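{- Let $\alpha > 0$ be a real number. If $\lambda(\alpha) < 3\alpha$, then $g(n) \ll_{\alpha} n^{\alpha}$; that is, there is a constant $K_\alpha>0$ depending only on $\alpha$ such that $g(n) \le K_\alpha\, n^{\alpha}$ for all positive integers $n$.
   Context: Write $[n] := \{1,2,\ldots,n\}$. A set $A$ of positive integers is called a multiplicative Sidon set if for all $a,b,c,d \in A$ (not necessarily distinct), $ab = cd$ implies the equality of sets $\{a,b\} = \{c,d\}$. For a positive integer $n$, $g(n)$ denotes the infimum of all real numbers $L$ such that there exists a multiplicative Sidon subset of $[n]$ which has non-empty intersection with every sub-interval $[x, x+L] \subseteq [1,n]$ of length $L$ (here $x$ is real). For a positive real number $\alpha$, $\lambda(\alpha)$ denotes the smallest non-negative real number such that, for all $\varepsilon > 0$ and all large enough $n$ (in terms of $\alpha$ and $\varepsilon$), the Lebesgue measure of the set of real $x \in [0,n]$ for which the interval $(x, x+x^{\alpha}]$ contains fewer than $5^{1/\alpha}$ primes is smaller than $n^{\lambda(\alpha)+\varepsilon}$. -}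

module Defs where

open import Algebra.Bundles using (CommutativeRing; Semiring)
open import Axiom.ExcludedMiddle using (ExcludedMiddle)
open import Data.Fin.Base using (toℕ)
open import Data.List.Base using (length)
open import Data.List.Membership.Propositional using () renaming (_∈_ to _∈ˡ_)
open import Data.List.Relation.Unary.Unique.Propositional using (Unique)
open import Data.Nat.Base as ℕ using (ℕ)
open import Data.Nat.Primality using (Prime)
open import Data.Product.Base using (_×_; _,_; proj₁; ∃; ∃-syntax; Σ-syntax)
open import Level using (0ℓ) renaming (suc to lsuc)
open import Relation.Binary.Core using (Rel)
open import Relation.Binary.PropositionalEquality.Core using (_≡_)
open import Relation.Binary.Structures using (IsTotalOrder)
open import Relation.Nullary.Decidable.Core using (yes; no)
open import Relation.Unary using (Pred; _∈_; _⊆_; _∪_; _≐_; ｛_｝)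

import Algebra.Definitions.RawSemiring as RawSemiringDefinitions
import Relation.Binary.Construct.NonStrictToStrict as NonStrictToStrict

module Bounds {A : Set} (_≤_ : Rel A 0ℓ) where

  UpperBound LowerBound : Pred A 0ℓ → Pred A 0ℓ
  UpperBound P u = ∀ {x} → x ∈ P → x ≤ u
  LowerBound P l = ∀ {x} → x ∈ P → l ≤ x

  IsLeast : Pred A 0ℓ → Pred A 0ℓ
  IsLeast P x = x ∈ P × x ∈ LowerBound P

-- The real numbers, given by the axioms that determine them up to unique
-- isomorphism.  The value of 0# ⁻¹ is unconstrained.

record CompleteOrderedField : Set (lsuc 0ℓ) where
  infix  9 _⁻¹
  infix  4 _≤_
  field
    commutativeRing : CommutativeRing 0ℓ 0ℓ

  open CommutativeRing commutativeRing public
    using (Carrier; _≈_; _≉_; _+_; _*_; -_; _-_; 0#; 1#; semiring)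

  field
    0≉1          : 0# ≉ 1#
    _⁻¹          : Carrier → Carrier
    *-inverseʳ   : ∀ {x} → x ≉ 0# → x * x ⁻¹ ≈ 1#
    _≤_          : Rel Carrier 0ℓ
    isTotalOrder : IsTotalOrder _≈_ _≤_
    +-monoˡ-≤    : ∀ z {x y} → x ≤ y → x + z ≤ y + z
    *-nonneg     : ∀ {x y} → 0# ≤ x → 0# ≤ y → 0# ≤ x * y

  open Bounds _≤_ public

  field
    complete : (P : Pred Carrier 0ℓ) → ∃ P → ∃ (UpperBound P) →
               ∃ (IsLeast (UpperBound P))

  open NonStrictToStrict _≈_ _≤_ public using (_<_)

IsMultiplicativeSidon : Pred ℕ 0ℓ → Set
IsMultiplicativeSidon A = ∀ {a b c d} → a ∈ A → b ∈ A → c ∈ A → d ∈ A →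
  a ℕ.* b ≡ c ℕ.* d → ｛ a ｝ ∪ ｛ b ｝ ≐ ｛ c ｝ ∪ ｛ d ｝

module Analysis (em : ExcludedMiddle 0ℓ) (R : CompleteOrderedField) where

  open CompleteOrderedField R public
    using (_≈_; _+_; _*_; _-_; 0#; 1#; _⁻¹; _≤_; _<_;
           UpperBound; LowerBound; IsLeast)
    renaming (Carrier to ℝ)

  open RawSemiringDefinitions
    (Semiring.rawSemiring (CompleteOrderedField.semiring R)) public
    using (sum) renaming (_×_ to _·_; _^_ to _^ⁿ_)

  fromℕ : ℕ → ℝ
  fromℕ n = n · 1#

  -- sup, inf and least take the junk value 0# when the supremum, infimum or
  -- least element does not exist.

  sup : Pred ℝ 0ℓ → ℝ
  sup P with em {∃ P × ∃ (UpperBound P)}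
  ... | yes (nonempty , bounded) = proj₁ (complete P nonempty bounded)
    where open CompleteOrderedField R using (complete)
  ... | no  _                    = 0#

  inf : Pred ℝ 0ℓ → ℝ
  inf P = sup (LowerBound P)

  least : Pred ℝ 0ℓ → ℝ
  least P with em {∃ (IsLeast P)}
  ... | yes (x , _) = x
  ... | no  _       = 0#

  -- Real powers x ^ a, intended for x ≥ 0 and a ≥ 0 only, with 0 ^ 0 = 1.
  -- For x ≥ 1, x ^ a is the supremum of the x ^ (m / k) over rationals
  -- 0 ≤ m / k ≤ a; for 0 ≤ x < 1 it is their infimum.  The root x ^ (m / k) is
  -- the largest y ≥ 0 with y ^ k ≤ x ^ m and the smallest with y ^ k ≥ x ^ m.

  infixr 8 _^_
  _^_ : ℝ → ℝ → ℝ
  x ^ a with em {1# ≤ x}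
  ... | yes _ = sup λ y → 0# ≤ y × ∃[ m ] ∃[ k ]
                  1 ℕ.≤ k × fromℕ m ≤ fromℕ k * a × y ^ⁿ k ≤ x ^ⁿ m
  ... | no  _ = inf λ y → 0# ≤ y × ∃[ m ] ∃[ k ]
                  1 ℕ.≤ k × fromℕ m ≤ fromℕ k * a × x ^ⁿ m ≤ y ^ⁿ k

  -- Lebesgue outer measure, for sets of finite outer measure: the infimum of
  -- the upper bounds for the total length of a countable cover by open
  -- intervals.  On measurable sets it is the Lebesgue measure; the sets
  -- measured below are finite unions of intervals.

  measure : Pred ℝ 0ℓ → ℝ
  measure S = inf λ ℓ → Σ[ a ∈ (ℕ → ℝ) ] Σ[ b ∈ (ℕ → ℝ) ]
    (∀ i → a i ≤ b i) ×
    (∀ {x} → x ∈ S → ∃[ i ] a i < x × x < b i) ×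
    (∀ N → sum {N} (λ i → b (toℕ i) - a (toℕ i)) ≤ ℓ)

  HasFewerThan : ℝ → Pred ℕ 0ℓ → Set
  HasFewerThan t S =
    ∃[ xs ] Unique xs × (_∈ˡ xs) ≐ S × fromℕ (length xs) < t

  PrimeIn⦅_,_] : ℝ → ℝ → Pred ℕ 0ℓ
  PrimeIn⦅ x , y ] p = Prime p × x < fromℕ p × fromℕ p ≤ y

  Exceptional : ℝ → ℕ → Pred ℝ 0ℓ
  Exceptional α n x = 0# ≤ x × x ≤ fromℕ n ×
    HasFewerThan (fromℕ 5 ^ α ⁻¹) PrimeIn⦅ x , x + x ^ α ]

  IsExceptionalExponent : ℝ → Pred ℝ 0ℓ
  IsExceptionalExponent α μ = 0# ≤ μ × (∀ ε → 0# < ε →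
    ∃[ N ] ∀ n → N ℕ.≤ n → measure (Exceptional α n) < fromℕ n ^ (μ + ε))

  -- λ(α)
  exceptionalExponent : ℝ → ℝ
  exceptionalExponent α = least (IsExceptionalExponent α)

  -- The list A stands for the finite set of its entries.
  IsSidonHitting : ℕ → Pred ℝ 0ℓ
  IsSidonHitting n L = 0# ≤ L × ∃[ A ]
    ((_∈ˡ A) ⊆ λ a → 1 ℕ.≤ a × a ℕ.≤ n) ×
    IsMultiplicativeSidon (_∈ˡ A) ×
    (∀ x → 1# ≤ x → x + L ≤ fromℕ n →
      ∃[ a ] a ∈ˡ A × x ≤ fromℕ a × fromℕ a ≤ x + L)

  g : ℕ → ℝ
  g n = inf (IsSidonHitting n)

module Submission where

-- Put γ = ⌈n^α⌉ and cut [1, n] into blocks of length 64 γ.  With k = ⌊1/α⌋, the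
-- first half of a block with fewer than 5^k primes consists of exceptional
-- points, so λ(α) < 3α leaves at most n^(2α-δ) such sparse blocks.
--
-- In every other block one of 5^k primes is chosen.  An integer up to n has at
-- most k prime factors beyond the first block, so by the method of conditional
-- expectations the choice can be made such that in every sparse block at least
-- half of the 16 γ candidates avoid all chosen primes: the 4^(8γk) sets of prime
-- factors of the candidates are outweighed by the 5^(8γk) ways to choose.
--
-- In the sparse blocks a candidate a lies in o(γ³) solutions of a b = c d, since
-- there are at most n^(2α-δ) · 16 γ choices for b, and c is one of the n^o(1)
-- divisors of a b.  It lies in few solutions of a b = c² as well: such c are
-- multiples of some e ≥ √a, and for a ≤ γ² residues modulo 4 keep c small.
-- Hence Rosenfeld's counting argument gives one candidate per sparse block such
-- that there are no solutions.  The chosen primes divide none of these candidates,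
-- so they can be added.

open import Defs
open import Axiom.ExcludedMiddle using (ExcludedMiddle)
open import Data.Nat.Base as ℕ using (ℕ)
open import Data.Product.Base using (_×_; ∃-syntax)
open import Level using (0ℓ)

-- In the counting argument a conflict with r chosen elements has weight β^(-r), where β is of order
-- γ. So a candidate may lie in order γ³ conflicts with three others, but only in order γ² conflicts
-- with two. The condition λ(α) < 3α serves the former: for m sparse blocks there are about m γ
-- n^o(1) of them, and m γ is bounded by the measure of the exceptional set. The obstacle is a b =
-- c²: counted by b, its solutions number m γ again, which may be far above γ². This forces the
-- separate treatment of small and large a.
--
-- In the choice of primes, 5^(8γk) against 4^(8γk) leaves a surplus (5/4)^(8γk), which pays for
-- treating all sparse blocks at once, as there are fewer than 2^γ of them. The blocks start at
-- their own length ℓ, so every chosen prime exceeds ℓ: it divides at most one candidate of a block,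
-- and k + 1 such primes cannot divide an integer up to n < ℓ^(k+1).
--
-- Real exponents are confined to the interface: an exponent ν < 3α for the measure and α itself are
-- replaced by fractions p/q and r/q, and the combinatorial part only compares powers of natural
-- numbers.

module Combinatorics where

  open import Data.Empty using (⊥-elim)
  open import Data.List.Base using (List; []; _∷_; [_]; _++_; map; length; filter; concat; upTo; take)
  open import Data.List.Membership.Propositional.Properties using (∈-++⁺ˡ; ∈-++⁺ʳ; ∈-map⁺; ∈-∃++; ∈-++⁻; ∈-upTo⁺; ∈-upTo⁻; ∈-map⁻; ∈-filter⁺; ∈-filter⁻; ∈-concat⁺′; ∈-concat⁻′)
  open import Data.List.Membership.Propositional using () renaming (_∈_ to _∈ˡ_; _∉_ to _∉ˡ_)
  open import Data.List.Properties using (length-++; length-map; length-upTo; length-take; length-filter; take++drop≡id)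
  open import Data.List.Relation.Binary.Disjoint.Propositional using (Disjoint)
  open import Data.List.Relation.Binary.Permutation.Propositional.Properties using (shift; ↭-length; All-resp-↭; ∈-resp-↭)
  import Data.List.Relation.Binary.Permutation.Propositional as Perm
  open import Data.List.Relation.Binary.Permutation.Propositional using (_↭_; ↭-refl; ↭-sym; prep; swap)
  open import Data.List.Relation.Binary.Pointwise using (Pointwise; []; _∷_)
  open import Data.List.Relation.Binary.Subset.Propositional using () renaming (_⊆_ to _⊆ˡ_)
  import Data.List.Relation.Unary.All.Properties as All
  import Data.List.Relation.Unary.AllPairs.Properties as AllPairs
  open import Data.List.Relation.Unary.AllPairs as AllPairs using (AllPairs; []; _∷_)
  open import Data.List.Relation.Unary.All as All using (All; []; _∷_)
  open import Data.List.Relation.Unary.Any using (here; there)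
  import Data.List.Relation.Unary.Unique.Propositional.Properties as Unique
  open import Data.List.Relation.Unary.Unique.Propositional using (Unique)
  open import Data.Nat.Base as ℕ using (ℕ; zero; suc; _+_; _*_; _∸_; _^_; _≤_; _<_; _/_; _%_; z≤n; s≤s; NonZero)
  open import Data.Nat.Coprimality as Coprimality using (Coprime; coprime-divisor; coprime-factors)
  open import Data.Nat.DivMod using (m≡m%n+[m/n]*n; m%n<n; m<n*o⇒m/o<n; m*n/n≡m; m/n*n≡m)
  open import Data.Nat.Divisibility
  open import Data.Nat.GCD using (gcd; gcd[m,n]∣m; gcd[m,n]∣n; gcd[m,n]≢0)
  open import Data.Nat.Induction using (<-rec)
  open import Data.Nat.Primality
  open import Data.Nat.Properties
  open import Data.Nat.Tactic.RingSolver using (solve-∀)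
  open import Data.Product.Base using (_×_; _,_; proj₁; proj₂)
  open import Data.Sum.Base using (_⊎_; inj₁; inj₂)
  open import Function.Base using (_∘_)
  open import Relation.Binary.Definitions using (tri<; tri≈; tri>)
  open import Relation.Binary.PropositionalEquality hiding ([_])
  open import Relation.Nullary using (¬_; yes; no; contradiction; ¬?)
  open import Relation.Unary using (Pred; Decidable; _≐_; _∪_; ｛_｝)

  -- The divisor bound

  ^-distribʳ-* : ∀ m n k → (m * n) ^ k ≡ m ^ k * n ^ k
  ^-distribʳ-* m n zero    = refl
  ^-distribʳ-* m n (suc k) rewrite ^-distribʳ-* m n k = shuffle m n (m ^ k) (n ^ k)
    where
    shuffle : ∀ a b c d → a * b * (c * d) ≡ a * c * (b * d)
    shuffle = solve-∀

  ^-positive : ∀ {m} k → 1 ≤ m → 1 ≤ m ^ k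
  ^-positive {m} k 1≤m = ≤-trans (≤-reflexive (sym (^-zeroˡ k))) (^-monoˡ-≤ k 1≤m)

  1+n≤2^n : ∀ n → suc n ≤ 2 ^ n
  1+n≤2^n zero    = ≤-refl
  1+n≤2^n (suc n) = begin
    suc (suc n)      ≡⟨ +-comm 1 (suc n) ⟩
    suc n + 1        ≤⟨ +-mono-≤ (1+n≤2^n n) (^-positive n (s≤s z≤n)) ⟩
    2 ^ n + 2 ^ n    ≡⟨ cong (2 ^ n +_) (sym (+-identityʳ _)) ⟩
    2 ^ suc n        ∎
    where open ≤-Reasoning

  -- Splitting n = r + q k with r < k gives n + 1 ≤ k (q + 1) ≤ k 2^q.
  [1+n]^k≤k^k*2^n : ∀ k .{{_ : NonZero k}} n → suc n ^ k ≤ k ^ k * 2 ^ n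
  [1+n]^k≤k^k*2^n k n = begin
    suc n ^ k                 ≤⟨ ^-monoˡ-≤ k 1+n≤ ⟩
    (k * 2 ^ q) ^ k           ≡⟨ ^-distribʳ-* k (2 ^ q) k ⟩
    k ^ k * (2 ^ q) ^ k       ≡⟨ cong (k ^ k *_) (^-*-assoc 2 q k) ⟩
    k ^ k * 2 ^ (q * k)       ≤⟨ *-monoʳ-≤ (k ^ k) (^-monoʳ-≤ 2 qk≤n) ⟩
    k ^ k * 2 ^ n             ∎
    where
    open ≤-Reasoning
    q = n / k
    qk≤n : q * k ≤ n
    qk≤n = ≤-trans (m≤n+m (q * k) (n % k)) (≤-reflexive (sym (m≡m%n+[m/n]*n n k)))
    1+n≤ : suc n ≤ k * 2 ^ q
    1+n≤ = begin
      suc n                  ≡⟨ cong suc (m≡m%n+[m/n]*n n k) ⟩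
      suc (n % k) + q * k    ≤⟨ +-monoˡ-≤ (q * k) (m%n<n n k) ⟩
      suc q * k              ≤⟨ *-monoˡ-≤ k (1+n≤2^n q) ⟩
      2 ^ q * k              ≡⟨ *-comm (2 ^ q) k ⟩
      k * 2 ^ q              ∎

  -- Repetitions and entries that are not divisors are harmless, as only the length of the list is
  -- bounded.
  ContainsDivisors : ℕ → List ℕ → Set
  ContainsDivisors N ds = ∀ {d} → d ∣ N → d ∈ˡ ds

  ∤⇒coprime : ∀ {p d} → Prime p → ¬ p ∣ d → Coprime d p
  ∤⇒coprime {p} {d} pp p∤d {i} (i∣d , i∣p) with prime⇒irreducible pp i∣p
  ... | inj₁ i≡1  = i≡1
  ... | inj₂ refl = ⊥-elim (p∤d i∣d)

  primePowerDivisors : ℕ → List ℕ → ℕ → List ℕ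
  primePowerDivisors p ds zero    = ds
  primePowerDivisors p ds (suc e) = ds ++ map (p *_) (primePowerDivisors p ds e)

  length-primePowerDivisors : ∀ p ds e → length (primePowerDivisors p ds e) ≡ suc e * length ds
  length-primePowerDivisors p ds zero    = sym (+-identityʳ _)
  length-primePowerDivisors p ds (suc e) = trans (length-++ ds)
    (cong (length ds +_) (trans (length-map (p *_) (primePowerDivisors p ds e)) (length-primePowerDivisors p ds e)))

  coprime-prime-power : ∀ {p d N} → Prime p → ¬ p ∣ d → ∀ e → d ∣ p ^ e * N → d ∣ N
  coprime-prime-power         pp p∤d zero    d∣ = subst (_ ∣_) (+-identityʳ _) d∣
  coprime-prime-power {p} {d} {N} pp p∤d (suc e) d∣ = coprime-prime-power pp p∤d e
    (coprime-divisor (∤⇒coprime pp p∤d) (subst (d ∣_) (*-assoc p (p ^ e) N) d∣))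

  containsDivisors-primePower : ∀ {p N ds} → Prime p → ContainsDivisors N ds →
    ∀ e → ContainsDivisors (p ^ e * N) (primePowerDivisors p ds e)
  containsDivisors-primePower {p} {N} {ds} pp N-ds zero {d} d∣ = N-ds (subst (d ∣_) (+-identityʳ N) d∣)
  containsDivisors-primePower {p} {N} {ds} pp N-ds (suc e) {d} d∣ with p ∣? d
  ... | no  p∤d = ∈-++⁺ˡ (N-ds (coprime-prime-power pp p∤d (suc e) d∣))
  ... | yes (divides q refl) = ∈-++⁺ʳ ds (subst (_∈ˡ map (p *_) (primePowerDivisors p ds e)) (*-comm p q)
      (∈-map⁺ (p *_) (containsDivisors-primePower pp N-ds e q∣)))
    where
    instance _ = prime⇒nonZero pp
    q∣ : q ∣ p ^ e * N
    q∣ = *-cancelˡ-∣ p (subst₂ _∣_ (*-comm q p) (*-assoc p (p ^ e) N) d∣)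

  exists-prime-divisor : ∀ N → 2 ≤ N → ∃[ p ] Prime p × p ∣ N
  exists-prime-divisor = <-rec _ go
    where
    go : ∀ N → (∀ {M} → M < N → 2 ≤ M → ∃[ p ] Prime p × p ∣ M) → 2 ≤ N → ∃[ p ] Prime p × p ∣ N
    go N rec 2≤N with composite? N
    ... | no ¬c = N , prime {{ℕ.n>1⇒nonTrivial 2≤N}} ¬c , ∣-refl
    ... | yes (hasNonTrivialDivisor {d} {{nt}} d<N d∣N) =
      let p , pp , p∣d = rec d<N (ℕ.nonTrivial⇒n>1 d {{nt}}) in p , pp , ∣-trans p∣d d∣N

  strip : ∀ p → 2 ≤ p → ∀ N → 1 ≤ N → ∃[ e ] ∃[ M ] N ≡ p ^ e * M × ¬ p ∣ M
  strip p 2≤p = <-rec _ go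
    where
    go : ∀ N → (∀ {M} → M < N → 1 ≤ M → ∃[ e ] ∃[ M′ ] M ≡ p ^ e * M′ × ¬ p ∣ M′) →
         1 ≤ N → ∃[ e ] ∃[ M ] N ≡ p ^ e * M × ¬ p ∣ M
    go N rec 1≤N with p ∣? N
    ... | no p∤N = 0 , N , sym (+-identityʳ N) , p∤N
    go .(0 * p) rec () | yes (divides zero refl)
    go .(suc q * p) rec 1≤N | yes (divides (suc q) refl) =
      let e , M , eq , p∤M = rec (m<m*n (suc q) p 2≤p) (s≤s z≤n)
      in suc e , M , trans (cong (_* p) eq) (trans (*-comm (p ^ e * M) p) (sym (*-assoc p (p ^ e) M))) , p∤M

  module _ (k : ℕ) .{{_ : NonZero k}} where

    private
      PrimeFactorsBelow : ℕ → ℕ → Set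
      PrimeFactorsBelow i N = ∀ {p} → Prime p → p ∣ N → 2 ^ k ≤ p + i

      Bound : ℕ → ℕ → Set
      Bound i N = ∃[ ds ] ContainsDivisors N ds × length ds ^ k ≤ (k ^ k) ^ i * N

      -- The one new candidate for a prime factor is q = 2^k - (i + 1). If q^e is split off, the
      -- number of divisors gains a factor e + 1, and (e + 1)^k ≤ k^k 2^e ≤ k^k q^e.
      bound-suc : ∀ {i} → (∀ N → 1 ≤ N → PrimeFactorsBelow i N → Bound i N) →
                  ∀ N → 1 ≤ N → PrimeFactorsBelow (suc i) N → Bound (suc i) N
      bound-suc {i} ih N 1≤N rough with prime? (2 ^ k ∸ suc i)
      ... | no ¬prime = let ds , N-ds , ds≤ = ih N 1≤N rough′ in ds , N-ds , (begin
          length ds ^ k                 ≤⟨ ds≤ ⟩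
          (k ^ k) ^ i * N               ≤⟨ *-monoˡ-≤ N (m≤n*m ((k ^ k) ^ i) (k ^ k)) ⟩
          (k ^ k) ^ suc i * N           ∎)
        where
        open ≤-Reasoning
        instance _ = m^n≢0 k k
        rough′ : PrimeFactorsBelow i N
        rough′ {p} pp p∣N with m≤n⇒m<n∨m≡n (rough pp p∣N)
        ... | inj₁ Q< = ≤-pred (≤-trans Q< (≤-reflexive (+-suc p i)))
        ... | inj₂ Q≡ = ⊥-elim (¬prime (subst Prime (sym (trans (cong (_∸ suc i) Q≡) (m+n∸n≡m p (suc i)))) pp))
      ... | yes qp with strip (2 ^ k ∸ suc i) (ℕ.nonTrivial⇒n>1 _ {{prime⇒nonTrivial qp}}) N 1≤N
      ... | e , M , refl , q∤M =
        let ds , M-ds , ds≤ = ih M 1≤M rough′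
        in primePowerDivisors q ds e , containsDivisors-primePower qp M-ds e , (begin
          length (primePowerDivisors q ds e) ^ k     ≡⟨ cong (_^ k) (length-primePowerDivisors q ds e) ⟩
          (suc e * length ds) ^ k                    ≡⟨ ^-distribʳ-* (suc e) (length ds) k ⟩
          suc e ^ k * length ds ^ k                  ≤⟨ *-mono-≤ (≤-trans ([1+n]^k≤k^k*2^n k e)
                                                         (*-monoʳ-≤ (k ^ k) (^-monoˡ-≤ e 2≤q))) ds≤ ⟩
          k ^ k * q ^ e * ((k ^ k) ^ i * M)          ≡⟨ shuffle (k ^ k) (q ^ e) ((k ^ k) ^ i) M ⟩
          (k ^ k) ^ suc i * (q ^ e * M)              ∎)
        where
        open ≤-Reasoning
        q = 2 ^ k ∸ suc i
        2≤q : 2 ≤ q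
        2≤q = ℕ.nonTrivial⇒n>1 _ {{prime⇒nonTrivial qp}}
        shuffle : ∀ a b c d → a * b * (c * d) ≡ a * c * (b * d)
        shuffle = solve-∀
        1≤M : 1 ≤ M
        1≤M = n≢0⇒n>0 λ { refl → q∤M (q ∣0) }
        rough′ : PrimeFactorsBelow i M
        rough′ {p} pp p∣M with m≤n⇒m<n∨m≡n (rough pp (∣n⇒∣m*n (q ^ e) p∣M))
        ... | inj₁ Q< = ≤-pred (≤-trans Q< (≤-reflexive (+-suc p i)))
        ... | inj₂ Q≡ = ⊥-elim (q∤M (subst (_∣ M) (sym (trans (cong (_∸ suc i) Q≡) (m+n∸n≡m p (suc i)))) p∣M))

      -- A prime p ≥ 2^k is split off once, whatever its multiplicity: the list doubles, and 2^k ≤ p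
      -- pays for that.
      bound-zero : ∀ N → 1 ≤ N → PrimeFactorsBelow 0 N → Bound 0 N
      bound-zero = <-rec _ go
        where
        go : ∀ N → (∀ {M} → M < N → 1 ≤ M → PrimeFactorsBelow 0 M → Bound 0 M) →
             1 ≤ N → PrimeFactorsBelow 0 N → Bound 0 N
        go 1 rec 1≤N rough = [ 1 ] , (λ d∣1 → here (∣1⇒≡1 d∣1)) , ≤-reflexive (^-zeroˡ k)
        go N@(suc (suc _)) rec 1≤N rough with exists-prime-divisor N (s≤s (s≤s z≤n))
        ... | p , pp , divides (suc M′) eq =
          let ds , M-ds , ds≤ = rec M<N (s≤s z≤n) (λ {r} rp r∣M → rough rp (subst (r ∣_) (sym eq) (∣m⇒∣m*n p r∣M)))
          in primePowerDivisors p ds 1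
           , (λ {d} d∣N → containsDivisors-primePower pp M-ds 1 (subst (d ∣_) N≡ d∣N)) , (begin
             length (primePowerDivisors p ds 1) ^ k  ≡⟨ cong (_^ k) (length-primePowerDivisors p ds 1) ⟩
             (2 * length ds) ^ k                     ≡⟨ ^-distribʳ-* 2 (length ds) k ⟩
             2 ^ k * length ds ^ k                   ≤⟨ *-mono-≤ (≤-trans (rough pp (divides (suc M′) eq)) (≤-reflexive (+-identityʳ p))) ds≤ ⟩
             p * (1 * M)                             ≡⟨ cong (p *_) (*-identityˡ M) ⟩
             p * M                                   ≡⟨ trans (*-comm p M) (sym eq) ⟩
             N                                       ≡⟨ *-identityˡ N ⟨
             1 * N                                   ∎)
          where
          open ≤-Reasoning
          M = suc M′
          M<N : M < N
          M<N = subst (M <_) (sym eq) (m<m*n M p (ℕ.nonTrivial⇒n>1 _ {{prime⇒nonTrivial pp}}))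
          N≡ : N ≡ p ^ 1 * M
          N≡ = trans eq (trans (*-comm M p) (cong (_* M) (sym (^-identityʳ p))))

      bound : ∀ i N → 1 ≤ N → PrimeFactorsBelow i N → Bound i N
      bound zero    = bound-zero
      bound (suc i) = bound-suc (bound i)

    -- For i = 2^k there is no restriction on the prime factors. As k is arbitrary, this is the
    -- bound N^o(1) for the number of divisors.
    divisor-bound : ∃[ C ] ∀ N → 1 ≤ N → ∃[ ds ] ContainsDivisors N ds × length ds ^ k ≤ C * N
    divisor-bound = (k ^ k) ^ (2 ^ k) , λ N 1≤N → bound (2 ^ k) N 1≤N (λ {p} _ _ → m≤n+m (2 ^ k) p)

  -- Independent transversals

  module _ {A : Set} where

    ∑ : List A → (A → ℕ) → ℕ
    ∑ []       f = 0
    ∑ (x ∷ xs) f = f x + ∑ xs f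

    ∑-mono : ∀ xs {f g} → (∀ {x} → x ∈ˡ xs → f x ≤ g x) → ∑ xs f ≤ ∑ xs g
    ∑-mono []       f≤g = z≤n
    ∑-mono (x ∷ xs) f≤g = +-mono-≤ (f≤g (here refl)) (∑-mono xs (f≤g ∘ there))

    ∑-cong : ∀ xs {f g} → (∀ x → f x ≡ g x) → ∑ xs f ≡ ∑ xs g
    ∑-cong []       f≡g = refl
    ∑-cong (x ∷ xs) f≡g = cong₂ _+_ (f≡g x) (∑-cong xs f≡g)

    ∑-+ : ∀ xs {f g} → ∑ xs (λ x → f x + g x) ≡ ∑ xs f + ∑ xs g
    ∑-+ []       = refl
    ∑-+ (x ∷ xs) {f} {g} rewrite ∑-+ xs {f} {g} = shuffle (f x) (g x) (∑ xs f) (∑ xs g)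
      where
      shuffle : ∀ a b c d → a + b + (c + d) ≡ a + c + (b + d)
      shuffle = solve-∀

    ∑-* : ∀ c xs {f} → ∑ xs (λ x → c * f x) ≡ c * ∑ xs f
    ∑-* c []           = sym (*-zeroʳ c)
    ∑-* c (x ∷ xs) {f} = trans (cong (c * f x +_) (∑-* c xs)) (sym (*-distribˡ-+ c (f x) (∑ xs f)))

    ∑-const : ∀ c xs → ∑ xs (λ _ → c) ≡ length xs * c
    ∑-const c []       = refl
    ∑-const c (x ∷ xs) = cong (c +_) (∑-const c xs)

    ∑-≤-const : ∀ c xs {f} → (∀ {x} → x ∈ˡ xs → f x ≤ c) → ∑ xs f ≤ length xs * c
    ∑-≤-const c xs f≤c = ≤-trans (∑-mono xs f≤c) (≤-reflexive (∑-const c xs))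

    ∑-≥-term : ∀ {x} xs {f} → x ∈ˡ xs → f x ≤ ∑ xs f
    ∑-≥-term (x ∷ xs) {f} (here refl) = m≤m+n (f x) _
    ∑-≥-term (y ∷ xs) {f} (there x∈)  = ≤-trans (∑-≥-term xs x∈) (m≤n+m _ (f y))

  ∑-swap : ∀ {A B : Set} (xs : List A) (ys : List B) {f : A → B → ℕ} →
           ∑ xs (λ x → ∑ ys (f x)) ≡ ∑ ys (λ y → ∑ xs (λ x → f x y))
  ∑-swap []       ys     = sym (trans (∑-const 0 ys) (*-zeroʳ (length ys)))
  ∑-swap (x ∷ xs) ys {f} = trans (cong (∑ ys (f x) +_) (∑-swap xs ys)) (sym (∑-+ ys))

  module _ {A : Set} where

    Choice : List (List A) → List A → Set
    Choice Cs xs = Pointwise _∈ˡ_ xs Cs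

    choice-∈ : ∀ {Cs : List (List A)} {xs b} → Choice Cs xs → b ∈ˡ xs → ∃[ C ] C ∈ˡ Cs × b ∈ˡ C
    choice-∈ (a∈C ∷ _) (here refl) = _ , here refl , a∈C
    choice-∈ (_ ∷ ch)  (there b∈)  = let C , C∈ , b∈C = choice-∈ ch b∈ in C , there C∈ , b∈C

    choice-∋ : ∀ {Cs : List (List A)} {xs C} → Choice Cs xs → C ∈ˡ Cs → ∃[ b ] b ∈ˡ xs × b ∈ˡ C
    choice-∋ (a∈C ∷ _) (here refl) = _ , here refl , a∈C
    choice-∋ (_ ∷ ch)  (there C∈)  = let b , b∈ , b∈C = choice-∋ ch C∈ in b , there b∈ , b∈C

    -- Applied to an indicator this counts the transversals with a given property.
    ∑ᶜ : List (List A) → (List A → ℕ) → ℕ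
    ∑ᶜ []       w = w []
    ∑ᶜ (C ∷ Cs) w = ∑ C λ a → ∑ᶜ Cs λ xs → w (a ∷ xs)

    ∑ᶜ-mono : ∀ Cs {v w} → (∀ {xs} → Choice Cs xs → v xs ≤ w xs) → ∑ᶜ Cs v ≤ ∑ᶜ Cs w
    ∑ᶜ-mono []       v≤w = v≤w []
    ∑ᶜ-mono (C ∷ Cs) v≤w = ∑-mono C λ a∈C → ∑ᶜ-mono Cs λ ch → v≤w (a∈C ∷ ch)

    ∑ᶜ-cong : ∀ Cs {v w} → (∀ xs → v xs ≡ w xs) → ∑ᶜ Cs v ≡ ∑ᶜ Cs w
    ∑ᶜ-cong []       v≡w = v≡w []
    ∑ᶜ-cong (C ∷ Cs) v≡w = ∑-cong C λ a → ∑ᶜ-cong Cs λ xs → v≡w (a ∷ xs)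

    ∑ᶜ-+ : ∀ Cs {v w} → ∑ᶜ Cs (λ xs → v xs + w xs) ≡ ∑ᶜ Cs v + ∑ᶜ Cs w
    ∑ᶜ-+ []       = refl
    ∑ᶜ-+ (C ∷ Cs) = trans (∑-cong C λ a → ∑ᶜ-+ Cs) (∑-+ C)

    ∑ᶜ-∑ : ∀ {E : Set} Cs (es : List E) {w : E → List A → ℕ} →
           ∑ᶜ Cs (λ xs → ∑ es (λ e → w e xs)) ≡ ∑ es (λ e → ∑ᶜ Cs (w e))
    ∑ᶜ-∑ []       es = refl
    ∑ᶜ-∑ (C ∷ Cs) es = trans (∑-cong C λ a → ∑ᶜ-∑ Cs es) (∑-swap C es)

    ∑ᶜ-zero : ∀ Cs → ∑ᶜ Cs (λ _ → 0) ≡ 0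
    ∑ᶜ-zero []       = refl
    ∑ᶜ-zero (C ∷ Cs) = trans (∑-cong C λ _ → ∑ᶜ-zero Cs) (trans (∑-const 0 C) (*-zeroʳ (length C)))

    -- Lets `hit-count` bring the class of a given element to the front.
    ∑ᶜ-↭ : ∀ {Cs Ds w} → (∀ {xs ys} → xs ↭ ys → w xs ≡ w ys) → Cs ↭ Ds → ∑ᶜ Cs w ≡ ∑ᶜ Ds w
    ∑ᶜ-↭ w-resp Perm.refl = refl
    ∑ᶜ-↭ w-resp (prep C p) = ∑-cong C λ a → ∑ᶜ-↭ (w-resp ∘ prep a) p
    ∑ᶜ-↭ {_} {_ ∷ _ ∷ Ds} w-resp (swap C D p) = trans
      (∑-cong C λ a → ∑-cong D λ b → trans (∑ᶜ-↭ (λ q → w-resp (prep a (prep b q))) p)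
                                           (∑ᶜ-cong Ds λ xs → w-resp (swap a b ↭-refl)))
      (∑-swap C D)
    ∑ᶜ-↭ w-resp (Perm.trans p q) = trans (∑ᶜ-↭ w-resp p) (∑ᶜ-↭ w-resp q)

    allPairs-↭ : ∀ {R : A → A → Set} {xs ys} → (∀ {x y} → R x y → R y x) → xs ↭ ys → AllPairs R xs → AllPairs R ys
    allPairs-↭ R-sym Perm.refl        rs                      = rs
    allPairs-↭ R-sym (prep x p)       (r ∷ rs)                = All-resp-↭ p r ∷ allPairs-↭ R-sym p rs
    allPairs-↭ R-sym (swap x y p)     ((xy ∷ rx) ∷ ry ∷ rs)   =
      (R-sym xy ∷ All-resp-↭ p ry) ∷ All-resp-↭ p rx ∷ allPairs-↭ R-sym p rs
    allPairs-↭ R-sym (Perm.trans p q) rs                      = allPairs-↭ R-sym q (allPairs-↭ R-sym p rs)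

    ∈⇒↭∷ : ∀ {x : A} {xs} → x ∈ˡ xs → ∃[ ys ] xs ↭ x ∷ ys
    ∈⇒↭∷ {x} x∈ with ∈-∃++ x∈
    ... | ys , zs , refl = ys ++ zs , shift x ys zs

  module Indicator (em : ExcludedMiddle 0ℓ) where

    𝟙 : Set → ℕ
    𝟙 P with em {P}
    ... | yes _ = 1
    ... | no  _ = 0

    𝟙-yes : ∀ {P} → P → 𝟙 P ≡ 1
    𝟙-yes {P} p with em {P}
    ... | yes _ = refl
    ... | no ¬p = contradiction p ¬p

    𝟙-no : ∀ {P} → ¬ P → 𝟙 P ≡ 0
    𝟙-no {P} ¬p with em {P}
    ... | yes p = contradiction p ¬p
    ... | no  _ = refl

    𝟙-mono : ∀ {P Q} → (P → Q) → 𝟙 P ≤ 𝟙 Q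
    𝟙-mono {P} P⇒Q with em {P}
    ... | yes p = ≤-reflexive (sym (𝟙-yes (P⇒Q p)))
    ... | no  _ = z≤n

    𝟙-≤ : ∀ {P n} → (P → 1 ≤ n) → 𝟙 P ≤ n
    𝟙-≤ {P} P⇒1≤n with em {P}
    ... | yes p = P⇒1≤n p
    ... | no  _ = z≤n

    𝟙-cong : ∀ {P Q} → (P → Q) → (Q → P) → 𝟙 P ≡ 𝟙 Q
    𝟙-cong f g = ≤-antisym (𝟙-mono f) (𝟙-mono g)

    𝟙≤1 : ∀ P → 𝟙 P ≤ 1
    𝟙≤1 P = 𝟙-≤ λ _ → ≤-refl

    ∑-𝟙≡ : ∀ {A : Set} {b : A} {xs} → Unique xs → ∑ xs (λ a → 𝟙 (a ≡ b)) ≤ 1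
    ∑-𝟙≡ [] = z≤n
    ∑-𝟙≡ {b = b} {xs = a ∷ xs} (a≢ ∷ u) with em {a ≡ b}
    ... | no  _    = ∑-𝟙≡ u
    ... | yes refl = s≤s (≤-trans (∑-≤-const 0 xs λ {x} x∈ → ≤-reflexive (𝟙-no λ { refl → All.lookup a≢ x∈ refl }))
                                  (≤-reflexive (*-zeroʳ (length xs))))

  -- Rosenfeld's counting argument: every further class multiplies the number of
  -- conflict-free choices by at least β, since a conflict of the new element with
  -- r chosen ones uses up r classes, and by induction costs a factor β ^ r.
  module Transversal (em : ExcludedMiddle 0ℓ)
    (Ok : List ℕ → Set) (ok-[] : Ok []) (ok-⊆ : ∀ {xs ys} → xs ⊆ˡ ys → Ok ys → Ok xs)
    (β : ℕ) (1≤β : 1 ≤ β) (V : ℕ → Set) (E₂ E₃ : ℕ → List (List ℕ)) where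

    open Indicator em

    -- The r entries have to be distinct so that they occupy r different classes, which is what
    -- gives the full factor β^r.
    Hit : ℕ → List ℕ → List ℕ → Set
    Hit r e xs = length e ≡ r × Unique e × e ⊆ˡ xs

    Conflict : ℕ → List ℕ → Set
    Conflict a xs = (∃[ e ] e ∈ˡ E₂ a × Hit 2 e xs) ⊎ (∃[ e ] e ∈ˡ E₃ a × Hit 3 e xs)

    GoodClass : List ℕ → Set
    GoodClass C = Unique C × 2 * β ≤ length C × All V C

    Admissible : List (List ℕ) → Set
    Admissible Cs = All GoodClass Cs × AllPairs Disjoint Cs

    module _
      -- Divided by 2 β^3 this says |E₂| / β^2 + |E₃| / β^3 ≤ 1/2: conflicts destroy at most half of
      -- the extensions by a, and a class has at least 2 β elements.
      (few-edges : ∀ {a} → V a → 2 * (length (E₂ a) * β + length (E₃ a)) ≤ β ^ 3)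
      (conflict : ∀ {a xs} → V a → All V xs → Ok xs → ¬ Ok (a ∷ xs) → Conflict a xs) where

      private
        N : List (List ℕ) → ℕ
        N Cs = ∑ᶜ Cs λ xs → 𝟙 (Ok xs)

        admissible-↭ : ∀ {Cs Ds} → Cs ↭ Ds → Admissible Cs → Admissible Ds
        admissible-↭ p (good , disjoint) = All-resp-↭ p good
          , allPairs-↭ (λ d (x , y) → d (y , x)) p disjoint

        admissible-tail : ∀ {C Cs} → Admissible (C ∷ Cs) → Admissible Cs
        admissible-tail (_ ∷ good , _ ∷ disjoint) = good , disjoint

        choice-V : ∀ {Cs xs} → Admissible Cs → Choice Cs xs → All V xs
        choice-V adm []         = []
        choice-V adm@((_ , _ , VC) ∷ _ , _) (a∈C ∷ ch) = All.lookup VC a∈C ∷ choice-V (admissible-tail adm) ch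

        Growth : List (List ℕ) → List ℕ → Set
        Growth Cs C = Admissible (C ∷ Cs) → β * N Cs ≤ N (C ∷ Cs)

        N-↭ : ∀ {Cs Ds} → Cs ↭ Ds → N Cs ≡ N Ds
        N-↭ = ∑ᶜ-↭ λ p → 𝟙-cong (ok-⊆ (∈-resp-↭ (↭-sym p))) (ok-⊆ (∈-resp-↭ p))

        OkHit : ℕ → List ℕ → List ℕ → Set
        OkHit r e xs = Ok xs × Hit r e xs

        okHit-resp : ∀ {r e xs ys} → xs ↭ ys → OkHit r e xs → OkHit r e ys
        okHit-resp p (ok , l , u , e⊆) = ok-⊆ (∈-resp-↭ (↭-sym p)) ok , l , u , ∈-resp-↭ p ∘ e⊆

        -- The class C of the first entry b is moved to the front, where the choice must be b; this
        -- leaves at most as many choices as the other classes allow for the remaining entries.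
        -- Growth from `Ds` to `C ∷ Ds` then yields one factor β per entry. If b lies in no class,
        -- nothing is counted.
        hit-count : ∀ {n} → (∀ {Cs C} → length (C ∷ Cs) ≤ n → Growth Cs C) → ∀ r e Cs → length Cs ≤ n →
                    Admissible Cs → β ^ r * ∑ᶜ Cs (λ xs → 𝟙 (OkHit r e xs)) ≤ N Cs
        hit-count ih zero e Cs _ adm = ≤-trans (≤-reflexive (*-identityˡ _)) (∑ᶜ-mono Cs λ ch → 𝟙-mono proj₁)
        hit-count ih (suc r) [] Cs _ adm = ≤-trans (*-monoʳ-≤ (β ^ suc r) (∑ᶜ-mono Cs {w = λ _ → 0} λ ch → 𝟙-≤ λ { (_ , () , _) }))
          (≤-trans (≤-reflexive (trans (cong (β ^ suc r *_) (∑ᶜ-zero Cs)) (*-zeroʳ (β ^ suc r)))) z≤n)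
        hit-count ih (suc r) (b ∷ e) Cs len adm with em {∃[ C ] C ∈ˡ Cs × b ∈ˡ C}
        ... | no b∉ = ≤-trans (*-monoʳ-≤ (β ^ suc r) (∑ᶜ-mono Cs {w = λ _ → 0} λ ch → 𝟙-≤ λ { (_ , _ , _ , e⊆) →
                contradiction (choice-∈ ch (e⊆ (here refl))) b∉ }))
                (≤-trans (≤-reflexive (trans (cong (β ^ suc r *_) (∑ᶜ-zero Cs)) (*-zeroʳ (β ^ suc r)))) z≤n)
        ... | yes (C , C∈ , b∈C) with ∈⇒↭∷ C∈
        ... | Ds , p = begin
          β ^ suc r * ∑ᶜ Cs (λ xs → 𝟙 (OkHit (suc r) (b ∷ e) xs))          ≡⟨ cong (β ^ suc r *_) (∑ᶜ-↭ okHit-resp≡ p) ⟩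
          β ^ suc r * ∑ᶜ (C ∷ Ds) (λ xs → 𝟙 (OkHit (suc r) (b ∷ e) xs))    ≤⟨ *-monoʳ-≤ (β ^ suc r) count≤T ⟩
          β * β ^ r * T                                                    ≡⟨ *-assoc β (β ^ r) T ⟩
          β * (β ^ r * T)                                                  ≤⟨ *-monoʳ-≤ β (hit-count ih r e Ds len-Ds admDs) ⟩
          β * N Ds                                                         ≤⟨ ih len-C∷Ds admC∷Ds ⟩
          N (C ∷ Ds)                                                       ≡⟨ N-↭ p ⟨
          N Cs                                                             ∎
          where
          open ≤-Reasoning
          T = ∑ᶜ Ds (λ xs → 𝟙 (OkHit r e xs))
          admC∷Ds = admissible-↭ p adm
          admDs = admissible-tail admC∷Ds
          len-C∷Ds = ≤-trans (≤-reflexive (sym (↭-length p))) len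
          len-Ds = ≤-trans (n≤1+n (length Ds)) len-C∷Ds
          okHit-resp≡ : ∀ {xs ys} → xs ↭ ys → 𝟙 (OkHit (suc r) (b ∷ e) xs) ≡ 𝟙 (OkHit (suc r) (b ∷ e) ys)
          okHit-resp≡ q = 𝟙-cong (okHit-resp q) (okHit-resp (↭-sym q))
          hit-tail : ∀ {a xs} → a ∈ˡ C → Choice Ds xs → OkHit (suc r) (b ∷ e) (a ∷ xs) → a ≡ b × OkHit r e xs
          hit-tail {a} {xs} a∈C ch (ok , l , b∉e ∷ u , e⊆) = a≡b , ok-⊆ there ok , suc-injective l , u , e⊆xs
            where
            b∉xs : b ∉ˡ xs
            b∉xs b∈xs = let D , D∈ , b∈D = choice-∈ ch b∈xs
                        in All.lookup (AllPairs.head (proj₂ admC∷Ds)) D∈ (b∈C , b∈D)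
            a≡b : a ≡ b
            a≡b with e⊆ (here refl)
            ... | here b≡a  = sym b≡a
            ... | there b∈ = contradiction b∈ b∉xs
            e⊆xs : e ⊆ˡ xs
            e⊆xs x∈e with e⊆ (there x∈e)
            ... | here refl  = contradiction (sym a≡b) (All.lookup b∉e x∈e)
            ... | there x∈xs = x∈xs
          class-term : ∀ {a} → a ∈ˡ C → ∑ᶜ Ds (λ xs → 𝟙 (OkHit (suc r) (b ∷ e) (a ∷ xs))) ≤ T * 𝟙 (a ≡ b)
          class-term {a} a∈C with em {a ≡ b}
          ... | yes a≡b = ≤-trans (∑ᶜ-mono Ds λ ch → 𝟙-mono (proj₂ ∘ hit-tail a∈C ch)) (≤-reflexive (sym (*-identityʳ T)))
          ... | no  a≢b = ≤-trans (∑ᶜ-mono Ds {w = λ _ → 0} λ ch → 𝟙-≤ λ h → contradiction (proj₁ (hit-tail a∈C ch h)) a≢b)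
                                  (≤-trans (≤-reflexive (∑ᶜ-zero Ds)) z≤n)
          count≤T : ∑ᶜ (C ∷ Ds) (λ xs → 𝟙 (OkHit (suc r) (b ∷ e) xs)) ≤ T
          count≤T = begin
            ∑ C (λ a → ∑ᶜ Ds (λ xs → 𝟙 (OkHit (suc r) (b ∷ e) (a ∷ xs))))  ≤⟨ ∑-mono C class-term ⟩
            ∑ C (λ a → T * 𝟙 (a ≡ b))                                      ≡⟨ ∑-* T C ⟩
            T * ∑ C (λ a → 𝟙 (a ≡ b))                                      ≤⟨ *-monoʳ-≤ T (∑-𝟙≡ (proj₁ (All.head (proj₁ admC∷Ds)))) ⟩
            T * 1                                                          ≡⟨ *-identityʳ T ⟩
            T                                                              ∎

        -- Each a in C extends at least half of the choices from `Cs`, and C has at least 2 β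
        -- elements. The induction is on a bound n for the number of classes, because `hit-count`
        -- needs growth for rearrangements of `Cs`.
        growth : ∀ n {Cs C} → length (C ∷ Cs) ≤ n → Growth Cs C
        growth (suc n) {Cs} {C} (s≤s len) adm = *-cancelˡ-≤ 2 (begin
          2 * (β * N Cs)      ≡⟨ *-assoc 2 β (N Cs) ⟨
          2 * β * N Cs        ≤⟨ *-monoˡ-≤ (N Cs) (proj₁ (proj₂ (All.head (proj₁ adm)))) ⟩
          length C * N Cs     ≡⟨ ∑-const (N Cs) C ⟨
          ∑ C (λ _ → N Cs)    ≤⟨ ∑-mono C extensions ⟩
          ∑ C (λ a → 2 * ∑ᶜ Cs (λ xs → 𝟙 (Ok (a ∷ xs))))  ≡⟨ ∑-* 2 C ⟩
          2 * N (C ∷ Cs)      ∎)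
          where
          open ≤-Reasoning
          adm′ = admissible-tail adm
          hits : ∀ r e → β ^ r * ∑ᶜ Cs (λ xs → 𝟙 (OkHit r e xs)) ≤ N Cs
          hits r e = hit-count (growth n) r e Cs len adm′
          extensions : ∀ {a} → a ∈ˡ C → N Cs ≤ 2 * ∑ᶜ Cs (λ xs → 𝟙 (Ok (a ∷ xs)))
          -- The term β^3 N Cs is added on both sides, so that the lost choices need not be
          -- subtracted.
          extensions {a} a∈C = *-cancelˡ-≤ (β ^ 3) {{ℕ.>-nonZero (^-positive 3 1≤β)}} (+-cancelʳ-≤ (β ^ 3 * N Cs) _ _ (begin
            β ^ 3 * N Cs + β ^ 3 * N Cs                        ≡⟨ double (β ^ 3 * N Cs) ⟩
            2 * (β ^ 3 * N Cs)                                 ≤⟨ *-monoʳ-≤ 2 (*-monoʳ-≤ (β ^ 3) split) ⟩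
            2 * (β ^ 3 * (Nₐ + (S 2 (E₂ a) + S 3 (E₃ a))))     ≡⟨ expand β Nₐ (S 2 (E₂ a)) (S 3 (E₃ a)) ⟩
            β ^ 3 * (2 * Nₐ) + 2 * (β * (β ^ 2 * S 2 (E₂ a)) + β ^ 3 * S 3 (E₃ a))
              ≤⟨ +-monoʳ-≤ (β ^ 3 * (2 * Nₐ)) (*-monoʳ-≤ 2 (+-mono-≤ (*-monoʳ-≤ β (S≤ 2 (E₂ a))) (S≤ 3 (E₃ a)))) ⟩
            β ^ 3 * (2 * Nₐ) + 2 * (β * (length (E₂ a) * N Cs) + length (E₃ a) * N Cs)
              ≡⟨ cong (β ^ 3 * (2 * Nₐ) +_) (collect β (length (E₂ a)) (length (E₃ a)) (N Cs)) ⟩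
            β ^ 3 * (2 * Nₐ) + 2 * (length (E₂ a) * β + length (E₃ a)) * N Cs
              ≤⟨ +-monoʳ-≤ (β ^ 3 * (2 * Nₐ)) (*-monoˡ-≤ (N Cs) (few-edges Va)) ⟩
            β ^ 3 * (2 * Nₐ) + β ^ 3 * N Cs                    ∎))
            where
            Va : V a
            Va = All.lookup (proj₂ (proj₂ (All.head (proj₁ adm)))) a∈C
            Nₐ = ∑ᶜ Cs (λ xs → 𝟙 (Ok (a ∷ xs)))
            S : ℕ → List (List ℕ) → ℕ
            S r E = ∑ E (λ e → ∑ᶜ Cs (λ xs → 𝟙 (OkHit r e xs)))
            double : ∀ x → x + x ≡ 2 * x
            double = solve-∀
            expand : ∀ b x y z → 2 * (b * (b * (b * 1)) * (x + (y + z))) ≡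
              b * (b * (b * 1)) * (2 * x) + 2 * (b * (b * (b * 1) * y) + b * (b * (b * 1)) * z)
            expand = solve-∀
            collect : ∀ b x y z → 2 * (b * (x * z) + y * z) ≡ 2 * (x * b + y) * z
            collect = solve-∀
            S≤ : ∀ r E → β ^ r * S r E ≤ length E * N Cs
            S≤ r E = ≤-trans (≤-reflexive (sym (∑-* (β ^ r) E))) (∑-≤-const (N Cs) E λ {e} _ → hits r e)
            split : N Cs ≤ Nₐ + (S 2 (E₂ a) + S 3 (E₃ a))
            split = begin
              N Cs          ≤⟨ ∑ᶜ-mono Cs pointwise ⟩
              ∑ᶜ Cs (λ xs → 𝟙 (Ok (a ∷ xs)) + (∑ (E₂ a) (λ e → 𝟙 (OkHit 2 e xs)) + ∑ (E₃ a) (λ e → 𝟙 (OkHit 3 e xs))))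
                ≡⟨ trans (∑ᶜ-+ Cs) (cong (Nₐ +_) (∑ᶜ-+ Cs)) ⟩
              Nₐ + (∑ᶜ Cs (λ xs → ∑ (E₂ a) (λ e → 𝟙 (OkHit 2 e xs))) + ∑ᶜ Cs (λ xs → ∑ (E₃ a) (λ e → 𝟙 (OkHit 3 e xs))))
                ≡⟨ cong (Nₐ +_) (cong₂ _+_ (∑ᶜ-∑ Cs (E₂ a)) (∑ᶜ-∑ Cs (E₃ a))) ⟩
              Nₐ + (S 2 (E₂ a) + S 3 (E₃ a))  ∎
              where
              pointwise : ∀ {xs} → Choice Cs xs → 𝟙 (Ok xs) ≤
                𝟙 (Ok (a ∷ xs)) + (∑ (E₂ a) (λ e → 𝟙 (OkHit 2 e xs)) + ∑ (E₃ a) (λ e → 𝟙 (OkHit 3 e xs)))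
              pointwise {xs} ch with em {Ok (a ∷ xs)}
              ... | yes _  = ≤-trans (𝟙≤1 (Ok xs)) (s≤s z≤n)
              ... | no ¬ok = 𝟙-≤ λ ok → case-conflict ok (conflict Va (choice-V adm′ ch) ok ¬ok)
                where
                case-conflict : Ok xs → Conflict a xs →
                  1 ≤ ∑ (E₂ a) (λ e → 𝟙 (OkHit 2 e xs)) + ∑ (E₃ a) (λ e → 𝟙 (OkHit 3 e xs))
                case-conflict ok (inj₁ (e , e∈ , hit)) = ≤-trans (≤-reflexive (sym (𝟙-yes (ok , hit))))
                  (≤-trans (∑-≥-term (E₂ a) e∈) (m≤m+n _ _))
                case-conflict ok (inj₂ (e , e∈ , hit)) = ≤-trans (≤-reflexive (sym (𝟙-yes (ok , hit))))
                  (≤-trans (∑-≥-term (E₃ a) e∈) (m≤n+m _ (∑ (E₂ a) (λ e → 𝟙 (OkHit 2 e xs)))))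

        N-positive : ∀ Cs → Admissible Cs → 1 ≤ N Cs
        N-positive []       adm = ≤-reflexive (sym (𝟙-yes ok-[]))
        N-positive (C ∷ Cs) adm = ≤-trans (*-mono-≤ 1≤β (N-positive Cs (admissible-tail adm))) (growth _ ≤-refl adm)

      transversal : ∀ Cs → Admissible Cs → ∃[ xs ] Choice Cs xs × Ok xs
      transversal Cs adm with em {∃[ xs ] Choice Cs xs × Ok xs}
      ... | yes found = found
      ... | no  none  = contradiction (N-positive Cs adm) (<⇒≱ (s≤s (≤-trans
        (∑ᶜ-mono Cs {w = λ _ → 0} λ {xs} ch → 𝟙-≤ λ ok → contradiction (xs , ch , ok) none) (≤-reflexive (∑ᶜ-zero Cs)))))

  -- Choosing primes

  some-term≤average : ∀ {A : Set} (xs : List A) {f K} → 1 ≤ length xs → ∑ xs f ≤ length xs * K →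
                      ∃[ x ] x ∈ˡ xs × f x ≤ K
  some-term≤average (x ∷ xs) {f} {K} _ ∑≤ with f x ≤? K
  ... | yes fx≤K = x , here refl , fx≤K
  some-term≤average (x ∷ []) {f} {K} _ ∑≤ | no fx≰K =
    contradiction (≤-trans (m≤m+n (f x) 0) (≤-trans ∑≤ (≤-reflexive (+-identityʳ K)))) fx≰K
  some-term≤average (x ∷ xs@(_ ∷ _)) {f} {K} _ ∑≤ | no fx≰K =
    let y , y∈ , fy≤K = some-term≤average xs (s≤s z≤n)
          (+-cancelˡ-≤ K _ _ (≤-trans (+-monoˡ-≤ (∑ xs f) (≰⇒≥ fx≰K)) ∑≤))
    in y , there y∈ , fy≤K

  -- The method of conditional expectations: the average of R ^ h over a class J of
  -- R elements is at most 1 + (sum of h over J), since h takes the values 0 and 1.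
  module _ {A I : Set} (R : ℕ) (1≤R : 1 ≤ R) (Is : List I) (h : I → A → ℕ) where

    choose-with-few-hits : ∀ Js → All (λ J → length J ≡ R) Js →
      (∀ {J i p} → J ∈ˡ Js → i ∈ˡ Is → p ∈ˡ J → h i p ≤ 1) → (c : I → ℕ) →
      ∃[ σ ] Choice Js σ × ∑ Is (λ i → c i * R ^ ∑ σ (h i)) ≤ ∑ Is (λ i → c i * 2 ^ ∑ Js (λ J → ∑ J (h i)))
    choose-with-few-hits []       []              h≤1 c = [] , [] , ≤-refl
    choose-with-few-hits (J ∷ Js) (refl ∷ sizes) h≤1 c =
      let p , p∈J , p≤  = some-term≤average J 1≤R total
          -- The hits of p are absorbed into the weights, so that the same statement applies to the
          -- remaining classes.
          σ , ch , σ≤ = choose-with-few-hits Js sizes (λ J∈ → h≤1 (there J∈)) (λ i → c i * R ^ h i p)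
      in p ∷ σ , p∈J ∷ ch , (begin
        ∑ Is (λ i → c i * R ^ (h i p + ∑ σ (h i)))         ≡⟨ ∑-cong Is (λ i →
                                                              trans (cong (c i *_) (^-distribˡ-+-* R (h i p) _)) (sym (*-assoc (c i) _ _))) ⟩
        ∑ Is (λ i → c i * R ^ h i p * R ^ ∑ σ (h i))       ≤⟨ σ≤ ⟩
        ∑ Is (λ i → c i * R ^ h i p * rest i)              ≤⟨ p≤ ⟩
        ∑ Is (λ i → c i * 2 ^ ∑ (J ∷ Js) (λ J → ∑ J (h i)))  ∎)
      where
      open ≤-Reasoning
      rest : I → ℕ
      rest i = 2 ^ ∑ Js (λ J → ∑ J (h i))
      shuffle₁ : ∀ a b d → a * b * d ≡ a * d * b
      shuffle₁ = solve-∀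
      shuffle₂ : ∀ r a b d → a * d * (r * b) ≡ r * (a * (b * d))
      shuffle₂ = solve-∀
      R^n≤ : ∀ {n} → n ≤ 1 → R ^ n ≤ 1 + R * n
      R^n≤ z≤n       = s≤s z≤n
      R^n≤ (s≤s z≤n) = n≤1+n _
      average : ∀ {i} → i ∈ˡ Is → ∑ J (λ p → R ^ h i p) ≤ R * 2 ^ ∑ J (h i)
      average {i} i∈ = begin
        ∑ J (λ p → R ^ h i p)          ≤⟨ ∑-mono J (λ p∈ → R^n≤ (h≤1 (here refl) i∈ p∈)) ⟩
        ∑ J (λ p → 1 + R * h i p)      ≡⟨ ∑-+ J ⟩
        ∑ J (λ _ → 1) + ∑ J (λ p → R * h i p)  ≡⟨ cong₂ _+_ (∑-const 1 J) (∑-* R J) ⟩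
        R * 1 + R * ∑ J (h i)          ≡⟨ *-distribˡ-+ R 1 _ ⟨
        R * suc (∑ J (h i))            ≤⟨ *-monoʳ-≤ R (1+n≤2^n (∑ J (h i))) ⟩
        R * 2 ^ ∑ J (h i)              ∎
      total : ∑ J (λ p → ∑ Is (λ i → c i * R ^ h i p * rest i)) ≤
              R * ∑ Is (λ i → c i * 2 ^ ∑ (J ∷ Js) (λ J → ∑ J (h i)))
      total = begin
        ∑ J (λ p → ∑ Is (λ i → c i * R ^ h i p * rest i))    ≡⟨ ∑-swap J Is ⟩
        ∑ Is (λ i → ∑ J (λ p → c i * R ^ h i p * rest i))
          ≡⟨ ∑-cong Is (λ i → trans (∑-cong J λ p → shuffle₁ (c i) (R ^ h i p) (rest i)) (∑-* (c i * rest i) J)) ⟩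
        ∑ Is (λ i → c i * rest i * ∑ J (λ p → R ^ h i p))    ≤⟨ ∑-mono Is (λ {i} i∈ → *-monoʳ-≤ (c i * rest i) (average i∈)) ⟩
        ∑ Is (λ i → c i * rest i * (R * 2 ^ ∑ J (h i)))
          ≡⟨ ∑-cong Is (λ i → trans (shuffle₂ R (c i) (2 ^ ∑ J (h i)) (rest i))
               (cong (λ x → R * (c i * x)) (sym (^-distribˡ-+-* 2 (∑ J (h i)) _)))) ⟩
        ∑ Is (λ i → R * (c i * 2 ^ ∑ (J ∷ Js) (λ J → ∑ J (h i))))  ≡⟨ ∑-* R Is ⟩
        R * ∑ Is (λ i → c i * 2 ^ ∑ (J ∷ Js) (λ J → ∑ J (h i)))    ∎

  ∑-concat : ∀ {A : Set} (xss : List (List A)) {f : A → ℕ} → ∑ (concat xss) f ≡ ∑ xss (λ xs → ∑ xs f)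
  ∑-concat {A} []     = refl
  ∑-concat {A} (xs ∷ xss) {f} = trans (∑-++ xs) (cong (∑ xs f +_) (∑-concat xss))
    where
    ∑-++ : ∀ xs {ys} → ∑ (xs ++ ys) f ≡ ∑ xs f + ∑ ys f
    ∑-++ []       = refl
    ∑-++ (x ∷ xs) = trans (cong (f x +_) (∑-++ xs)) (sym (+-assoc (f x) _ _))

  ∑-map : ∀ {A B : Set} (g : A → B) xs {f : B → ℕ} → ∑ (map g xs) f ≡ ∑ xs (f ∘ g)
  ∑-map g []           = refl
  ∑-map g (x ∷ xs) {f} = cong (f (g x) +_) (∑-map g xs)

  length≡∑1 : ∀ {A : Set} (xs : List A) → length xs ≡ ∑ xs (λ _ → 1)
  length≡∑1 xs = sym (trans (∑-const 1 xs) (*-identityʳ (length xs)))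

  length≤filter+∑ : ∀ {A : Set} {P : Pred A 0ℓ} (P? : Decidable P) xs {f : A → ℕ} →
    (∀ {x} → x ∈ˡ xs → ¬ P x → 1 ≤ f x) → length xs ≤ length (filter P? xs) + ∑ xs f
  length≤filter+∑ P? []           1≤f = z≤n
  length≤filter+∑ P? (x ∷ xs) {f} 1≤f with P? x
  ... | yes px = s≤s (≤-trans (length≤filter+∑ P? xs (1≤f ∘ there)) (+-monoʳ-≤ (length (filter P? xs)) (m≤n+m (∑ xs f) (f x))))
  ... | no ¬px = ≤-trans (+-mono-≤ (1≤f (here refl) ¬px) (length≤filter+∑ P? xs (1≤f ∘ there)))
      (≤-reflexive (shuffle (f x) (length (filter P? xs)) (∑ xs f)))
    where
    shuffle : ∀ a b c → a + (b + c) ≡ b + (a + c)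
    shuffle = solve-∀

  module _ (em : ExcludedMiddle 0ℓ) where
    open Indicator em

    length-filter≤∑ : ∀ {A : Set} {P : Pred A 0ℓ} (P? : Decidable P) xs →
                      length (filter P? xs) ≤ ∑ xs (λ x → 𝟙 (P x))
    length-filter≤∑ P? [] = z≤n
    length-filter≤∑ {P = P} P? (x ∷ xs) with P? x
    ... | yes px = +-mono-≤ (≤-reflexive (sym (𝟙-yes px))) (length-filter≤∑ P? xs)
    ... | no ¬px = ≤-trans (length-filter≤∑ P? xs) (m≤n+m _ (𝟙 (P x)))

    ∑-𝟙-subsingleton : ∀ {A : Set} {P : A → Set} {xs} → Unique xs →
      (∀ {x y} → x ∈ˡ xs → y ∈ˡ xs → P x → P y → x ≡ y) → ∑ xs (λ x → 𝟙 (P x)) ≤ 1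
    ∑-𝟙-subsingleton [] sub = z≤n
    ∑-𝟙-subsingleton {P = P} {x ∷ xs} (x∉ ∷ u) sub with em {P x}
    ... | no  _  = ∑-𝟙-subsingleton u (λ x∈ y∈ → sub (there x∈) (there y∈))
    ... | yes px = s≤s (≤-trans (∑-≤-const 0 xs λ y∈ → ≤-reflexive (𝟙-no λ py →
        All.lookup x∉ y∈ (sub (here refl) (there y∈) px py))) (≤-reflexive (*-zeroʳ (length xs))))

    -- Pigeonhole: each of the b fibres of f contains at most one element with the property P.
    ∑-𝟙-fibres : ∀ {A : Set} {P : A → Set} {xs} (f : A → ℕ) b → Unique xs →
      (∀ {x} → x ∈ˡ xs → P x → f x < b) →
      (∀ {x y} → x ∈ˡ xs → y ∈ˡ xs → P x → P y → f x ≡ f y → x ≡ y) → ∑ xs (λ x → 𝟙 (P x)) ≤ b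
    ∑-𝟙-fibres {P = P} {xs} f b u f< f-inj = begin
      ∑ xs (λ x → 𝟙 (P x))                                ≤⟨ ∑-mono xs (λ x∈ → 𝟙-≤ λ px →
                                                             ≤-trans (≤-reflexive (sym (𝟙-yes (px , refl)))) (∑-≥-term (upTo b) (∈-upTo⁺ (f< x∈ px)))) ⟩
      ∑ xs (λ x → ∑ (upTo b) (λ j → 𝟙 (P x × f x ≡ j)))   ≡⟨ ∑-swap xs (upTo b) ⟩
      ∑ (upTo b) (λ j → ∑ xs (λ x → 𝟙 (P x × f x ≡ j)))   ≤⟨ ∑-≤-const 1 (upTo b) (λ _ → ∑-𝟙-subsingleton u
                                                             λ { x∈ y∈ (px , refl) (py , eq) → f-inj x∈ y∈ px py (sym eq) }) ⟩
      length (upTo b) * 1                                 ≡⟨ trans (*-identityʳ _) (length-upTo b) ⟩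
      b                                                   ∎
      where open ≤-Reasoning

    -- The product of the distinct prime divisors of a among `ps` is at most a: after p is split
    -- off, the others still divide the cofactor.
    prime-divisors-product : ∀ {B} ps → Unique ps → (∀ {p} → p ∈ˡ ps → Prime p × B ≤ p) →
      ∀ a → 1 ≤ a → B ^ ∑ ps (λ p → 𝟙 (p ∣ a)) ≤ a
    prime-divisors-product []       u        primes a 1≤a = 1≤a
    prime-divisors-product {B} (p ∷ ps) (p∉ ∷ u) primes a 1≤a with em {p ∣ a}
    ... | no  _ = prime-divisors-product ps u (primes ∘ there) a 1≤a
    prime-divisors-product {B} (p ∷ ps) (p∉ ∷ u) primes .(zero * p) () | yes (divides zero refl)
    prime-divisors-product {B} (p ∷ ps) (p∉ ∷ u) primes .(suc q * p) 1≤a | yes (divides (suc q) refl) = begin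
      B * B ^ ∑ ps (λ r → 𝟙 (r ∣ suc q * p))   ≤⟨ *-mono-≤ (proj₂ (primes (here refl))) B^≤ ⟩
      p * suc q                                ≡⟨ *-comm p (suc q) ⟩
      suc q * p                                ∎
      where
      open ≤-Reasoning
      r∣ : ∀ {r} → r ∈ˡ ps → r ∣ suc q * p → r ∣ suc q
      r∣ {r} r∈ r∣qp with euclidsLemma (suc q) p (proj₁ (primes (there r∈))) r∣qp
      ... | inj₁ r∣q = r∣q
      ... | inj₂ r∣p with prime⇒irreducible (proj₁ (primes (here refl))) r∣p
      ...   | inj₁ refl = contradiction (proj₁ (primes (there r∈))) ¬prime[1]
      ...   | inj₂ refl = contradiction refl (All.lookup p∉ r∈)
      B^≤ : B ^ ∑ ps (λ r → 𝟙 (r ∣ suc q * p)) ≤ suc q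
      B^≤ = begin
        B ^ ∑ ps (λ r → 𝟙 (r ∣ suc q * p))   ≡⟨ cong (B ^_) (≤-antisym (∑-mono ps λ r∈ → 𝟙-mono (r∣ r∈))
                                                  (∑-mono ps λ _ → 𝟙-mono (∣m⇒∣m*n p))) ⟩
        B ^ ∑ ps (λ r → 𝟙 (r ∣ suc q))       ≤⟨ prime-divisors-product ps u (primes ∘ there) (suc q) (s≤s z≤n) ⟩
        suc q                                ∎

  -- Common divisors of nearby integers and of squares

  ∣-close⇒≡ : ∀ {h x y} → h ∣ x → h ∣ y → x ≤ y → y < x + h → x ≡ y
  ∣-close⇒≡ {h} {x} {y} h∣x h∣y x≤y y<x+h with y ∸ x in eq
  ... | zero  = ≤-antisym x≤y (m∸n≡0⇒m≤n eq)
  ... | suc d = contradiction (∣⇒≤ (subst (h ∣_) eq h∣y∸x)) (<⇒≱ (begin-strict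
      suc d        ≡⟨ eq ⟨
      y ∸ x        <⟨ ∸-monoˡ-< y<x+h x≤y ⟩
      x + h ∸ x    ≡⟨ m+n∸m≡n x h ⟩
      h            ∎))
    where
    open ≤-Reasoning
    h∣y∸x : h ∣ y ∸ x
    h∣y∸x = ∣m+n∣m⇒∣n (subst (h ∣_) (sym (m+[n∸m]≡n x≤y)) h∣y) h∣x

  coprime-square : ∀ {x y} → Coprime x y → Coprime (x * x) (y * y)
  coprime-square c = half (Coprimality.sym (half (Coprimality.sym c)))
    where
    half : ∀ {x y} → Coprime x y → Coprime (x * x) y
    half {x} {y} c {i} (i∣xx , i∣y) = c (coprime-divisor i⊥x i∣xx , i∣y)
      where
      i⊥x : Coprime i x
      i⊥x (j∣i , j∣x) = c (j∣x , ∣-trans j∣i i∣y)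

  -- Division by the gcd h leaves coprime numbers, whose squares are coprime too; what divides both
  -- of these squares times h² divides h².
  ∣-square-gcd : ∀ a x y .{{_ : NonZero x}} → a ∣ x * x → a ∣ y * y → a ∣ gcd x y * gcd x y
  ∣-square-gcd a x y a∣xx a∣yy = coprime-factors (coprime-square {x / h} {y / h} (Coprimality.coprime-/gcd x y))
      (subst (a ∣_) (square≡ (gcd[m,n]∣m x y)) a∣xx , subst (a ∣_) (square≡ (gcd[m,n]∣n x y)) a∣yy)
    where
    h = gcd x y
    instance h≢0 = ℕ.≢-nonZero (gcd[m,n]≢0 x y (inj₁ (ℕ.≢-nonZero⁻¹ x)))
    square≡ : ∀ {z} → h ∣ z → z * z ≡ z / h * (z / h) * (h * h)
    square≡ {z} h∣z = trans (cong (λ w → w * w) (sym (m/n*n≡m h∣z))) (shuffle (z / h) h)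
      where
      shuffle : ∀ a b → a * b * (a * b) ≡ a * a * (b * b)
      shuffle = solve-∀

  -- The squares divisible by a are those of the multiples of some e ≥ √a.
  square-multiples-spread : ∀ {a γ x y} → γ * γ ≤ a → 1 ≤ x → 1 ≤ y → a ∣ x * x → a ∣ y * y → x ≤ y → y < x + γ → x ≡ y
  square-multiples-spread {a} {γ} {x@(suc _)} {y} γγ≤a 1≤x 1≤y a∣xx a∣yy x≤y y<x+γ =
    -- The gcd h serves as e: a divides h², so h ≥ γ, and two multiples of h closer than h coincide.
    ∣-close⇒≡ (gcd[m,n]∣m x y) (gcd[m,n]∣n x y) x≤y (<-≤-trans y<x+γ (+-monoʳ-≤ x γ≤h))
    where
    h = gcd x y
    instance
      h≢0 = ℕ.≢-nonZero (gcd[m,n]≢0 x y (inj₁ (λ ())))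
      hh≢0 = m*n≢0 h h
    γ≤h : γ ≤ h
    γ≤h with γ ≤? h
    ... | yes γ≤h = γ≤h
    ... | no  γ≰h = contradiction (≤-trans γγ≤a (∣⇒≤ (∣-square-gcd a x y a∣xx a∣yy))) (<⇒≱ (*-mono-< (≰⇒> γ≰h) (≰⇒> γ≰h)))

  -- Total, with a default at 0, so that the last member of a b = c d can be written down for every
  -- entry c of a list of divisors, even for a stray 0.
  exactQuotient : ℕ → ℕ → ℕ
  exactQuotient x zero    = 0
  exactQuotient x (suc c) = x / suc c

  exactQuotient-* : ∀ {c d x} → 1 ≤ c → c * d ≡ x → exactQuotient x c ≡ d
  exactQuotient-* {suc c} {d} _ refl = trans (cong (_/ suc c) (*-comm (suc c) d)) (m*n/n≡m d (suc c))

  -- Multiplicative Sidon sets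

  Sidon : List ℕ → Set
  Sidon xs = IsMultiplicativeSidon (_∈ˡ xs)

  sidon-⊆ : ∀ {xs ys} → xs ⊆ˡ ys → Sidon ys → Sidon xs
  sidon-⊆ xs⊆ys s a∈ b∈ c∈ d∈ = s (xs⊆ys a∈) (xs⊆ys b∈) (xs⊆ys c∈) (xs⊆ys d∈)

  module _ {a b c d : ℕ} where

    pairs-≐ : (a ≡ c × b ≡ d) ⊎ (a ≡ d × b ≡ c) → ｛ a ｝ ∪ ｛ b ｝ ≐ ｛ c ｝ ∪ ｛ d ｝
    pairs-≐ (inj₁ (refl , refl)) = (λ x → x) , (λ x → x)
    pairs-≐ (inj₂ (refl , refl)) = (λ { (inj₁ e) → inj₂ e ; (inj₂ e) → inj₁ e }) ,
                                   (λ { (inj₁ e) → inj₂ e ; (inj₂ e) → inj₁ e })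

    cancel-pairs : 1 ≤ a → a * b ≡ c * d → a ≡ c ⊎ a ≡ d → (a ≡ c × b ≡ d) ⊎ (a ≡ d × b ≡ c)
    cancel-pairs 1≤a eq (inj₁ refl) = inj₁ (refl , *-cancelˡ-≡ b d a {{ℕ.>-nonZero 1≤a}} eq)
    cancel-pairs 1≤a eq (inj₂ refl) = inj₂ (refl , *-cancelˡ-≡ b c a {{ℕ.>-nonZero 1≤a}} (trans eq (*-comm c a)))

  -- The equation a b = c d keeps its form when its sides, or the factors on one side, are
  -- exchanged; so a new element may be assumed in the position of a. Once a is c or d, cancellation
  -- matches the other two.
  sidon-extend : ∀ ys {xs} → (∀ {a} → a ∈ˡ ys → 1 ≤ a) →
    (∀ {a b c d} → a ∈ˡ ys → b ∈ˡ ys ++ xs → c ∈ˡ ys ++ xs → d ∈ˡ ys ++ xs → a * b ≡ c * d → a ≡ c ⊎ a ≡ d) →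
    Sidon xs → Sidon (ys ++ xs)
  sidon-extend ys {xs} positive key sidon {a} {b} {c} {d} a∈ b∈ c∈ d∈ eq
    with ∈-++⁻ ys a∈ | ∈-++⁻ ys b∈ | ∈-++⁻ ys c∈ | ∈-++⁻ ys d∈
  ... | inj₁ a∈ys | _ | _ | _ = pairs-≐ (cancel-pairs (positive a∈ys) eq (key a∈ys b∈ c∈ d∈ eq))
  ... | _ | inj₁ b∈ys | _ | _ = pairs-≐ (flip₁ (cancel-pairs (positive b∈ys) eq′ (key b∈ys a∈ c∈ d∈ eq′)))
    where
    eq′ = trans (*-comm b a) eq
    flip₁ : (b ≡ c × a ≡ d) ⊎ (b ≡ d × a ≡ c) → (a ≡ c × b ≡ d) ⊎ (a ≡ d × b ≡ c)
    flip₁ (inj₁ (p , q)) = inj₂ (q , p)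
    flip₁ (inj₂ (p , q)) = inj₁ (q , p)
  ... | _ | _ | inj₁ c∈ys | _ = pairs-≐ (flip₂ (cancel-pairs (positive c∈ys) (sym eq) (key c∈ys d∈ a∈ b∈ (sym eq))))
    where
    flip₂ : (c ≡ a × d ≡ b) ⊎ (c ≡ b × d ≡ a) → (a ≡ c × b ≡ d) ⊎ (a ≡ d × b ≡ c)
    flip₂ (inj₁ (p , q)) = inj₁ (sym p , sym q)
    flip₂ (inj₂ (p , q)) = inj₂ (sym q , sym p)
  ... | _ | _ | _ | inj₁ d∈ys = pairs-≐ (flip₃ (cancel-pairs (positive d∈ys) eq′ (key d∈ys c∈ a∈ b∈ eq′)))
    where
    eq′ = trans (*-comm d c) (sym eq)
    flip₃ : (d ≡ a × c ≡ b) ⊎ (d ≡ b × c ≡ a) → (a ≡ c × b ≡ d) ⊎ (a ≡ d × b ≡ c)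
    flip₃ (inj₁ (p , q)) = inj₂ (sym p , sym q)
    flip₃ (inj₂ (p , q)) = inj₁ (sym q , sym p)
  ... | inj₂ a∈xs | inj₂ b∈xs | inj₂ c∈xs | inj₂ d∈xs = sidon a∈xs b∈xs c∈xs d∈xs eq

  -- A prime p of `ps` on one side divides a factor on the other by Euclid's lemma, and the only
  -- multiple of p in `ps ++ xs` is p itself.
  sidon-++-primes : ∀ ps {xs} → (∀ {p} → p ∈ˡ ps → Prime p) → (∀ {p x} → p ∈ˡ ps → x ∈ˡ xs → ¬ p ∣ x) →
                    Sidon xs → Sidon (ps ++ xs)
  sidon-++-primes ps {xs} primes p∤x = sidon-extend ps (λ p∈ → ℕ.>-nonZero⁻¹ _ {{prime⇒nonZero (primes p∈)}}) key
    where
    ∣⇒≡ : ∀ {p c} → p ∈ˡ ps → c ∈ˡ ps ++ xs → p ∣ c → p ≡ c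
    ∣⇒≡ p∈ c∈ p∣c with ∈-++⁻ ps c∈
    ... | inj₂ c∈xs = contradiction p∣c (p∤x p∈ c∈xs)
    ... | inj₁ c∈ps with prime⇒irreducible (primes c∈ps) p∣c
    ...   | inj₁ refl = contradiction (primes p∈) ¬prime[1]
    ...   | inj₂ p≡c  = p≡c
    key : ∀ {a b c d} → a ∈ˡ ps → b ∈ˡ ps ++ xs → c ∈ˡ ps ++ xs → d ∈ˡ ps ++ xs → a * b ≡ c * d → a ≡ c ⊎ a ≡ d
    key {a} {b} {c} {d} a∈ b∈ c∈ d∈ eq with euclidsLemma c d (primes a∈) (subst (a ∣_) eq (m∣m*n b))
    ... | inj₁ a∣c = inj₁ (∣⇒≡ a∈ c∈ a∣c)
    ... | inj₂ a∣d = inj₂ (∣⇒≡ a∈ d∈ a∣d)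

  -- An element a completes the set xs to a violation of the Sidon property in one
  -- of the ways a a = c d, a b = c c and a b = c d, with distinct elements of xs.
  module SidonConflicts (em : ExcludedMiddle 0ℓ) (divisorsOf : ℕ → List ℕ)
    (divisorsOf-complete : ∀ N → 1 ≤ N → ContainsDivisors N (divisorsOf N))
    (B : List ℕ) (B-positive : ∀ {b} → b ∈ˡ B → 1 ≤ b) where

    HalfSquare : ℕ → ℕ → Set
    HalfSquare a c = ∃[ b ] b ∈ˡ B × a * b ≡ c * c

    -- A conflict is recorded by the other elements of its equation: c, d for a a = c d; b, c for a
    -- b = c c; b, c, d for a b = c d. The first and the third kind are enumerated by divisors c of
    -- the left side. For the second kind, running over all b in B would give too many pairs, so
    -- only the c in B that occur are listed; their number is estimated separately.
    edges₂ edges₃ : ℕ → List (List ℕ)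
    edges₂ a = map (λ c → c ∷ exactQuotient (a * a) c ∷ []) (divisorsOf (a * a)) ++
               map (λ c → exactQuotient (c * c) a ∷ c ∷ []) (filter (λ c → em {HalfSquare a c}) B)
    edges₃ a = concat (map (λ b → map (λ c → b ∷ c ∷ exactQuotient (a * b) c ∷ []) (divisorsOf (a * b))) B)

    private
      Hits : ℕ → List ℕ → List ℕ → Set
      Hits r e xs = length e ≡ r × Unique e × e ⊆ˡ xs

      ⊆-cons : ∀ {x : ℕ} {e xs} → x ∈ˡ xs → e ⊆ˡ xs → (x ∷ e) ⊆ˡ xs
      ⊆-cons x∈ e⊆ (here refl) = x∈
      ⊆-cons x∈ e⊆ (there y∈)  = e⊆ y∈

      ⊆-nil : ∀ {xs : List ℕ} → [] ⊆ˡ xs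
      ⊆-nil ()

    sidon-conflict : ∀ {a xs} → a ∈ˡ B → All (_∈ˡ B) xs → Sidon xs → ¬ Sidon (a ∷ xs) →
      (∃[ e ] e ∈ˡ edges₂ a × Hits 2 e xs) ⊎ (∃[ e ] e ∈ˡ edges₃ a × Hits 3 e xs)
    sidon-conflict {a} {xs} a∈B xs⊆B sidon ¬sidon
      with em {(∃[ e ] e ∈ˡ edges₂ a × Hits 2 e xs) ⊎ (∃[ e ] e ∈ˡ edges₃ a × Hits 3 e xs)}
    ... | yes found = found
    ... | no  none  = contradiction (λ {p} {q} {r} {s} → sidon-extend (a ∷ []) (λ { (here refl) → B-positive a∈B }) key sidon {p} {q} {r} {s}) ¬sidon
      where
      instance _ = ℕ.>-nonZero (B-positive a∈B)
      1≤a = B-positive a∈B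
      none₂ : ∀ {b c} → b ≢ c → b ∈ˡ xs → c ∈ˡ xs → ¬ (b ∷ c ∷ []) ∈ˡ edges₂ a
      none₂ b≢c b∈ c∈ e∈ = none (inj₁ (_ , e∈ , refl , (b≢c ∷ []) ∷ [] ∷ [] , ⊆-cons b∈ (⊆-cons c∈ ⊆-nil)))
      square : ∀ {c d} → c ∈ˡ xs → d ∈ˡ xs → a * a ≡ c * d → c ≢ d → (c ∷ d ∷ []) ∈ˡ edges₂ a
      square {c} {d} c∈ d∈ eq c≢d = ∈-++⁺ˡ (subst (λ x → (c ∷ x ∷ []) ∈ˡ map _ (divisorsOf (a * a)))
        (exactQuotient-* (B-positive (All.lookup xs⊆B c∈)) (sym eq))
        (∈-map⁺ (λ c → c ∷ exactQuotient (a * a) c ∷ [])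
          (divisorsOf-complete (a * a) (*-mono-≤ 1≤a 1≤a) (divides d (trans eq (*-comm c d))))))
      half-square : ∀ {b c} → b ∈ˡ xs → c ∈ˡ xs → a * b ≡ c * c → (b ∷ c ∷ []) ∈ˡ edges₂ a
      half-square {b} {c} b∈ c∈ eq = ∈-++⁺ʳ (map _ (divisorsOf (a * a)))
        (subst (λ x → (x ∷ c ∷ []) ∈ˡ map (λ c → exactQuotient (c * c) a ∷ c ∷ []) (filter (λ c → em {HalfSquare a c}) B))
          (exactQuotient-* 1≤a eq)
          (∈-map⁺ (λ c → exactQuotient (c * c) a ∷ c ∷ [])
            (∈-filter⁺ (λ c → em {HalfSquare a c}) (All.lookup xs⊆B c∈) (b , All.lookup xs⊆B b∈ , eq))))
      generic : ∀ {b c d} → b ∈ˡ xs → c ∈ˡ xs → a * b ≡ c * d → (b ∷ c ∷ d ∷ []) ∈ˡ edges₃ a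
      generic {b} {c} {d} b∈ c∈ eq = ∈-concat⁺′
        (subst (λ x → (b ∷ c ∷ x ∷ []) ∈ˡ map (λ c → b ∷ c ∷ exactQuotient (a * b) c ∷ []) (divisorsOf (a * b)))
          (exactQuotient-* (B-positive (All.lookup xs⊆B c∈)) (sym eq))
          (∈-map⁺ (λ c → b ∷ c ∷ exactQuotient (a * b) c ∷ [])
            (divisorsOf-complete (a * b) (*-mono-≤ 1≤a (B-positive (All.lookup xs⊆B b∈))) (divides d (trans eq (*-comm c d))))))
        (∈-map⁺ (λ b → map (λ c → b ∷ c ∷ exactQuotient (a * b) c ∷ []) (divisorsOf (a * b))) (All.lookup xs⊆B b∈))
      square-injective : ∀ {x y} → x * x ≡ y * y → x ≡ y
      square-injective {x} {y} eq with <-cmp x y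
      ... | tri< x<y _ _ = contradiction eq (<⇒≢ (*-mono-< x<y x<y))
      ... | tri≈ _ x≡y _ = x≡y
      ... | tri> _ _ y<x = contradiction (sym eq) (<⇒≢ (*-mono-< y<x y<x))
      key : ∀ {a′ b c d} → a′ ∈ˡ a ∷ [] → b ∈ˡ a ∷ xs → c ∈ˡ a ∷ xs → d ∈ˡ a ∷ xs → a′ * b ≡ c * d → a′ ≡ c ⊎ a′ ≡ d
      key (here refl) b∈ (here refl) d∈ eq = inj₁ refl
      key (here refl) b∈ (there c∈) (here refl) eq = inj₂ refl
      key {b = b} {c} {d} (here refl) (here refl) (there c∈) (there d∈) eq with c ≟ d
      ... | yes refl = inj₁ (square-injective eq)
      ... | no  c≢d  = contradiction (square c∈ d∈ eq c≢d) (none₂ c≢d c∈ d∈)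
      key {b = b} {c} {d} (here refl) (there b∈) (there c∈) (there d∈) eq with c ≟ d | b ≟ c | b ≟ d
      ... | _        | yes refl | _        = inj₂ (*-cancelʳ-≡ a d b {{ℕ.>-nonZero (B-positive (All.lookup xs⊆B b∈))}} (trans eq (*-comm b d)))
      ... | _        | no _     | yes refl = inj₁ (*-cancelʳ-≡ a c b {{ℕ.>-nonZero (B-positive (All.lookup xs⊆B b∈))}} eq)
      ... | yes refl | no b≢c   | no _     = contradiction (half-square b∈ c∈ eq) (none₂ b≢c b∈ c∈)
      ... | no c≢d   | no b≢c   | no b≢d   = contradiction (generic b∈ c∈ eq) λ e∈ → none (inj₂ (_ , e∈ , refl ,
          (b≢c ∷ b≢d ∷ []) ∷ (c≢d ∷ []) ∷ [] ∷ [] , ⊆-cons b∈ (⊆-cons c∈ (⊆-cons d∈ ⊆-nil))))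

    length-edges₂ : ∀ a → length (edges₂ a) ≡ length (divisorsOf (a * a)) + length (filter (λ c → em {HalfSquare a c}) B)
    length-edges₂ a = trans (length-++ (map (λ c → c ∷ exactQuotient (a * a) c ∷ []) (divisorsOf (a * a))))
      (cong₂ _+_ (length-map _ (divisorsOf (a * a))) (length-map _ (filter (λ c → em {HalfSquare a c}) B)))

    length-edges₃ : ∀ a → length (edges₃ a) ≡ ∑ B (λ b → length (divisorsOf (a * b)))
    length-edges₃ a = begin
      length (edges₃ a)        ≡⟨ length≡∑1 (edges₃ a) ⟩
      ∑ (edges₃ a) (λ _ → 1)   ≡⟨ trans (∑-concat (map F B)) (∑-map F B) ⟩
      ∑ B (λ b → ∑ (F b) (λ _ → 1))  ≡⟨ ∑-cong B (λ b → trans (sym (length≡∑1 (F b))) (length-map _ (divisorsOf (a * b)))) ⟩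
      ∑ B (λ b → length (divisorsOf (a * b)))  ∎
      where
      open ≡-Reasoning
      F : ℕ → List (List ℕ)
      F b = map (λ c → b ∷ c ∷ exactQuotient (a * b) c ∷ []) (divisorsOf (a * b))

  -- Blocks and the construction of the hitting set

  module Blocks (ℓ : ℕ) where

    origin : ℕ → ℕ
    origin k = suc k * ℓ

    InBlock : ℕ → ℕ → Set
    InBlock k x = origin k < x × x ≤ origin k + ℓ

    inBlock-≤ : ∀ {M k x} → k < M → InBlock k x → x ≤ suc M * ℓ
    inBlock-≤ {M} {k} {x} k<M (_ , x≤) = begin
      x                  ≤⟨ x≤ ⟩
      origin k + ℓ        ≡⟨ +-comm (origin k) ℓ ⟩
      suc (suc k) * ℓ    ≤⟨ *-monoˡ-≤ ℓ (s≤s k<M) ⟩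
      suc M * ℓ          ∎
      where open ≤-Reasoning

    inBlock-unique : ∀ {j k x} → InBlock j x → InBlock k x → j ≡ k
    inBlock-unique {j} {k} x∈j x∈k with <-cmp j k
    ... | tri< j<k _ _ = contradiction (proj₁ x∈k) (≤⇒≯ (inBlock-≤ j<k x∈j))
    ... | tri≈ _ j≡k _ = j≡k
    ... | tri> _ _ k<j = contradiction (proj₁ x∈j) (≤⇒≯ (inBlock-≤ k<j x∈k))

    disjoint-blocks : ∀ (F : ℕ → List ℕ) → (∀ {k x} → x ∈ˡ F k → InBlock k x) → ∀ {ks} → Unique ks → AllPairs Disjoint (map F ks)
    disjoint-blocks F inBlock u = AllPairs.map⁺ (AllPairs.map disjoint u)
      where
      disjoint : ∀ {j k} → j ≢ k → Disjoint (F j) (F k)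
      disjoint j≢k (x∈j , x∈k) = j≢k (inBlock-unique (inBlock x∈j) (inBlock x∈k))

    blockPrimes : ℕ → List ℕ
    blockPrimes k = filter prime? (map (λ i → origin k + suc i) (upTo ℓ))

    blockPrimes-unique : ∀ k → Unique (blockPrimes k)
    blockPrimes-unique k = Unique.filter⁺ prime? (Unique.map⁺ (λ eq → suc-injective (+-cancelˡ-≡ (origin k) _ _ eq)) (Unique.upTo⁺ ℓ))

    ∈-blockPrimes⁻ : ∀ {k p} → p ∈ˡ blockPrimes k → Prime p × InBlock k p
    ∈-blockPrimes⁻ {k} {p} p∈ with ∈-filter⁻ prime? {xs = map (λ i → origin k + suc i) (upTo ℓ)} p∈
    ... | p∈map , pp with ∈-map⁻ (λ i → origin k + suc i) p∈map
    ... | i , i∈ , refl = pp , m<m+n (origin k) (s≤s z≤n) , +-monoʳ-≤ (origin k) (∈-upTo⁻ i∈)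

    ∈-blockPrimes⁺ : ∀ {k p} → Prime p → InBlock k p → p ∈ˡ blockPrimes k
    ∈-blockPrimes⁺ {k} {p} pp (s<p , p≤) = ∈-filter⁺ prime? (subst (_∈ˡ map (λ i → origin k + suc i) (upTo ℓ)) eq
        (∈-map⁺ (λ i → origin k + suc i) (∈-upTo⁺ {i = p ∸ suc (origin k)} bound))) pp
      where
      eq : origin k + suc (p ∸ suc (origin k)) ≡ p
      eq = trans (+-suc (origin k) _) (m+[n∸m]≡n s<p)
      bound : p ∸ suc (origin k) < ℓ
      bound = +-cancelˡ-< (origin k) _ _ (≤-trans (≤-reflexive (trans (sym (+-suc (origin k) _)) eq)) p≤)

    module _ (kk : ℕ) where

      Sparse : ℕ → Set
      Sparse k = length (blockPrimes k) < 5 ^ kk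

      sparse? : Decidable Sparse
      sparse? k = length (blockPrimes k) <? 5 ^ kk

      sparseBlocks : ℕ → List ℕ
      sparseBlocks M = filter sparse? (upTo M)

  residue-shuffle : ∀ q i r → q * 4 + (4 * i + r) ≡ 4 * (q + i) + r
  residue-shuffle = solve-∀

  -- The left side is twice an odd number, whereas an even square is divisible by 4.
  2-1-nonsquare : ∀ x y c → (4 * x + 2) * (4 * y + 1) ≢ c * c
  2-1-nonsquare x y c eq = absurd (euclidsLemma c c prime[2] (divides (1 + 2 * w) (trans (sym eq) (form x y))))
    where
    w = 4 * x * y + x + 2 * y
    form : ∀ x y → (4 * x + 2) * (4 * y + 1) ≡ (1 + 2 * (4 * x * y + x + 2 * y)) * 2
    form = solve-∀
    odd≢even : ∀ {w z} → 1 + 2 * w ≢ 2 * z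
    odd≢even {w} {z} eq = contradiction (∣1⇒≡1 (∣m+n∣m⇒∣n (subst (2 ∣_) (trans (sym eq) (+-comm 1 (2 * w))) (m∣m*n z)) (m∣m*n w))) λ ()
    absurd : 2 ∣ c ⊎ 2 ∣ c → _
    absurd (inj₁ (divides q c≡)) = odd≢even {w} {q * q} (*-cancelʳ-≡ _ _ 2 (begin
      (1 + 2 * w) * 2           ≡⟨ form x y ⟨
      (4 * x + 2) * (4 * y + 1) ≡⟨ eq ⟩
      c * c                     ≡⟨ cong (λ z → z * z) c≡ ⟩
      q * 2 * (q * 2)           ≡⟨ regroup q ⟩
      2 * (q * q) * 2           ∎))
      where
      open ≡-Reasoning
      regroup : ∀ q → q * 2 * (q * 2) ≡ 2 * (q * q) * 2
      regroup = solve-∀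
    absurd (inj₂ d) = absurd (inj₁ d)

  close-shuffle : ∀ a b c → a + (b + c) ≡ a + c + b
  close-shuffle = solve-∀

  edges-gather : ∀ x → x + 64 * x + 4 * x ≡ 69 * x
  edges-gather = solve-∀

  edges-expand : ∀ g m t → 2 * ((t + (g * g + 64 * g + 64 * m)) * (4 * g) + m * (16 * g) * t) ≡
                           8 * g * (g * g + 64 * g + (t + 64 * m + 4 * (m * t)))
  edges-expand = solve-∀

  edges-collect : ∀ g → 8 * g * (g * g + g * g + 6 * (g * g)) ≡ (4 * g) * ((4 * g) * ((4 * g) * 1))
  edges-collect = solve-∀

  exponent-16 : ∀ g j → 16 * g * j ≡ 16 * (j * g)
  exponent-16 = solve-∀

  exponent-8 : ∀ g j → j * (8 * g) ≡ 8 * (j * g)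
  exponent-8 = solve-∀

  nonempty : ∀ {x : ℕ} {xs} → x ∈ˡ xs → 1 ≤ length xs
  nonempty (here _)  = s≤s z≤n
  nonempty (there _) = s≤s z≤n

  -- A block has 16 γ candidates, of which at most half are lost to the chosen primes;
  -- this leaves 2 β elements for the transversal, with β = 4 γ.
  module Construction (em : ExcludedMiddle 0ℓ) (n γ ℓ kk t M : ℕ) (ℓ≡ : ℓ ≡ 64 * γ) (64≤γ : 64 ≤ γ) (n<2^γ : n < 2 ^ γ)
    (n<ℓ^ : n < ℓ ^ suc kk) (blocks≤n : suc M * ℓ ≤ n)
    (divisorsOf : ℕ → List ℕ) (divisorsOf-complete : ∀ N → 1 ≤ N → ContainsDivisors N (divisorsOf N))
    (divisorsOf-length : ∀ N → 1 ≤ N → N ≤ n * n → length (divisorsOf N) ≤ t)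
    (few-sparse : 12 * (length (Blocks.sparseBlocks ℓ kk M) * t) ≤ γ * γ) where

    private
      open Blocks ℓ
      open Indicator em

      1≤γ : 1 ≤ γ
      1≤γ = ≤-trans (s≤s z≤n) 64≤γ

      instance
        γ≢0 : NonZero γ
        γ≢0 = ℕ.>-nonZero 1≤γ

      bads goods : List ℕ
      bads  = sparseBlocks kk M
      goods = filter (¬? ∘ sparse? kk) (upTo M)

      m : ℕ
      m = length bads

      bad-< : ∀ {k} → k ∈ˡ bads → k < M
      bad-< k∈ = ∈-upTo⁻ (proj₁ (∈-filter⁻ (sparse? kk) {xs = upTo M} k∈))

      -- Candidates are ≡ 2 (mod 4) in the blocks below γ², and ≡ 1 (mod 4) above.
      -- Hence a b = c² with a below γ² forces b, and so c, to be small.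
      residue : ℕ → ℕ
      residue k with origin k <? γ * γ
      ... | yes _ = 2
      ... | no  _ = 1

      residue-cases : ∀ k → (origin k < γ * γ × residue k ≡ 2) ⊎ (γ * γ ≤ origin k × residue k ≡ 1)
      residue-cases k with origin k <? γ * γ
      ... | yes small = inj₁ (small , refl)
      ... | no  large = inj₂ (≮⇒≥ large , refl)

      residue-≤2 : ∀ k → 1 ≤ residue k × residue k ≤ 2
      residue-≤2 k with origin k <? γ * γ
      ... | yes _ = s≤s z≤n , ≤-refl
      ... | no  _ = s≤s z≤n , s≤s z≤n

      candidate : ℕ → ℕ → ℕ
      candidate k i = origin k + (4 * i + residue k)

      candidates : ℕ → List ℕ
      candidates k = map (candidate k) (upTo (16 * γ))

      length-candidates : ∀ k → length (candidates k) ≡ 16 * γ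
      length-candidates k = trans (length-map (candidate k) (upTo (16 * γ))) (length-upTo (16 * γ))

      candidates-unique : ∀ k → Unique (candidates k)
      candidates-unique k = Unique.map⁺ (λ eq → *-cancelˡ-≡ _ _ 4 (+-cancelʳ-≡ (residue k) _ _ (+-cancelˡ-≡ (origin k) _ _ eq)))
                                        (Unique.upTo⁺ (16 * γ))

      candidate-offset< : ∀ {k i} → i < 16 * γ → 4 * i + residue k < ℓ
      candidate-offset< {k} {i} i< = begin-strict
        4 * i + residue k    ≤⟨ +-monoʳ-≤ (4 * i) (proj₂ (residue-≤2 k)) ⟩
        4 * i + 2            <⟨ +-monoʳ-< (4 * i) (s≤s (s≤s (s≤s (z≤n {1})))) ⟩
        4 * i + 4            ≡⟨ trans (+-comm (4 * i) 4) (sym (*-suc 4 i)) ⟩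
        4 * suc i            ≤⟨ *-monoʳ-≤ 4 i< ⟩
        4 * (16 * γ)         ≡⟨ trans (sym (*-assoc 4 16 γ)) (sym ℓ≡) ⟩
        ℓ                    ∎
        where open ≤-Reasoning

      candidates-inBlock : ∀ {k a} → a ∈ˡ candidates k → InBlock k a × a < origin k + ℓ
      candidates-inBlock {k} a∈ with ∈-map⁻ (candidate k) a∈
      ... | i , i∈ , refl = (m<m+n (origin k) (≤-trans (proj₁ (residue-≤2 k)) (m≤n+m (residue k) (4 * i))) , <⇒≤ a<) , a<
        where a< = +-monoʳ-< (origin k) (candidate-offset< {k} (∈-upTo⁻ i∈))

      ℓ≤origin : ∀ k → ℓ ≤ origin k
      ℓ≤origin k = m≤m+n ℓ (k * ℓ)

      inBlock⇒≤n : ∀ {k x} → k < M → InBlock k x → x ≤ n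
      inBlock⇒≤n k<M x∈ = ≤-trans (inBlock-≤ k<M x∈) blocks≤n

      inBlock⇒≥1 : ∀ {k x} → InBlock k x → 1 ≤ x
      inBlock⇒≥1 (s<x , _) = ≤-trans (s≤s z≤n) s<x

      -- Cut down to exactly 5^kk primes per block, since `choose-with-few-hits` averages over
      -- classes of one common size R.
      primeClasses : List (List ℕ)
      primeClasses = map (λ k → take (5 ^ kk) (blockPrimes k)) goods

      take-⊆ : ∀ r (xs : List ℕ) → take r xs ⊆ˡ xs
      take-⊆ r xs x∈ = subst (_ ∈ˡ_) (take++drop≡id r xs) (∈-++⁺ˡ x∈)

      primeClass-inBlock : ∀ {k p} → p ∈ˡ take (5 ^ kk) (blockPrimes k) → Prime p × InBlock k p
      primeClass-inBlock {k} p∈ = ∈-blockPrimes⁻ {k} (take-⊆ (5 ^ kk) (blockPrimes k) p∈)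

      ∈-primeClasses : ∀ {J p} → J ∈ˡ primeClasses → p ∈ˡ J → Prime p × ∃[ k ] k < M × InBlock k p
      ∈-primeClasses J∈ p∈ with ∈-map⁻ (λ k → take (5 ^ kk) (blockPrimes k)) J∈
      ... | k , k∈ , refl = let pp , p∈k = primeClass-inBlock {k} p∈
          in pp , k , ∈-upTo⁻ (proj₁ (∈-filter⁻ (¬? ∘ sparse? kk) {xs = upTo M} k∈)) , p∈k

      primeClasses-sizes : All (λ J → length J ≡ 5 ^ kk) primeClasses
      primeClasses-sizes = All.map⁺ (All.tabulate λ {k} k∈ → trans (length-take (5 ^ kk) (blockPrimes k))
        (m≤n⇒m⊓n≡m (≮⇒≥ (proj₂ (∈-filter⁻ (¬? ∘ sparse? kk) {xs = upTo M} k∈)))))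

      primeClasses-unique : Unique (concat primeClasses)
      primeClasses-unique = Unique.concat⁺
        (All.map⁺ (All.tabulate λ {k} _ → Unique.take⁺ (5 ^ kk) (blockPrimes-unique k)))
        (disjoint-blocks _ (λ {k} p∈ → proj₂ (primeClass-inBlock {k} p∈)) (Unique.filter⁺ (¬? ∘ sparse? kk) (Unique.upTo⁺ M)))

      1≤ℓ : 1 ≤ ℓ
      1≤ℓ = ≤-trans (*-mono-≤ {1} {64} (s≤s z≤n) 1≤γ) (≤-reflexive (sym ℓ≡))

      -- These primes exceed ℓ, so kk + 1 of them dividing a would force a ≥ ℓ^(kk + 1) > n.
      few-prime-divisors : ∀ {k a} → k < M → InBlock k a → ∑ primeClasses (λ J → ∑ J (λ p → 𝟙 (p ∣ a))) ≤ kk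
      few-prime-divisors {k} {a} k<M a∈ = ≮⇒≥ λ kk< → <⇒≱ n<ℓ^ (begin
        ℓ ^ suc kk   ≤⟨ ^-monoʳ-≤ ℓ {{ℕ.>-nonZero 1≤ℓ}} kk< ⟩
        ℓ ^ ∑ primeClasses (λ J → ∑ J (λ p → 𝟙 (p ∣ a)))   ≡⟨ cong (ℓ ^_) (∑-concat primeClasses) ⟨
        ℓ ^ ∑ (concat primeClasses) (λ p → 𝟙 (p ∣ a))
          ≤⟨ prime-divisors-product em (concat primeClasses) primeClasses-unique large a (inBlock⇒≥1 {k} a∈) ⟩
        a            ≤⟨ inBlock⇒≤n {k} k<M a∈ ⟩
        n            ∎)
        where
        open ≤-Reasoning
        large : ∀ {p} → p ∈ˡ concat primeClasses → Prime p × ℓ ≤ p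
        large p∈ with ∈-concat⁻′ primeClasses p∈
        ... | J , p∈J , J∈ = let pp , k , _ , s<p , _ = ∈-primeClasses J∈ p∈J in pp , ≤-trans (ℓ≤origin k) (<⇒≤ s<p)

      hits : ℕ → ℕ → ℕ
      hits k p = ∑ (candidates k) (λ a → 𝟙 (p ∣ a))

      -- The prime p is larger than ℓ, hence larger than the distance between any two candidates of
      -- a block.
      hits≤1 : ∀ {J k p} → J ∈ˡ primeClasses → k ∈ˡ bads → p ∈ˡ J → hits k p ≤ 1
      hits≤1 {J} {k} {p} J∈ _ p∈ = ∑-𝟙-subsingleton em (candidates-unique k) λ a∈ b∈ p∣a p∣b → eq a∈ b∈ p∣a p∣b
        where
        ℓ<p : ℓ < p
        ℓ<p = let _ , j , _ , s<p , _ = ∈-primeClasses J∈ p∈ in ≤-<-trans (ℓ≤origin j) s<p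
        close : ∀ {a b} → a ∈ˡ candidates k → b ∈ˡ candidates k → b < a + p
        close {a} {b} a∈ b∈ = begin-strict
          b              <⟨ proj₂ (candidates-inBlock b∈) ⟩
          origin k + ℓ    ≤⟨ +-mono-≤ (<⇒≤ (proj₁ (proj₁ (candidates-inBlock a∈)))) (<⇒≤ ℓ<p) ⟩
          a + p          ∎
          where open ≤-Reasoning
        eq : ∀ {a b} → a ∈ˡ candidates k → b ∈ˡ candidates k → p ∣ a → p ∣ b → a ≡ b
        eq {a} {b} a∈ b∈ p∣a p∣b with ≤-total a b
        ... | inj₁ a≤b = ∣-close⇒≡ p∣a p∣b a≤b (close a∈ b∈)
        ... | inj₂ b≤a = sym (∣-close⇒≡ p∣b p∣a b≤a (close b∈ a∈))

      -- Double counting: `few-prime-divisors` applies to each of the 16 γ candidates.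
      total-hits : ∀ {k} → k ∈ˡ bads → ∑ primeClasses (λ J → ∑ J (hits k)) ≤ 16 * γ * kk
      total-hits {k} k∈ = begin
        ∑ primeClasses (λ J → ∑ J (hits k))    ≡⟨ ∑-cong primeClasses (λ J → ∑-swap J (candidates k)) ⟩
        ∑ primeClasses (λ J → ∑ (candidates k) (λ a → ∑ J (λ p → 𝟙 (p ∣ a))))  ≡⟨ ∑-swap primeClasses (candidates k) ⟩
        ∑ (candidates k) (λ a → ∑ primeClasses (λ J → ∑ J (λ p → 𝟙 (p ∣ a))))
          ≤⟨ ∑-≤-const kk (candidates k) (λ a∈ → few-prime-divisors (bad-< k∈) (proj₁ (candidates-inBlock a∈))) ⟩
        length (candidates k) * kk             ≡⟨ cong (_* kk) (length-candidates k) ⟩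
        16 * γ * kk                            ∎
        where open ≤-Reasoning

      abstract
        chosen : ∃[ σ ] Choice primeClasses σ × ∑ bads (λ k → 1 * (5 ^ kk) ^ ∑ σ (hits k)) ≤
                                                ∑ bads (λ k → 1 * 2 ^ ∑ primeClasses (λ J → ∑ J (hits k)))
        chosen = choose-with-few-hits (5 ^ kk) (^-positive {5} kk (s≤s z≤n)) bads hits primeClasses primeClasses-sizes hits≤1 (λ _ → 1)

      σ : List ℕ
      σ = proj₁ chosen

      σ-choice : Choice primeClasses σ
      σ-choice = proj₁ (proj₂ chosen)

      M≤n : M ≤ n
      M≤n = ≤-trans (≤-trans (n≤1+n M) (m≤m*n (suc M) ℓ {{ℕ.>-nonZero 1≤ℓ}})) blocks≤n

      m≤n : m ≤ n
      m≤n = ≤-trans (≤-trans (length-filter (sparse? kk) (upTo M)) (≤-reflexive (length-upTo M))) M≤n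

      -- For kk = 0 the hypothesis n < ℓ^(kk + 1) would contradict ℓ ≤ n.
      1≤kk : ∀ {k} → k ∈ˡ bads → 1 ≤ kk
      1≤kk k∈ = ≮⇒≥ λ kk<1 → <⇒≱ n<ℓ^ (≤-trans (≤-reflexive (trans (cong (λ j → ℓ ^ suc j) (n<1⇒n≡0 kk<1)) (*-identityʳ ℓ)))
        (≤-trans (m≤m+n ℓ (M * ℓ)) blocks≤n))

      -- The choice bounds a sum over all sparse blocks, hence each of its terms. A block with more
      -- than 8 γ hits would contribute at least 5^(8 γ kk), which exceeds the bound m 2^(16 γ kk)
      -- for the whole sum.
      hits-bound : ∀ {k} → k ∈ˡ bads → ∑ σ (hits k) ≤ 8 * γ
      hits-bound {k} k∈ = ≮⇒≥ λ 8γ< → <⇒≱ (many-hits 8γ<) (begin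
        (5 ^ kk) ^ ∑ σ (hits k)    ≤⟨ ∑-≥-term bads {λ k → (5 ^ kk) ^ ∑ σ (hits k)} k∈ ⟩
        ∑ bads (λ k → (5 ^ kk) ^ ∑ σ (hits k))   ≡⟨ ∑-cong bads (λ k → *-identityˡ _) ⟨
        ∑ bads (λ k → 1 * (5 ^ kk) ^ ∑ σ (hits k))   ≤⟨ proj₂ (proj₂ chosen) ⟩
        ∑ bads (λ k → 1 * 2 ^ ∑ primeClasses (λ J → ∑ J (hits k)))
          ≤⟨ ∑-≤-const _ bads (λ k∈ → ≤-trans (≤-reflexive (*-identityˡ _)) (^-monoʳ-≤ 2 (total-hits k∈))) ⟩
        m * 2 ^ (16 * γ * kk)      ∎)
        where
        open ≤-Reasoning
        instance _ = m^n≢0 5 kk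
        γ≤kkγ : γ ≤ kk * γ
        γ≤kkγ = ≤-trans (≤-reflexive (sym (*-identityˡ γ))) (*-monoˡ-≤ γ (1≤kk k∈))
        many-hits : 8 * γ < ∑ σ (hits k) → m * 2 ^ (16 * γ * kk) < (5 ^ kk) ^ ∑ σ (hits k)
        many-hits 8γ< = begin-strict
          m * 2 ^ (16 * γ * kk)        <⟨ *-monoˡ-< (2 ^ (16 * γ * kk)) {{m^n≢0 2 (16 * γ * kk)}} (≤-<-trans m≤n n<2^γ) ⟩
          2 ^ γ * 2 ^ (16 * γ * kk)    ≤⟨ *-mono-≤ (^-monoʳ-≤ 2 γ≤kkγ) (≤-reflexive (trans (cong (2 ^_) (exponent-16 γ kk)) (sym (^-*-assoc 2 16 (kk * γ))))) ⟩
          2 ^ (kk * γ) * (2 ^ 16) ^ (kk * γ)  ≡⟨ ^-distribʳ-* 2 (2 ^ 16) (kk * γ) ⟨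
          -- Here 5 > 4 is used: 2^16 is 4^8, and the additional factor 2 comes from m < 2^γ ≤ 2^(kk
          -- γ).
          (2 * 2 ^ 16) ^ (kk * γ)      ≤⟨ ^-monoˡ-≤ (kk * γ) (≤ᵇ⇒≤ (2 * 2 ^ 16) (5 ^ 8) _) ⟩
          (5 ^ 8) ^ (kk * γ)           ≡⟨ ^-*-assoc 5 8 (kk * γ) ⟩
          5 ^ (8 * (kk * γ))           ≡⟨ trans (cong (5 ^_) (sym (exponent-8 γ kk))) (sym (^-*-assoc 5 kk (8 * γ))) ⟩
          (5 ^ kk) ^ (8 * γ)           ≤⟨ ^-monoʳ-≤ (5 ^ kk) (<⇒≤ 8γ<) ⟩
          (5 ^ kk) ^ ∑ σ (hits k)      ∎

      Free : ℕ → Set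
      Free a = All (λ p → ¬ p ∣ a) σ

      free? : Decidable Free
      free? a = em

      class : ℕ → List ℕ
      class k = filter free? (candidates k)

      -- Every candidate that is not free accounts for a hit, so at most 8 γ of the 16 γ candidates
      -- are lost.
      length-class : ∀ {k} → k ∈ˡ bads → 8 * γ ≤ length (class k)
      length-class {k} k∈ = +-cancelʳ-≤ (8 * γ) _ _ (begin
        8 * γ + 8 * γ                              ≡⟨ *-distribʳ-+ γ 8 8 ⟨
        16 * γ                                     ≡⟨ length-candidates k ⟨
        length (candidates k)                      ≤⟨ length≤filter+∑ free? (candidates k) (λ _ → hit) ⟩
        length (class k) + ∑ (candidates k) (λ a → ∑ σ (λ p → 𝟙 (p ∣ a)))
                                                   ≡⟨ cong (length (class k) +_) (∑-swap (candidates k) σ) ⟩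
        length (class k) + ∑ σ (hits k)            ≤⟨ +-monoʳ-≤ (length (class k)) (hits-bound k∈) ⟩
        length (class k) + 8 * γ                   ∎)
        where
        open ≤-Reasoning
        hit : ∀ {a} → ¬ Free a → 1 ≤ ∑ σ (λ p → 𝟙 (p ∣ a))
        hit {a} ¬free with em {∃[ p ] p ∈ˡ σ × p ∣ a}
        ... | yes (p , p∈ , p∣a) = ≤-trans (≤-reflexive (sym (𝟙-yes p∣a))) (∑-≥-term σ p∈)
        ... | no  none = contradiction (All.tabulate λ {p} p∈ p∣a → none (p , p∈ , p∣a)) ¬free

      -- Conflicts are counted among all candidates of sparse blocks, free or not; this can only
      -- raise the counts and makes the size of B explicit.
      B : List ℕ
      B = concat (map candidates bads)

      ∈B⁻ : ∀ {b} → b ∈ˡ B → ∃[ k ] k ∈ˡ bads × b ∈ˡ candidates k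
      ∈B⁻ b∈ with ∈-concat⁻′ (map candidates bads) b∈
      ... | _ , b∈C , C∈ with ∈-map⁻ candidates C∈
      ... | k , k∈ , refl = k , k∈ , b∈C

      ∈B⁺ : ∀ {k b} → k ∈ˡ bads → b ∈ˡ candidates k → b ∈ˡ B
      ∈B⁺ k∈ b∈ = ∈-concat⁺′ b∈ (∈-map⁺ candidates k∈)

      B-range : ∀ {b} → b ∈ˡ B → 1 ≤ b × b ≤ n
      B-range b∈ = let k , k∈ , b∈k = ∈B⁻ b∈
                       inB = proj₁ (candidates-inBlock {k} b∈k)
                   in inBlock⇒≥1 {k} inB , inBlock⇒≤n {k} (bad-< k∈) inB

      bads-unique : Unique bads
      bads-unique = Unique.filter⁺ (sparse? kk) (Unique.upTo⁺ M)

      B-unique : Unique B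
      B-unique = Unique.concat⁺ (All.map⁺ (All.tabulate λ {k} _ → candidates-unique k))
        (disjoint-blocks candidates (λ {k} b∈ → proj₁ (candidates-inBlock {k} b∈)) bads-unique)

      length-B : length B ≡ m * (16 * γ)
      length-B = begin
        length B                                  ≡⟨ length≡∑1 B ⟩
        ∑ B (λ _ → 1)                             ≡⟨ trans (∑-concat (map candidates bads)) (∑-map candidates bads) ⟩
        ∑ bads (λ k → ∑ (candidates k) (λ _ → 1))  ≡⟨ ∑-cong bads (λ k → trans (sym (length≡∑1 (candidates k))) (length-candidates k)) ⟩
        ∑ bads (λ _ → 16 * γ)                     ≡⟨ ∑-const (16 * γ) bads ⟩
        m * (16 * γ)                              ∎
        where open ≡-Reasoning

      open SidonConflicts em divisorsOf divisorsOf-complete B (proj₁ ∘ B-range)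

      4∣origin : ∀ k → 4 ∣ origin k
      4∣origin k = ∣n⇒∣m*n (suc k) (subst (4 ∣_) (sym ℓ≡) (divides (16 * γ) (trans (*-assoc 4 16 γ) (*-comm 4 (16 * γ)))))

      residue-form : ∀ {k a} → a ∈ˡ candidates k → ∃[ x ] a ≡ 4 * x + residue k
      residue-form {k} a∈ =
        let i , _ , a≡ = ∈-map⁻ (candidate k) a∈
            divides q origin≡ = 4∣origin k
        in q + i , trans a≡ (trans (cong (_+ (4 * i + residue k)) origin≡) (residue-shuffle q i (residue k)))

      -- If a lies in a block starting below γ², then so does b, as a product with residues 2 and 1
      -- is no square; hence c² = a b < (γ² + ℓ)². Otherwise a ≥ γ², and by
      -- `square-multiples-spread` the possible c in one block are at least γ apart, which allows 64
      -- per block of length 64 γ.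
      few-half-squares : ∀ {a} → a ∈ˡ B → length (filter (λ c → em {HalfSquare a c}) B) ≤ γ * γ + ℓ + 64 * m
      few-half-squares {a} a∈ with ∈B⁻ a∈
      ... | k , k∈ , a∈k with residue-cases k
      ... | inj₁ (small , residue-2) = ≤-trans (length-filter≤∑ em (λ c → em {HalfSquare a c}) B)
          (≤-trans (∑-𝟙-fibres em (λ c → c) (γ * γ + ℓ) B-unique (λ _ → c-small) (λ _ _ _ _ eq → eq)) (m≤m+n (γ * γ + ℓ) (64 * m)))
        where
        small-block : ∀ {j b} → b ∈ˡ candidates j → origin j < γ * γ → b < γ * γ + ℓ
        small-block {j} b∈ lt = <-trans (proj₂ (candidates-inBlock {j} b∈)) (+-monoˡ-< ℓ lt)
        b-small : ∀ {b c} → b ∈ˡ B → a * b ≡ c * c → b < γ * γ + ℓ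
        b-small {b} {c} b∈ eq with ∈B⁻ b∈
        ... | j , _ , b∈j with residue-cases j
        ...   | inj₁ (lt , _) = small-block {j} b∈j lt
        ...   | inj₂ (_ , residue-1) =
          let x , a≡ = residue-form {k} a∈k
              y , b≡ = residue-form {j} b∈j
          in contradiction (trans (sym (cong₂ _*_ (trans a≡ (cong (4 * x +_) residue-2)) (trans b≡ (cong (4 * y +_) residue-1)))) eq)
                           (2-1-nonsquare x y c)
        c-small : ∀ {c} → HalfSquare a c → c < γ * γ + ℓ
        c-small {c} (b , b∈ , eq) = ≰⇒> λ c≥ → <⇒≱ (*-mono-< (small-block {k} a∈k small) (b-small {b} {c} b∈ eq))
          (≤-trans (*-mono-≤ c≥ c≥) (≤-reflexive (sym eq)))
      ... | inj₂ (large , _) = ≤-trans (length-filter≤∑ em (λ c → em {HalfSquare a c}) B) (begin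
          ∑ B (λ c → 𝟙 (HalfSquare a c))                              ≡⟨ trans (∑-concat (map candidates bads)) (∑-map candidates bads) ⟩
          ∑ bads (λ j → ∑ (candidates j) (λ c → 𝟙 (HalfSquare a c)))  ≤⟨ ∑-≤-const 64 bads per-block ⟩
          m * 64                                                      ≡⟨ *-comm m 64 ⟩
          64 * m                                                      ≤⟨ m≤n+m (64 * m) (γ * γ + ℓ) ⟩
          γ * γ + ℓ + 64 * m                                          ∎)
        where
        open ≤-Reasoning
        γγ≤a : γ * γ ≤ a
        γγ≤a = ≤-trans large (<⇒≤ (proj₁ (proj₁ (candidates-inBlock {k} a∈k))))
        square : ∀ {c} → HalfSquare a c → a ∣ c * c
        square (b , _ , eq) = divides b (trans (sym eq) (*-comm a b))
        per-block : ∀ {j} → j ∈ˡ bads → ∑ (candidates j) (λ c → 𝟙 (HalfSquare a c)) ≤ 64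
        per-block {j} j∈ = ∑-𝟙-fibres em offset 64 (candidates-unique j) (λ c∈ _ → offset<64 c∈)
          (λ {x} {y} x∈ y∈ hx hy eq → spread x∈ y∈ hx hy eq)
          where
          offset : ℕ → ℕ
          offset c = (c ∸ origin j) / γ
          above : ∀ {c} → c ∈ˡ candidates j → origin j ≤ c
          above c∈ = <⇒≤ (proj₁ (proj₁ (candidates-inBlock {j} c∈)))
          offset<64 : ∀ {c} → c ∈ˡ candidates j → offset c < 64
          offset<64 {c} c∈ = m<n*o⇒m/o<n (begin-strict
            c ∸ origin j               <⟨ ∸-monoˡ-< (proj₂ (candidates-inBlock {j} c∈)) (above c∈) ⟩
            origin j + ℓ ∸ origin j    ≡⟨ m+n∸m≡n (origin j) ℓ ⟩
            ℓ                          ≡⟨ ℓ≡ ⟩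
            64 * γ                     ∎)
          close : ∀ {x y} → x ∈ˡ candidates j → y ∈ˡ candidates j → offset x ≡ offset y → y < x + γ
          close {x} {y} x∈ y∈ eq = begin-strict
            y                                              ≡⟨ m+[n∸m]≡n (above y∈) ⟨
            origin j + (y ∸ origin j)                      ≡⟨ cong (origin j +_) (m≡m%n+[m/n]*n (y ∸ origin j) γ) ⟩
            origin j + ((y ∸ origin j) % γ + offset y * γ)  <⟨ +-monoʳ-< (origin j) (+-monoˡ-< (offset y * γ) (m%n<n (y ∸ origin j) γ)) ⟩
            origin j + (γ + offset y * γ)                  ≡⟨ cong (λ q → origin j + (γ + q * γ)) eq ⟨
            origin j + (γ + offset x * γ)                  ≤⟨ +-monoʳ-≤ (origin j) (+-monoʳ-≤ γ (≤-trans (m≤n+m _ ((x ∸ origin j) % γ)) (≤-reflexive (sym (m≡m%n+[m/n]*n (x ∸ origin j) γ))))) ⟩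
            origin j + (γ + (x ∸ origin j))                ≡⟨ close-shuffle (origin j) γ (x ∸ origin j) ⟩
            origin j + (x ∸ origin j) + γ                  ≡⟨ cong (_+ γ) (m+[n∸m]≡n (above x∈)) ⟩
            x + γ                                          ∎
          spread : ∀ {x y} → x ∈ˡ candidates j → y ∈ˡ candidates j → HalfSquare a x → HalfSquare a y → offset x ≡ offset y → x ≡ y
          spread {x} {y} x∈ y∈ hx hy eq with ≤-total x y
          ... | inj₁ x≤y = square-multiples-spread γγ≤a (proj₁ (B-range (∈B⁺ j∈ x∈))) (proj₁ (B-range (∈B⁺ j∈ y∈)))
                             (square {x} hx) (square {y} hy) x≤y (close x∈ y∈ eq)
          ... | inj₂ y≤x = sym (square-multiples-spread γγ≤a (proj₁ (B-range (∈B⁺ j∈ y∈))) (proj₁ (B-range (∈B⁺ j∈ x∈)))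
                             (square {y} hy) (square {x} hx) y≤x (close y∈ x∈ (sym eq)))

      -- Once 8 γ is taken out, the bracket consists of γ², of 64 γ ≤ γ² and of terms in m and t
      -- that sum to at most 6 γ². Together this is 8 γ², and 8 γ times 8 γ² is exactly (4 γ)^3.
      few-edges : ∀ {a} → a ∈ˡ B → 2 * (length (edges₂ a) * (4 * γ) + length (edges₃ a)) ≤ (4 * γ) ^ 3
      few-edges {a} a∈ = begin
        2 * (length (edges₂ a) * (4 * γ) + length (edges₃ a))
          ≡⟨ cong₂ (λ x y → 2 * (x * (4 * γ) + y)) (length-edges₂ a) (length-edges₃ a) ⟩
        2 * ((length (divisorsOf (a * a)) + length (filter (λ c → em {HalfSquare a c}) B)) * (4 * γ) + ∑ B (λ b → length (divisorsOf (a * b))))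
          ≤⟨ *-monoʳ-≤ 2 (+-mono-≤ (*-monoˡ-≤ (4 * γ) (+-mono-≤ (divisors≤t a∈) (few-half-squares a∈))) (∑-≤-const t B divisors≤t)) ⟩
        2 * ((t + (γ * γ + ℓ + 64 * m)) * (4 * γ) + length B * t)
          ≡⟨ cong₂ (λ x y → 2 * ((t + (γ * γ + x + 64 * m)) * (4 * γ) + y * t)) ℓ≡ length-B ⟩
        2 * ((t + (γ * γ + 64 * γ + 64 * m)) * (4 * γ) + m * (16 * γ) * t)
          ≡⟨ edges-expand γ m t ⟩
        8 * γ * (γ * γ + 64 * γ + (t + 64 * m + 4 * (m * t)))
          ≤⟨ *-monoʳ-≤ (8 * γ) (+-mono-≤ (+-monoʳ-≤ (γ * γ) (*-monoˡ-≤ γ 64≤γ)) mt-terms) ⟩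
        8 * γ * (γ * γ + γ * γ + 6 * (γ * γ))
          ≡⟨ edges-collect γ ⟩
        (4 * γ) ^ 3  ∎
        where
        open ≤-Reasoning
        divisors≤t : ∀ {b} → b ∈ˡ B → length (divisorsOf (a * b)) ≤ t
        divisors≤t {b} b∈ = divisorsOf-length (a * b) (*-mono-≤ (proj₁ (B-range a∈)) (proj₁ (B-range b∈)))
                                                      (*-mono-≤ (proj₂ (B-range a∈)) (proj₂ (B-range b∈)))
        1≤m : 1 ≤ m
        1≤m = let _ , k∈ , _ = ∈B⁻ a∈ in nonempty k∈
        1≤t : 1 ≤ t
        1≤t = ≤-trans (nonempty (divisorsOf-complete (a * a) (*-mono-≤ (proj₁ (B-range a∈)) (proj₁ (B-range a∈))) (1∣ (a * a)))) (divisors≤t a∈)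
        mt-terms : t + 64 * m + 4 * (m * t) ≤ 6 * (γ * γ)
        mt-terms = begin
          t + 64 * m + 4 * (m * t)
            ≤⟨ +-monoˡ-≤ (4 * (m * t)) (+-mono-≤ (m≤n*m t m {{ℕ.>-nonZero 1≤m}}) (*-monoʳ-≤ 64 (m≤m*n m t {{ℕ.>-nonZero 1≤t}}))) ⟩
          m * t + 64 * (m * t) + 4 * (m * t)  ≡⟨ edges-gather (m * t) ⟩
          -- The factor 12 in `few-sparse` is made for this step: 69 ≤ 72 = 6 · 12.
          69 * (m * t)                        ≤⟨ *-monoˡ-≤ (m * t) (≤ᵇ⇒≤ 69 72 _) ⟩
          72 * (m * t)                        ≡⟨ *-assoc 6 12 (m * t) ⟩
          6 * (12 * (m * t))                  ≤⟨ *-monoʳ-≤ 6 few-sparse ⟩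
          6 * (γ * γ)                         ∎

      classes : List (List ℕ)
      classes = map class bads

      class-inBlock : ∀ {k a} → a ∈ˡ class k → InBlock k a
      class-inBlock {k} a∈ = proj₁ (candidates-inBlock {k} (proj₁ (∈-filter⁻ free? {xs = candidates k} a∈)))

      open Transversal em Sidon (λ ()) sidon-⊆ (4 * γ) (*-mono-≤ {1} {4} (s≤s z≤n) 1≤γ) (_∈ˡ B) edges₂ edges₃

      classes-admissible : Admissible classes
      classes-admissible = All.map⁺ (All.tabulate λ {k} k∈ →
          Unique.filter⁺ free? (candidates-unique k) ,
          ≤-trans (≤-reflexive (sym (*-assoc 2 4 γ))) (length-class k∈) ,
          All.tabulate (λ a∈ → ∈B⁺ k∈ (proj₁ (∈-filter⁻ free? {xs = candidates k} a∈)))) ,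
        disjoint-blocks class (λ {k} → class-inBlock {k}) bads-unique

      abstract
        selected : ∃[ xs ] Choice classes xs × Sidon xs
        selected = transversal few-edges sidon-conflict classes classes-admissible

      xs : List ℕ
      xs = proj₁ selected

      xs-choice : Choice classes xs
      xs-choice = proj₁ (proj₂ selected)

      ∈σ⁻ : ∀ {p} → p ∈ˡ σ → Prime p × ∃[ k ] k < M × InBlock k p
      ∈σ⁻ p∈ = let J , J∈ , p∈J = choice-∈ σ-choice p∈ in ∈-primeClasses J∈ p∈J

      ∈classes⁻ : ∀ {C x} → C ∈ˡ classes → x ∈ˡ C → Free x × ∃[ k ] k < M × InBlock k x
      ∈classes⁻ C∈ x∈C with ∈-map⁻ class C∈
      ... | k , k∈ , refl = proj₂ (∈-filter⁻ free? {xs = candidates k} x∈C) , k , bad-< k∈ , class-inBlock {k} x∈C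

      ∈xs⁻ : ∀ {x} → x ∈ˡ xs → Free x × ∃[ k ] k < M × InBlock k x
      ∈xs⁻ x∈ = let C , C∈ , x∈C = choice-∈ xs-choice x∈ in ∈classes⁻ C∈ x∈C

    hitting-sidon-set : ∃[ A ] (∀ {a} → a ∈ˡ A → 1 ≤ a × a ≤ n) × Sidon A ×
                        (∀ {k} → k < M → ∃[ a ] a ∈ˡ A × Blocks.InBlock ℓ k a)
    hitting-sidon-set = σ ++ xs , range ,
      (λ {a} {b} {c} {d} → sidon-++-primes σ (proj₁ ∘ ∈σ⁻) (λ p∈ x∈ → All.lookup (proj₁ (∈xs⁻ x∈)) p∈) (proj₂ (proj₂ selected)) {a} {b} {c} {d}) ,
      hit
      where
      range : ∀ {a} → a ∈ˡ σ ++ xs → 1 ≤ a × a ≤ n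
      range a∈ with ∈-++⁻ σ a∈
      ... | inj₁ a∈σ  = let _ , k , k<M , inB = ∈σ⁻ a∈σ in inBlock⇒≥1 {k} inB , inBlock⇒≤n {k} k<M inB
      ... | inj₂ a∈xs = let _ , k , k<M , inB = ∈xs⁻ a∈xs in inBlock⇒≥1 {k} inB , inBlock⇒≤n {k} k<M inB
      hit : ∀ {k} → k < M → ∃[ a ] a ∈ˡ σ ++ xs × InBlock k a
      hit {k} k<M with sparse? kk k
      ... | yes sparse = let x , x∈ , x∈C = choice-∋ xs-choice (∈-map⁺ class (∈-filter⁺ (sparse? kk) (∈-upTo⁺ k<M) sparse))
                         in x , ∈-++⁺ʳ σ x∈ , class-inBlock {k} x∈C
      ... | no ¬sparse = let p , p∈ , p∈J = choice-∋ σ-choice (∈-map⁺ (λ k → take (5 ^ kk) (blockPrimes k)) (∈-filter⁺ (¬? ∘ sparse? kk) (∈-upTo⁺ k<M) ¬sparse))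
                         in p , ∈-++⁺ˡ p∈ , proj₂ (primeClass-inBlock {k} p∈J)

  -- Arithmetic of the exponents

  -- The witness w is the q-th root of N rounded up, found by descending from N. Rounding costs at
  -- most a factor 2 in w, as w ≤ 2 (w - 1) for w ≥ 2.
  ceiling-root : ∀ N q → 1 ≤ N → 1 ≤ q → ∃[ w ] N ≤ w ^ q × w ^ q ≤ 2 ^ q * N
  ceiling-root N q 1≤N 1≤q = go N (≤-trans (≤-reflexive (sym (^-identityʳ N))) (^-monoʳ-≤ N {{ℕ.>-nonZero 1≤N}} 1≤q))
    where
    open ≤-Reasoning
    go : ∀ w → N ≤ w ^ q → ∃[ w ] N ≤ w ^ q × w ^ q ≤ 2 ^ q * N
    go zero N≤ = contradiction (≤-trans 1≤N (≤-trans N≤ (≤-reflexive (0^q q 1≤q)))) λ ()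
      where
      0^q : ∀ q → 1 ≤ q → 0 ^ q ≡ 0
      0^q (suc q) _ = refl
    go (suc v) N≤ with N ≤? v ^ q
    ... | yes N≤v = go v N≤v
    go 1 N≤ | no _ = 1 , N≤ , (begin
      1 ^ q             ≡⟨ ^-zeroˡ q ⟩
      1                   ≤⟨ *-mono-≤ (^-positive {2} q (s≤s z≤n)) 1≤N ⟩
      2 ^ q * N       ∎)
    go w@(suc v@(suc u)) N≤ | no N≰v = w , N≤ , (begin
      w ^ q             ≤⟨ ^-monoˡ-≤ q (≤-trans (≤-reflexive (+-comm 1 v)) (+-monoʳ-≤ v {1} {v + 0} (s≤s z≤n))) ⟩
      (2 * v) ^ q     ≡⟨ ^-distribʳ-* 2 v q ⟩
      2 ^ q * v ^ q ≤⟨ *-monoʳ-≤ (2 ^ q) (<⇒≤ (≰⇒> N≰v)) ⟩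
      2 ^ q * N       ∎)

  double-16 : ∀ m γ → 2 * (16 * (m * γ)) ≡ m * (32 * γ)
  double-16 = solve-∀

  ^-cancelˡ-≤ : ∀ {x y} q → 1 ≤ q → x ^ q ≤ y ^ q → x ≤ y
  ^-cancelˡ-≤ {x} {y} q 1≤q le with x ≤? y
  ... | yes x≤y = x≤y
  ... | no  x≰y = contradiction le (<⇒≱ (^-monoˡ-< q {{ℕ.>-nonZero 1≤q}} (≰⇒> x≰y)))

  ^-cancelˡ-< : ∀ {x y} q → x ^ q < y ^ q → x < y
  ^-cancelˡ-< {x} {y} q lt = ≰⇒> λ y≤x → <⇒≱ lt (^-monoˡ-≤ q y≤x)

  -- The bound for (n + 1)^(q + 1) has one factor n to spare, which absorbs the constants (q + 1)^(q
  -- + 1) and 64^q as soon as n ≥ n₀.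
  [64n]^q≤2^n : ∀ q → ∃[ n₀ ] ∀ n → n₀ ≤ n → (64 * n) ^ q ≤ 2 ^ n
  [64n]^q≤2^n q = k ^ k * 64 ^ q , λ n n₀≤n → *-cancelˡ-≤ (k ^ k) {{m^n≢0 k k}} (begin
    k ^ k * (64 * n) ^ q        ≡⟨ cong (k ^ k *_) (^-distribʳ-* 64 n q) ⟩
    k ^ k * (64 ^ q * n ^ q)    ≡⟨ *-assoc (k ^ k) (64 ^ q) (n ^ q) ⟨
    k ^ k * 64 ^ q * n ^ q      ≤⟨ *-monoˡ-≤ (n ^ q) n₀≤n ⟩
    n ^ k                       ≤⟨ ^-monoˡ-≤ k (n≤1+n n) ⟩
    suc n ^ k                   ≤⟨ [1+n]^k≤k^k*2^n k n ⟩
    k ^ k * 2 ^ n               ∎)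
    where
    open ≤-Reasoning
    k = suc q

  squares≤ : ∀ D {n} → D ≤ n → D * (n * n) ≤ n ^ 4
  squares≤ D {n} D≤n = begin
    D * (n * n)          ≤⟨ *-monoˡ-≤ (n * n) (≤-trans D≤n (m≤m*m n)) ⟩
    n * n * (n * n)      ≡⟨ fourth n ⟩
    n ^ 4                ∎
    where
    open ≤-Reasoning
    m≤m*m : ∀ m → m ≤ m * m
    m≤m*m zero    = z≤n
    m≤m*m (suc m) = m≤m*n (suc m) (suc m)
    fourth : ∀ n → n * n * (n * n) ≡ n * (n * (n * (n * 1)))
    fourth = solve-∀

  -- Here p/q stands for an upper bound of the exponent of the exceptional measure and r/q for a
  -- lower bound of α. The gap p + 1 ≤ 3 r leaves a spare factor n^(1/q) for the divisor bound and
  -- all constants; q ≤ r (kk + 1) says that n is at most the (kk + 1)-st power of n^(r/q).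
  module Exponents (p q r kk : ℕ) (1≤q : 1 ≤ q) (1≤r : 1 ≤ r) (p<3r : suc p ≤ 3 * r) (q≤r[1+kk] : q ≤ r * suc kk) where

    private
      instance
        q≢0 : NonZero q
        q≢0 = ℕ.>-nonZero 1≤q

      -- With exponent 4 q, an integer up to n² has O(n^(1/(2q))) divisors. This uses up half of the
      -- spare n^(1/q); the other half beats the constants.
      bound = divisor-bound (q * 4) {{m*n≢0 q 4}}

      C : ℕ
      C = suc (proj₁ bound)

      K : ℕ
      K = 64 ^ (3 * q)

      -- Defined so that (K t^q)^4 ≤ D n² for the bound t on the number of divisors; once D ≤ n,
      -- this is at most n^4.
      D : ℕ
      D = K ^ 4 * (2 ^ (q * 4) * C)

      γ₀ : ℕ
      γ₀ = 64 + proj₁ ([64n]^q≤2^n q)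

    divisorsOf : ℕ → List ℕ
    divisorsOf zero    = []
    divisorsOf (suc N) = proj₁ (proj₂ bound (suc N) (s≤s z≤n))

    divisorsOf-complete : ∀ N → 1 ≤ N → ContainsDivisors N (divisorsOf N)
    divisorsOf-complete (suc N) _ = proj₁ (proj₂ (proj₂ bound (suc N) (s≤s z≤n)))

    -- Since n ≤ n^r < (64 γ)^q, an n above (64 γ₀)^q forces γ ≥ γ₀; the summand D is there for
    -- `Kt^q≤n`.
    threshold : ℕ
    threshold = suc ((64 * γ₀) ^ q + D)

    module _ {n γ : ℕ} (threshold≤n : threshold ≤ n) (n^r< : n ^ r < (64 * γ) ^ q) where

      private
        1≤n : 1 ≤ n
        1≤n = ≤-trans (s≤s z≤n) threshold≤n

        instance
          n≢0 : NonZero n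
          n≢0 = ℕ.>-nonZero 1≤n

        n<[64γ]^q : n < (64 * γ) ^ q
        n<[64γ]^q = ≤-<-trans (≤-trans (≤-reflexive (sym (^-identityʳ n))) (^-monoʳ-≤ n 1≤r)) n^r<

        γ₀≤γ : γ₀ ≤ γ
        γ₀≤γ = <⇒≤ (*-cancelˡ-< 64 γ₀ γ (^-cancelˡ-< q (≤-<-trans
          (≤-trans (m≤m+n ((64 * γ₀) ^ q) D) (≤-trans (n≤1+n _) threshold≤n)) n<[64γ]^q)))

      64≤γ : 64 ≤ γ
      64≤γ = ≤-trans (m≤m+n 64 _) γ₀≤γ

      n<2^γ : n < 2 ^ γ
      n<2^γ = <-≤-trans n<[64γ]^q (proj₂ ([64n]^q≤2^n q) γ (≤-trans (m≤n+m _ 64) γ₀≤γ))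

      n<[64γ]^[1+kk] : n < (64 * γ) ^ suc kk
      n<[64γ]^[1+kk] = ^-cancelˡ-< q (begin-strict
        n ^ q                          ≤⟨ ^-monoʳ-≤ n q≤r[1+kk] ⟩
        n ^ (r * suc kk)               ≡⟨ ^-*-assoc n r (suc kk) ⟨
        (n ^ r) ^ suc kk               <⟨ ^-monoˡ-< (suc kk) n^r< ⟩
        ((64 * γ) ^ q) ^ suc kk        ≡⟨ trans (^-*-assoc (64 * γ) q (suc kk)) (trans (cong ((64 * γ) ^_) (*-comm q (suc kk))) (sym (^-*-assoc (64 * γ) (suc kk) q))) ⟩
        ((64 * γ) ^ suc kk) ^ q        ∎)
        where open ≤-Reasoning

      private
        root = ceiling-root (C * (n * n)) (q * 4) (*-mono-≤ {1} {C} (s≤s z≤n) (*-mono-≤ 1≤n 1≤n)) (*-mono-≤ {1} {q} {1} {4} 1≤q (s≤s z≤n))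

      maxDivisors : ℕ
      maxDivisors = proj₁ root

      divisorsOf-length : ∀ N → 1 ≤ N → N ≤ n * n → length (divisorsOf N) ≤ maxDivisors
      divisorsOf-length (suc N) _ N≤ = ^-cancelˡ-≤ (q * 4) (*-mono-≤ {1} {q} {1} {4} 1≤q (s≤s z≤n)) (begin
        length (divisorsOf (suc N)) ^ (q * 4)  ≤⟨ proj₂ (proj₂ (proj₂ bound (suc N) (s≤s z≤n))) ⟩
        proj₁ bound * suc N                    ≤⟨ *-mono-≤ (n≤1+n (proj₁ bound)) N≤ ⟩
        C * (n * n)                            ≤⟨ proj₁ (proj₂ root) ⟩
        maxDivisors ^ (q * 4)                  ∎)
        where open ≤-Reasoning

      private
        Kt^q≤n : K * maxDivisors ^ q ≤ n
        Kt^q≤n = ^-cancelˡ-≤ 4 (s≤s z≤n) (begin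
          (K * t ^ q) ^ 4                              ≡⟨ ^-distribʳ-* K (t ^ q) 4 ⟩
          K ^ 4 * (t ^ q) ^ 4                          ≡⟨ cong (K ^ 4 *_) (^-*-assoc t q 4) ⟩
          K ^ 4 * t ^ (q * 4)                          ≤⟨ *-monoʳ-≤ (K ^ 4) (proj₂ (proj₂ root)) ⟩
          K ^ 4 * (2 ^ (q * 4) * (C * (n * n)))        ≡⟨ cong (K ^ 4 *_) (*-assoc (2 ^ (q * 4)) C (n * n)) ⟨
          K ^ 4 * (2 ^ (q * 4) * C * (n * n))          ≡⟨ *-assoc (K ^ 4) (2 ^ (q * 4) * C) (n * n) ⟨
          D * (n * n)                                  ≤⟨ squares≤ D (≤-trans (m≤n+m D ((64 * γ₀) ^ q)) (≤-trans (n≤1+n _) threshold≤n)) ⟩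
          n ^ 4                                        ∎)
          where
          open ≤-Reasoning
          t = maxDivisors

      -- Both sides are multiplied by γ and raised to the q-th power, with K in front. Then m γ
      -- contributes n^p and K t^q at most n, and n^(p + 1) ≤ n^(3 r) ≤ (64 γ)^(3 q) = K γ^(3 q).
      few-sparse : ∀ m → (16 * (m * γ)) ^ q ≤ n ^ p → 12 * (m * maxDivisors) ≤ γ * γ
      few-sparse m mγ≤ = *-cancelʳ-≤ _ _ γ {{ℕ.>-nonZero (≤-trans (s≤s z≤n) 64≤γ)}} (^-cancelˡ-≤ q 1≤q
          (*-cancelˡ-≤ K {{m^n≢0 64 (3 * q)}} (begin
        K * (12 * (m * t) * γ) ^ q               ≤⟨ *-monoʳ-≤ K (^-monoˡ-≤ q (*-monoˡ-≤ γ (*-monoˡ-≤ (m * t) (≤ᵇ⇒≤ 12 16 _)))) ⟩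
        K * (16 * (m * t) * γ) ^ q               ≡⟨ cong (λ z → K * z ^ q) (regroup 16 m t γ) ⟩
        K * (t * (16 * (m * γ))) ^ q             ≡⟨ cong (K *_) (^-distribʳ-* t (16 * (m * γ)) q) ⟩
        K * (t ^ q * (16 * (m * γ)) ^ q)         ≡⟨ *-assoc K (t ^ q) ((16 * (m * γ)) ^ q) ⟨
        K * t ^ q * (16 * (m * γ)) ^ q           ≤⟨ *-mono-≤ Kt^q≤n mγ≤ ⟩
        n ^ suc p                                ≤⟨ ^-monoʳ-≤ n p<3r ⟩
        n ^ (3 * r)                              ≡⟨ trans (cong (n ^_) (*-comm 3 r)) (sym (^-*-assoc n r 3)) ⟩
        (n ^ r) ^ 3                              ≤⟨ ^-monoˡ-≤ 3 (<⇒≤ n^r<) ⟩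
        ((64 * γ) ^ q) ^ 3                       ≡⟨ trans (^-*-assoc (64 * γ) q 3) (cong ((64 * γ) ^_) (*-comm q 3)) ⟩
        (64 * γ) ^ (3 * q)                       ≡⟨ ^-distribʳ-* 64 γ (3 * q) ⟩
        K * γ ^ (3 * q)                          ≡⟨ cong (K *_) (trans (sym (^-*-assoc γ 3 q)) (cong (_^ q) (cube γ))) ⟩
        K * (γ * γ * γ) ^ q                      ∎)))
        where
        open ≤-Reasoning
        t = maxDivisors
        regroup : ∀ c m t g → c * (m * t) * g ≡ t * (c * (m * g))
        regroup = solve-∀
        cube : ∀ g → g * (g * (g * 1)) ≡ g * g * g
        cube = solve-∀

module Analytic where

  open Combinatorics using (Sidon; module Blocks; module Construction; ^-distribʳ-*; ^-positive; ceiling-root; double-16; module Exponents)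
  open import Algebra.Bundles using (CommutativeRing)
  import Algebra.Properties.Monoid.Mult as MonoidMult
  import Algebra.Properties.Ring as RingProperties
  import Algebra.Properties.Semiring.Exp as SemiringExp
  import Algebra.Properties.Semiring.Mult as SemiringMult
  open import Data.Empty using (⊥-elim)
  open import Data.Fin.Base using (toℕ)
  open import Data.List.Base using ([]; length; filter; upTo; [_])
  open import Data.List.Membership.Propositional.Properties using (∈-filter⁺; ∈-filter⁻)
  open import Data.List.Membership.Propositional using () renaming (_∈_ to _∈ˡ_)
  open import Data.List.Properties using (upTo-∷ʳ; filter-++; filter-accept; filter-reject; length-++; length-filter)
  import Data.List.Relation.Unary.Unique.Propositional.Properties as Unique
  open import Data.Nat.Base as ℕ using (ℕ; zero; suc)
  open import Data.Nat.DivMod using (m≡m%n+[m/n]*n; m%n<n)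
  import Data.Nat.Properties as ℕ
  open import Data.Product.Base using (_×_; _,_; proj₁; proj₂; ∃; Σ-syntax)
  open import Data.Sum.Base using (_⊎_; inj₁; inj₂)
  open import Relation.Binary.Bundles using (Poset)
  open import Relation.Binary.PropositionalEquality.Core as ≡ using (_≡_)
  import Relation.Binary.Reasoning.PartialOrder as PartialOrderReasoning
  open import Relation.Binary.Structures using (IsTotalOrder)
  open import Relation.Nullary using (¬_; yes; no; contradiction)
  open import Relation.Unary using (Pred; _∈_; Decidable)

  -- Ordered fields

  module OrderedField (em : ExcludedMiddle 0ℓ) (R : CompleteOrderedField) where

    open Analysis em R public
    open CompleteOrderedField R public using (-_; _≉_; commutativeRing; 0≉1; *-inverseʳ; isTotalOrder; +-monoˡ-≤; *-nonneg; complete)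
    open CommutativeRing commutativeRing public
      using (refl; sym; trans; +-cong; +-congˡ; +-congʳ; *-cong; *-congˡ; *-congʳ; +-comm; +-assoc; +-identityˡ; +-identityʳ;
             *-comm; *-assoc; *-identityˡ; *-identityʳ; distribˡ; distribʳ; zeroˡ; zeroʳ; -‿inverseˡ; -‿inverseʳ)
    open IsTotalOrder isTotalOrder public
      using (total; antisym)
      renaming (refl to ≤-refl; reflexive to ≤-reflexive; trans to ≤-trans; ≤-respˡ-≈ to ≤-respˡ; ≤-respʳ-≈ to ≤-respʳ)
    open CommutativeRing commutativeRing using (ring; semiring; +-monoid)
    open RingProperties ring public using (-1*x≈-x; -‿involutive)

    poset : Poset 0ℓ 0ℓ 0ℓ
    poset = record { isPartialOrder = IsTotalOrder.isPartialOrder isTotalOrder }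

    module ≤-Reasoning = PartialOrderReasoning poset

    <⇒≤ : ∀ {x y} → x < y → x ≤ y
    <⇒≤ = proj₁

    <⇒≱ : ∀ {x y} → x < y → ¬ y ≤ x
    <⇒≱ (x≤y , x≉y) y≤x = x≉y (antisym x≤y y≤x)

    ≰⇒> : ∀ {x y} → ¬ x ≤ y → y < x
    ≰⇒> {x} {y} x≰y with total x y
    ... | inj₁ x≤y = contradiction x≤y x≰y
    ... | inj₂ y≤x = y≤x , λ y≈x → x≰y (≤-reflexive (sym y≈x))

    ≮⇒≥ : ∀ {x y} → ¬ x < y → y ≤ x
    ≮⇒≥ {x} {y} x≮y with em {y ≤ x}
    ... | yes y≤x = y≤x
    ... | no  y≰x = contradiction (≰⇒> y≰x) x≮y

    <-≤-trans : ∀ {x y z} → x < y → y ≤ z → x < z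
    <-≤-trans {x} {y} {z} x<y y≤z = begin-strict x <⟨ x<y ⟩ y ≤⟨ y≤z ⟩ z ∎
      where open ≤-Reasoning

    ≤-<-trans : ∀ {x y z} → x ≤ y → y < z → x < z
    ≤-<-trans {x} {y} {z} x≤y y<z = begin-strict x ≤⟨ x≤y ⟩ y <⟨ y<z ⟩ z ∎
      where open ≤-Reasoning

    <-irrefl : ∀ {x} → ¬ x < x
    <-irrefl (_ , x≉x) = x≉x refl

    +-monoʳ-≤ : ∀ z {x y} → x ≤ y → z + x ≤ z + y
    +-monoʳ-≤ z {x} {y} x≤y = begin z + x ≈⟨ +-comm z x ⟩ x + z ≤⟨ +-monoˡ-≤ z x≤y ⟩ y + z ≈⟨ +-comm y z ⟩ z + y ∎
      where open ≤-Reasoning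

    +-mono-≤ : ∀ {x y u v} → x ≤ y → u ≤ v → x + u ≤ y + v
    +-mono-≤ {y = y} {u = u} x≤y u≤v = ≤-trans (+-monoˡ-≤ u x≤y) (+-monoʳ-≤ y u≤v)

    x+z-z≈x : ∀ x z → (x + z) - z ≈ x
    x+z-z≈x x z = trans (+-assoc x z (- z)) (trans (+-congˡ (-‿inverseʳ z)) (+-identityʳ x))

    x-z+z≈x : ∀ x z → (x - z) + z ≈ x
    x-z+z≈x x z = trans (+-assoc x (- z) z) (trans (+-congˡ (-‿inverseˡ z)) (+-identityʳ x))

    +-cancelʳ-≤ : ∀ z {x y} → x + z ≤ y + z → x ≤ y
    +-cancelʳ-≤ z {x} {y} le = begin
      x              ≈⟨ x+z-z≈x x z ⟨
      (x + z) - z    ≤⟨ +-monoˡ-≤ (- z) le ⟩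
      (y + z) - z    ≈⟨ x+z-z≈x y z ⟩
      y              ∎
      where open ≤-Reasoning

    +-cancelˡ-≤ : ∀ z {x y} → z + x ≤ z + y → x ≤ y
    +-cancelˡ-≤ z {x} {y} le = +-cancelʳ-≤ z (≤-respˡ (+-comm z x) (≤-respʳ (+-comm z y) le))

    +-monoˡ-< : ∀ z {x y} → x < y → x + z < y + z
    +-monoˡ-< z x<y = ≰⇒> λ le → <⇒≱ x<y (+-cancelʳ-≤ z le)

    +-monoʳ-< : ∀ z {x y} → x < y → z + x < z + y
    +-monoʳ-< z x<y = ≰⇒> λ le → <⇒≱ x<y (+-cancelˡ-≤ z le)

    x≤x+y : ∀ x {y} → 0# ≤ y → x ≤ x + y
    x≤x+y x 0≤y = ≤-respˡ (+-identityʳ x) (+-monoʳ-≤ x 0≤y)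

    x<x+y : ∀ x {y} → 0# < y → x < x + y
    x<x+y x 0<y = ≤-<-trans (≤-reflexive (sym (+-identityʳ x))) (+-monoʳ-< x 0<y)

    x≤y+x : ∀ x {y} → 0# ≤ y → x ≤ y + x
    x≤y+x x 0≤y = ≤-respˡ (+-identityˡ x) (+-monoˡ-≤ x 0≤y)

    0≤y-x : ∀ {x y} → x ≤ y → 0# ≤ y - x
    0≤y-x {x} {y} x≤y = ≤-respˡ (-‿inverseʳ x) (+-monoˡ-≤ (- x) x≤y)

    *-monoʳ-≤ : ∀ {z x y} → 0# ≤ z → x ≤ y → z * x ≤ z * y
    *-monoʳ-≤ {z} {x} {y} 0≤z x≤y = begin
      z * x                    ≤⟨ x≤y+x (z * x) (*-nonneg 0≤z (0≤y-x x≤y)) ⟩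
      z * (y - x) + z * x      ≈⟨ distribˡ z (y - x) x ⟨
      z * ((y - x) + x)        ≈⟨ *-congˡ (x-z+z≈x y x) ⟩
      z * y                    ∎
      where open ≤-Reasoning

    *-monoˡ-≤ : ∀ {z x y} → 0# ≤ z → x ≤ y → x * z ≤ y * z
    *-monoˡ-≤ {z} {x} {y} 0≤z x≤y = ≤-respˡ (*-comm z x) (≤-respʳ (*-comm z y) (*-monoʳ-≤ 0≤z x≤y))

    *-mono-≤ : ∀ {x y u v} → 0# ≤ u → 0# ≤ y → x ≤ y → u ≤ v → x * u ≤ y * v
    *-mono-≤ 0≤u 0≤y x≤y u≤v = ≤-trans (*-monoˡ-≤ 0≤u x≤y) (*-monoʳ-≤ 0≤y u≤v)

    *-cancelʳ : ∀ {z x y} → 0# < z → x * z ≈ y * z → x ≈ y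
    *-cancelʳ {z} {x} {y} 0<z eq = trans (sym (cancel x)) (trans (*-congʳ eq) (cancel y))
      where
      cancel : ∀ w → w * z * z ⁻¹ ≈ w
      cancel w = trans (*-assoc w z (z ⁻¹)) (trans (*-congˡ (*-inverseʳ (λ z≈0 → proj₂ 0<z (sym z≈0)))) (*-identityʳ w))

    *-monoˡ-< : ∀ {z x y} → 0# < z → x < y → x * z < y * z
    *-monoˡ-< 0<z x<y = *-monoˡ-≤ (<⇒≤ 0<z) (<⇒≤ x<y) , λ eq → proj₂ x<y (*-cancelʳ 0<z eq)

    *-cancelʳ-≤ : ∀ {z x y} → 0# < z → x * z ≤ y * z → x ≤ y
    *-cancelʳ-≤ 0<z le = ≮⇒≥ λ y<x → <⇒≱ (*-monoˡ-< 0<z y<x) le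

    0≤1 : 0# ≤ 1#
    0≤1 with total 0# 1#
    ... | inj₁ 0≤1 = 0≤1
    ... | inj₂ 1≤0 = ≤-respʳ (trans (-1*x≈-x (- 1#)) (-‿involutive 1#)) (*-nonneg 0≤-1 0≤-1)
      where
      0≤-1 : 0# ≤ - 1#
      0≤-1 = ≤-respʳ (+-identityˡ (- 1#)) (0≤y-x 1≤0)

    0<1 : 0# < 1#
    0<1 = 0≤1 , 0≉1

    0<⇒0<⁻¹ : ∀ {x} → 0# < x → 0# < x ⁻¹
    0<⇒0<⁻¹ {x} 0<x = ≰⇒> λ x⁻¹≤0 → <⇒≱ 0<1 (begin
      1#           ≈⟨ *-inverseʳ (λ x≈0 → proj₂ 0<x (sym x≈0)) ⟨
      x * x ⁻¹     ≤⟨ *-monoʳ-≤ (<⇒≤ 0<x) x⁻¹≤0 ⟩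
      x * 0#       ≈⟨ zeroʳ x ⟩
      0#           ∎)
      where open ≤-Reasoning

    *-inverse : ∀ {x} → 0# < x → x * x ⁻¹ ≈ 1#
    *-inverse 0<x = *-inverseʳ (λ x≈0 → proj₂ 0<x (sym x≈0))

    fromℕ-+ : ∀ m n → fromℕ (m ℕ.+ n) ≈ fromℕ m + fromℕ n
    fromℕ-+ = MonoidMult.×-homo-+ +-monoid 1#

    fromℕ-* : ∀ m n → fromℕ (m ℕ.* n) ≈ fromℕ m * fromℕ n
    fromℕ-* = SemiringMult.×1-homo-* semiring

    fromℕ-1 : fromℕ 1 ≈ 1#
    fromℕ-1 = +-identityʳ 1#

    0≤fromℕ : ∀ n → 0# ≤ fromℕ n
    0≤fromℕ zero    = ≤-refl
    0≤fromℕ (suc n) = ≤-trans (0≤fromℕ n) (x≤y+x (fromℕ n) 0≤1)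

    fromℕ-mono-≤ : ∀ {m n} → m ℕ.≤ n → fromℕ m ≤ fromℕ n
    fromℕ-mono-≤ {n = n} ℕ.z≤n = 0≤fromℕ n
    fromℕ-mono-≤ (ℕ.s≤s m≤n)   = +-monoʳ-≤ 1# (fromℕ-mono-≤ m≤n)

    fromℕ<fromℕ-suc : ∀ n → fromℕ n < fromℕ (suc n)
    fromℕ<fromℕ-suc n = <-≤-trans (x<x+y (fromℕ n) 0<1) (≤-reflexive (+-comm (fromℕ n) 1#))

    fromℕ-mono-< : ∀ {m n} → m ℕ.< n → fromℕ m < fromℕ n
    fromℕ-mono-< {m} m<n = <-≤-trans (fromℕ<fromℕ-suc m) (fromℕ-mono-≤ m<n)

    fromℕ-cancel-≤ : ∀ {m n} → fromℕ m ≤ fromℕ n → m ℕ.≤ n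
    fromℕ-cancel-≤ {m} {n} le = ℕ.≮⇒≥ λ n<m → <⇒≱ (fromℕ-mono-< n<m) le

    fromℕ-cancel-< : ∀ {m n} → fromℕ m < fromℕ n → m ℕ.< n
    fromℕ-cancel-< {m} {n} lt = ℕ.≰⇒> λ n≤m → <⇒≱ lt (fromℕ-mono-≤ n≤m)

    1≤fromℕ : ∀ {n} → 1 ℕ.≤ n → 1# ≤ fromℕ n
    1≤fromℕ 1≤n = ≤-respˡ fromℕ-1 (fromℕ-mono-≤ 1≤n)

    fromℕ-^ : ∀ m k → fromℕ (m ℕ.^ k) ≈ fromℕ m ^ⁿ k
    fromℕ-^ m zero    = fromℕ-1
    fromℕ-^ m (suc k) = trans (fromℕ-* m (m ℕ.^ k)) (*-congˡ (fromℕ-^ m k))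

    0≤^ⁿ : ∀ {x} k → 0# ≤ x → 0# ≤ x ^ⁿ k
    0≤^ⁿ zero    0≤x = 0≤1
    0≤^ⁿ (suc k) 0≤x = *-nonneg 0≤x (0≤^ⁿ k 0≤x)

    1≤^ⁿ : ∀ {x} k → 1# ≤ x → 1# ≤ x ^ⁿ k
    1≤^ⁿ zero    1≤x = ≤-refl
    1≤^ⁿ (suc k) 1≤x = ≤-respˡ (*-identityˡ 1#) (*-mono-≤ 0≤1 (≤-trans 0≤1 1≤x) 1≤x (1≤^ⁿ k 1≤x))

    ^ⁿ-monoˡ-≤ : ∀ k {x y} → 0# ≤ x → x ≤ y → x ^ⁿ k ≤ y ^ⁿ k
    ^ⁿ-monoˡ-≤ zero    0≤x x≤y = ≤-refl
    ^ⁿ-monoˡ-≤ (suc k) 0≤x x≤y = *-mono-≤ (0≤^ⁿ k 0≤x) (≤-trans 0≤x x≤y) x≤y (^ⁿ-monoˡ-≤ k 0≤x x≤y)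

    ^ⁿ-* : ∀ x m n → (x ^ⁿ m) ^ⁿ n ≈ x ^ⁿ (m ℕ.* n)
    ^ⁿ-* = SemiringExp.^-assocʳ semiring

    ^ⁿ-monoʳ-≤ : ∀ {x m n} → 1# ≤ x → m ℕ.≤ n → x ^ⁿ m ≤ x ^ⁿ n
    ^ⁿ-monoʳ-≤ {n = n} 1≤x ℕ.z≤n = 1≤^ⁿ n 1≤x
    ^ⁿ-monoʳ-≤ 1≤x (ℕ.s≤s m≤n) = *-monoʳ-≤ (≤-trans 0≤1 1≤x) (^ⁿ-monoʳ-≤ 1≤x m≤n)

    ^ⁿ-monoˡ-< : ∀ k {x y} → 1 ℕ.≤ k → 0# ≤ x → x < y → x ^ⁿ k < y ^ⁿ k
    ^ⁿ-monoˡ-< (suc zero)    _ 0≤x x<y = *-monoˡ-< 0<1 x<y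
    ^ⁿ-monoˡ-< (suc (suc k)) _ 0≤x x<y = step 0≤x x<y (^ⁿ-monoˡ-< (suc k) (ℕ.s≤s ℕ.z≤n) 0≤x x<y)
      where
      step : ∀ {x y} → 0# ≤ x → x < y → x ^ⁿ suc k < y ^ⁿ suc k → x ^ⁿ suc (suc k) < y ^ⁿ suc (suc k)
      step {x} {y} 0≤x x<y ih = begin-strict
        x * x ^ⁿ suc k   ≤⟨ *-monoʳ-≤ 0≤x (<⇒≤ ih) ⟩
        x * y ^ⁿ suc k   <⟨ *-monoˡ-< (≤-<-trans (0≤^ⁿ (suc k) 0≤x) ih) x<y ⟩
        y * y ^ⁿ suc k   ∎
        where open ≤-Reasoning

    ^ⁿ-cancel-≤ : ∀ k {x y} → 1 ℕ.≤ k → 0# ≤ y → x ^ⁿ k ≤ y ^ⁿ k → x ≤ y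
    ^ⁿ-cancel-≤ k 1≤k 0≤y le = ≮⇒≥ λ y<x → <⇒≱ (^ⁿ-monoˡ-< k 1≤k 0≤y y<x) le

    -- A member and an upper bound together exclude the junk value of `sup`.
    sup-upper : ∀ {P : Pred ℝ 0ℓ} {x} → ∃ (UpperBound P) → x ∈ P → x ≤ sup P
    sup-upper {P} {x} bounded x∈P with em {∃ P × ∃ (UpperBound P)}
    ... | yes (nonempty , bounded′) = proj₁ (proj₂ (complete P nonempty bounded′)) x∈P
    ... | no  ¬sup                  = contradiction ((x , x∈P) , bounded) ¬sup

    sup-least : ∀ {P : Pred ℝ 0ℓ} {u} → ∃ P → u ∈ UpperBound P → sup P ≤ u
    sup-least {P} {u} nonempty u-upper with em {∃ P × ∃ (UpperBound P)}
    ... | yes (nonempty′ , bounded) = proj₂ (proj₂ (complete P nonempty′ bounded)) u-upper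
    ... | no  ¬sup                  = contradiction (nonempty , u , λ {x} → u-upper {x}) ¬sup

    inf-lower : ∀ {P : Pred ℝ 0ℓ} {x} → ∃ (LowerBound P) → x ∈ P → inf P ≤ x
    inf-lower bounded x∈P = sup-least bounded λ l-lower → l-lower x∈P

    inf-greatest : ∀ {P : Pred ℝ 0ℓ} {l} → ∃ P → l ∈ LowerBound P → l ≤ inf P
    inf-greatest {P} {l} (x , x∈P) l-lower = sup-upper {LowerBound P} {l} (x , λ l-lower → l-lower x∈P) λ {y} → l-lower {y}

    -- If x bounded all natural numbers, they would have a supremum s, and n = (n + 1) - 1 ≤ s - 1
    -- for all n would give s ≤ s - 1.
    archimedean : ∀ x → ∃[ n ] x ≤ fromℕ n
    archimedean x with em {∃[ n ] x ≤ fromℕ n}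
    ... | yes found = found
    ... | no  none  = ⊥-elim (<-irrefl s<s)
      where
      ImageOfℕ : Pred ℝ 0ℓ
      ImageOfℕ y = ∃[ n ] y ≡ fromℕ n
      bounded : ∃ (UpperBound ImageOfℕ)
      bounded = x , λ { (n , ≡.refl) → <⇒≤ (≰⇒> λ x≤n → none (n , x≤n)) }
      s = sup ImageOfℕ
      s≤s-1 : s ≤ s - 1#
      s≤s-1 = sup-least (0# , 0 , ≡.refl) λ { (n , ≡.refl) → begin
        fromℕ n               ≈⟨ x+z-z≈x (fromℕ n) 1# ⟨
        (fromℕ n + 1#) - 1#   ≈⟨ +-congʳ (+-comm (fromℕ n) 1#) ⟩
        fromℕ (suc n) - 1#    ≤⟨ +-monoˡ-≤ (- 1#) (sup-upper bounded (suc n , ≡.refl)) ⟩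
        s - 1#                ∎ }
        where open ≤-Reasoning
      s<s : s < s
      s<s = begin-strict
        s               ≤⟨ s≤s-1 ⟩
        s - 1#          <⟨ x<x+y (s - 1#) 0<1 ⟩
        (s - 1#) + 1#   ≈⟨ x-z+z≈x s 1# ⟩
        s               ∎
        where open ≤-Reasoning

    ceiling : ∀ {x} → 0# ≤ x → ∃[ n ] x ≤ fromℕ n × fromℕ n ≤ x + 1#
    ceiling {x} 0≤x = let N , x≤N = archimedean x in go N x≤N
      where
      go : ∀ N → x ≤ fromℕ N → ∃[ n ] x ≤ fromℕ n × fromℕ n ≤ x + 1#
      go zero    x≤0 = 0 , x≤0 , ≤-trans 0≤x (x≤x+y x 0≤1)
      go (suc N) x≤N with em {x ≤ fromℕ N}
      ... | yes x≤ = go N x≤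
      ... | no  x≰ = suc N , x≤N , ≤-trans (+-monoʳ-≤ 1# (<⇒≤ (≰⇒> x≰))) (≤-reflexive (+-comm 1# x))

    floor : ∀ {x} → 0# ≤ x → ∃[ n ] fromℕ n ≤ x × x < fromℕ (suc n)
    floor {x} 0≤x = let N , x≤N = archimedean x in go N (≤-<-trans x≤N (fromℕ<fromℕ-suc N))
      where
      go : ∀ N → x < fromℕ (suc N) → ∃[ n ] fromℕ n ≤ x × x < fromℕ (suc n)
      go zero    x< = 0 , 0≤x , x<
      go (suc N) x< with em {x < fromℕ (suc N)}
      ... | yes lt = go N lt
      ... | no  ≮  = suc N , ≮⇒≥ ≮ , x<

  module _ {Q : Pred ℕ 0ℓ} (Q? : Decidable Q) (M : ℕ) where

    private
      count-split : length (filter Q? (upTo (suc M))) ≡ length (filter Q? (upTo M)) ℕ.+ length (filter Q? [ M ])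
      count-split = ≡.trans (≡.cong length (≡.trans (≡.cong (filter Q?) (≡.sym (upTo-∷ʳ M))) (filter-++ Q? (upTo M) [ M ])))
                            (length-++ (filter Q? (upTo M)))

    count-suc-yes : Q M → length (filter Q? (upTo (suc M))) ≡ suc (length (filter Q? (upTo M)))
    count-suc-yes q = ≡.trans count-split (≡.trans (≡.cong (λ xs → length (filter Q? (upTo M)) ℕ.+ length xs) (filter-accept Q? q))
                                                   (ℕ.+-comm (length (filter Q? (upTo M))) 1))

    count-suc-no : ¬ Q M → length (filter Q? (upTo (suc M))) ≡ length (filter Q? (upTo M))
    count-suc-no ¬q = ≡.trans count-split (≡.trans (≡.cong (λ xs → length (filter Q? (upTo M)) ℕ.+ length xs) (filter-reject Q? ¬q))
                                                   (ℕ.+-identityʳ (length (filter Q? (upTo M)))))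

  -- Real powers compared with integer powers

  module RealPowers (em : ExcludedMiddle 0ℓ) (R : CompleteOrderedField) where

    open OrderedField em R

    PowerBelow : ℝ → ℝ → Pred ℝ 0ℓ
    PowerBelow x a y = 0# ≤ y × ∃[ m ] ∃[ k ] 1 ℕ.≤ k × fromℕ m ≤ fromℕ k * a × y ^ⁿ k ≤ x ^ⁿ m

    ^-≡-sup : ∀ {x} a → 1# ≤ x → x ^ a ≡ sup (PowerBelow x a)
    ^-≡-sup {x} a 1≤x with em {1# ≤ x}
    ... | yes _   = ≡.refl
    ... | no  1≰x = contradiction 1≤x 1≰x

    -- For a natural number A ≥ a the power x^A is an upper bound, as seen on k-th powers: m ≤ k a ≤
    -- A k. Thus the supremum that defines x^a is a genuine one.
    powerBelow-bounded : ∀ {x} a → 1# ≤ x → ∃ (UpperBound (PowerBelow x a))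
    powerBelow-bounded {x} a 1≤x = let A , a≤A = archimedean a in x ^ⁿ A , λ { {y} (0≤y , m , k , 1≤k , m≤ka , y^k≤x^m) →
      ^ⁿ-cancel-≤ k 1≤k (0≤^ⁿ A (≤-trans 0≤1 1≤x)) (begin
        y ^ⁿ k            ≤⟨ y^k≤x^m ⟩
        x ^ⁿ m            ≤⟨ ^ⁿ-monoʳ-≤ {m = m} {A ℕ.* k} 1≤x (fromℕ-cancel-≤ {m} {A ℕ.* k} (begin
                               fromℕ m              ≤⟨ m≤ka ⟩
                               fromℕ k * a          ≤⟨ *-monoʳ-≤ (0≤fromℕ k) a≤A ⟩
                               fromℕ k * fromℕ A    ≈⟨ *-comm (fromℕ k) (fromℕ A) ⟩
                               fromℕ A * fromℕ k    ≈⟨ fromℕ-* A k ⟨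
                               fromℕ (A ℕ.* k)      ∎)) ⟩
        x ^ⁿ (A ℕ.* k)    ≈⟨ ^ⁿ-* x A k ⟨
        (x ^ⁿ A) ^ⁿ k     ∎) }
      where open ≤-Reasoning

    ^-lower : ∀ {x a y} → 1# ≤ x → y ∈ PowerBelow x a → y ≤ x ^ a
    ^-lower {x} {a} 1≤x y∈ rewrite ^-≡-sup a 1≤x = sup-upper (powerBelow-bounded a 1≤x) y∈

    1∈PowerBelow : ∀ {x a} → 0# ≤ a → 1# ∈ PowerBelow x a
    1∈PowerBelow 0≤a = 0≤1 , 0 , 1 , ℕ.s≤s ℕ.z≤n , *-nonneg (0≤fromℕ 1) 0≤a , ≤-reflexive (*-identityˡ 1#)

    ^-upper : ∀ {x a u} → 1# ≤ x → 0# ≤ a → u ∈ UpperBound (PowerBelow x a) → x ^ a ≤ u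
    ^-upper {x} {a} 1≤x 0≤a upper rewrite ^-≡-sup a 1≤x = sup-least (1# , 1∈PowerBelow 0≤a) upper

    1≤^ : ∀ {x a} → 1# ≤ x → 0# ≤ a → 1# ≤ x ^ a
    1≤^ 1≤x 0≤a = ^-lower 1≤x (1∈PowerBelow 0≤a)

    ^-monoʳ-≤ : ∀ {x a b} → 1# ≤ x → 0# ≤ a → a ≤ b → x ^ a ≤ x ^ b
    ^-monoʳ-≤ 1≤x 0≤a a≤b = ^-upper 1≤x 0≤a λ { (0≤y , m , k , 1≤k , m≤ka , le) →
      ^-lower 1≤x (0≤y , m , k , 1≤k , ≤-trans m≤ka (*-monoʳ-≤ (0≤fromℕ k) a≤b) , le) }

    ^-monoˡ-≤ : ∀ {x z a} → 1# ≤ x → x ≤ z → 0# ≤ a → x ^ a ≤ z ^ a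
    ^-monoˡ-≤ 1≤x x≤z 0≤a = ^-upper 1≤x 0≤a λ { (0≤y , m , k , 1≤k , m≤ka , le) →
      ^-lower (≤-trans 1≤x x≤z) (0≤y , m , k , 1≤k , m≤ka , ≤-trans le (^ⁿ-monoˡ-≤ m (≤-trans 0≤1 1≤x) x≤z)) }

    ^-lower-ℕ : ∀ {n a} y m k → 1 ℕ.≤ n → 1 ℕ.≤ k → fromℕ m ≤ fromℕ k * a → y ℕ.^ k ℕ.≤ n ℕ.^ m → fromℕ y ≤ fromℕ n ^ a
    ^-lower-ℕ {n} y m k 1≤n 1≤k m≤ka le = ^-lower (1≤fromℕ 1≤n) (0≤fromℕ y , m , k , 1≤k , m≤ka ,
      ≤-respˡ (fromℕ-^ y k) (≤-respʳ (fromℕ-^ n m) (fromℕ-mono-≤ le)))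

    -- In short, n^a ≤ n^(p/q) ≤ w. For y at most n^(m/k) with m/k ≤ a, all roots disappear on
    -- raising to the power k q: y^(k q) ≤ n^(m q) ≤ n^(p k) ≤ w^(k q).
    ^-upper-ℕ : ∀ {n a} w p q → 1 ℕ.≤ n → 0# ≤ a → 1 ℕ.≤ q → a * fromℕ q ≤ fromℕ p → n ℕ.^ p ℕ.≤ w ℕ.^ q →
                fromℕ n ^ a ≤ fromℕ w
    ^-upper-ℕ {n} {a} w p q 1≤n 0≤a 1≤q aq≤p n^p≤w^q = ^-upper (1≤fromℕ 1≤n) 0≤a λ { {y} (0≤y , m , k , 1≤k , m≤ka , y^k≤n^m) →
      ^ⁿ-cancel-≤ (k ℕ.* q) (ℕ.*-mono-≤ 1≤k 1≤q) (0≤fromℕ w) (begin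
        y ^ⁿ (k ℕ.* q)               ≈⟨ ^ⁿ-* y k q ⟨
        (y ^ⁿ k) ^ⁿ q                ≤⟨ ^ⁿ-monoˡ-≤ q (0≤^ⁿ k 0≤y) y^k≤n^m ⟩
        (fromℕ n ^ⁿ m) ^ⁿ q          ≈⟨ ^ⁿ-* (fromℕ n) m q ⟩
        fromℕ n ^ⁿ (m ℕ.* q)         ≤⟨ ^ⁿ-monoʳ-≤ {m = m ℕ.* q} {p ℕ.* k} (1≤fromℕ 1≤n) (fromℕ-cancel-≤ {m ℕ.* q} {p ℕ.* k} (begin
                                          fromℕ (m ℕ.* q)               ≈⟨ fromℕ-* m q ⟩
                                          fromℕ m * fromℕ q             ≤⟨ *-monoˡ-≤ (0≤fromℕ q) m≤ka ⟩
                                          fromℕ k * a * fromℕ q         ≈⟨ *-assoc (fromℕ k) a (fromℕ q) ⟩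
                                          fromℕ k * (a * fromℕ q)       ≤⟨ *-monoʳ-≤ (0≤fromℕ k) aq≤p ⟩
                                          fromℕ k * fromℕ p             ≈⟨ trans (fromℕ-* p k) (*-comm (fromℕ p) (fromℕ k)) ⟨
                                          fromℕ (p ℕ.* k)               ∎)) ⟩
        fromℕ n ^ⁿ (p ℕ.* k)         ≈⟨ ^ⁿ-* (fromℕ n) p k ⟨
        (fromℕ n ^ⁿ p) ^ⁿ k          ≤⟨ ^ⁿ-monoˡ-≤ k (0≤^ⁿ p (0≤fromℕ n)) (≤-respˡ (fromℕ-^ n p) (≤-respʳ (fromℕ-^ w q) (fromℕ-mono-≤ n^p≤w^q))) ⟩
        (fromℕ w ^ⁿ q) ^ⁿ k          ≈⟨ ^ⁿ-* (fromℕ w) q k ⟩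
        fromℕ w ^ⁿ (q ℕ.* k)         ≡⟨ ≡.cong (fromℕ w ^ⁿ_) (ℕ.*-comm q k) ⟩
        fromℕ w ^ⁿ (k ℕ.* q)         ∎) }
      where open ≤-Reasoning

  -- Lower bounds for Lebesgue outer measure

  module IntervalCovers (em : ExcludedMiddle 0ℓ) (R : CompleteOrderedField) where

    open OrderedField em R

    _⊔_ _⊓_ : ℝ → ℝ → ℝ
    x ⊔ y with total x y
    ... | inj₁ _ = y
    ... | inj₂ _ = x
    x ⊓ y with total x y
    ... | inj₁ _ = x
    ... | inj₂ _ = y

    ⊔-lub : ∀ {x y z} → x ≤ z → y ≤ z → x ⊔ y ≤ z
    ⊔-lub {x} {y} x≤z y≤z with total x y
    ... | inj₁ _ = y≤z
    ... | inj₂ _ = x≤z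

    ⊓-glb : ∀ {x y z} → z ≤ x → z ≤ y → z ≤ x ⊓ y
    ⊓-glb {x} {y} z≤x z≤y with total x y
    ... | inj₁ _ = z≤x
    ... | inj₂ _ = z≤y

    x≤x⊔y : ∀ x y → x ≤ x ⊔ y
    x≤x⊔y x y with total x y
    ... | inj₁ x≤y = x≤y
    ... | inj₂ _   = ≤-refl

    y≤x⊔y : ∀ x y → y ≤ x ⊔ y
    y≤x⊔y x y with total x y
    ... | inj₁ _   = ≤-refl
    ... | inj₂ y≤x = y≤x

    x⊓y≤x : ∀ x y → x ⊓ y ≤ x
    x⊓y≤x x y with total x y
    ... | inj₁ _   = ≤-refl
    ... | inj₂ y≤x = y≤x

    x⊓y≤y : ∀ x y → x ⊓ y ≤ y
    x⊓y≤y x y with total x y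
    ... | inj₁ x≤y = x≤y
    ... | inj₂ _   = ≤-refl

    clamp : ℝ → ℝ → ℝ → ℝ
    clamp a b x = b ⊓ (a ⊔ x)

    clamp-mono : ∀ a b {x y} → x ≤ y → clamp a b x ≤ clamp a b y
    clamp-mono a b {x} {y} x≤y = ⊓-glb (x⊓y≤x b (a ⊔ x))
      (≤-trans (x⊓y≤y b (a ⊔ x)) (⊔-lub (x≤x⊔y a y) (≤-trans x≤y (y≤x⊔y a y))))

    clamp-≥ : ∀ {a b} x → a ≤ b → a ≤ clamp a b x
    clamp-≥ {a} x a≤b = ⊓-glb a≤b (x≤x⊔y a x)

    clamp-≤ : ∀ a b x → clamp a b x ≤ b
    clamp-≤ a b x = x⊓y≤x b (a ⊔ x)

    clamp-inside : ∀ {a b x} → a ≤ x → x ≤ b → clamp a b x ≈ x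
    clamp-inside {a} {b} {x} a≤x x≤b = antisym (≤-trans (x⊓y≤y b (a ⊔ x)) (⊔-lub a≤x ≤-refl)) (⊓-glb x≤b (y≤x⊔y a x))

    Sum : ℕ → (ℕ → ℝ) → ℝ
    Sum N f = sum {N} (λ i → f (toℕ i))

    Sum-mono : ∀ N {f h : ℕ → ℝ} → (∀ i → f i ≤ h i) → Sum N f ≤ Sum N h
    Sum-mono zero    f≤h = ≤-refl
    Sum-mono (suc N) f≤h = +-mono-≤ (f≤h 0) (Sum-mono N (λ i → f≤h (suc i)))

    swapʳ : ∀ x y z → (x + y) + z ≈ (x + z) + y
    swapʳ x y z = trans (+-assoc x y z) (trans (+-congˡ (+-comm y z)) (sym (+-assoc x z y)))

    Sum-+ : ∀ N (f h : ℕ → ℝ) → Sum N (λ i → f i + h i) ≈ Sum N f + Sum N h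
    Sum-+ zero    f h = sym (+-identityˡ 0#)
    Sum-+ (suc N) f h = begin-equality
      (f 0 + h 0) + Sum N (λ i → f (suc i) + h (suc i))   ≈⟨ +-congˡ (Sum-+ N (λ i → f (suc i)) (λ i → h (suc i))) ⟩
      (f 0 + h 0) + (F + H)                               ≈⟨ +-assoc (f 0 + h 0) F H ⟨
      ((f 0 + h 0) + F) + H                               ≈⟨ +-congʳ (swapʳ (f 0) (h 0) F) ⟩
      ((f 0 + F) + h 0) + H                               ≈⟨ +-assoc (f 0 + F) (h 0) H ⟩
      (f 0 + F) + (h 0 + H)                               ∎
      where
      open ≤-Reasoning
      F = Sum N (λ i → f (suc i))
      H = Sum N (λ i → h (suc i))

    -- The increase y - x comes from the i-th summand alone, and no other summand decreases; it is
    -- written across the inequality to avoid subtraction.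
    Sum-gain : ∀ {N i} {f h : ℕ → ℝ} {x y} → (∀ j → f j ≤ h j) → i ℕ.< N → f i + y ≤ h i + x → Sum N f + y ≤ Sum N h + x
    Sum-gain {suc N} {zero} {f} {h} {x} {y} f≤h _ gain = begin
      (f 0 + F) + y    ≈⟨ swapʳ (f 0) F y ⟩
      (f 0 + y) + F    ≤⟨ +-mono-≤ gain (Sum-mono N (λ i → f≤h (suc i))) ⟩
      (h 0 + x) + H    ≈⟨ swapʳ (h 0) x H ⟩
      (h 0 + H) + x    ∎
      where
      open ≤-Reasoning
      F = Sum N (λ i → f (suc i))
      H = Sum N (λ i → h (suc i))
    Sum-gain {suc N} {suc i} {f} {h} {x} {y} f≤h (ℕ.s≤s i<N) gain = begin
      (f 0 + F) + y    ≈⟨ +-assoc (f 0) F y ⟩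
      f 0 + (F + y)    ≤⟨ +-mono-≤ (f≤h 0) (Sum-gain (λ j → f≤h (suc j)) i<N gain) ⟩
      h 0 + (H + x)    ≈⟨ +-assoc (h 0) H x ⟨
      (h 0 + H) + x    ∎
      where
      open ≤-Reasoning
      F = Sum N (λ i → f (suc i))
      H = Sum N (λ i → h (suc i))

    module _ (a b : ℕ → ℝ) (a≤b : ∀ i → a i ≤ b i) where

      Covered : ℝ → Set
      Covered x = ∃[ i ] a i < x × x < b i

      -- Up to the constant Σ aᵢ, the total length of the first N intervals to the left of x.
      lengthBefore : ℕ → ℝ → ℝ
      lengthBefore N x = Sum N (λ i → clamp (a i) (b i) x)

      lengthBefore-mono : ∀ N {x y} → x ≤ y → lengthBefore N x ≤ lengthBefore N y
      lengthBefore-mono N x≤y = Sum-mono N (λ i → clamp-mono (a i) (b i) x≤y)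

      -- Heine–Borel by taking the supremum of the points x for which [u, x] is dealt with.
      covered-length : ∀ {u v} → u ≤ v → (∀ {x} → u ≤ x → x ≤ v → Covered x) →
        ∃[ N ] ∀ N′ → N ℕ.≤ N′ → lengthBefore N′ u + v ≤ lengthBefore N′ v + u
      covered-length {u} {v} u≤v covered = at-v
        where
        Reached : Pred ℝ 0ℓ
        Reached x = u ≤ x × x ≤ v × ∃[ N ] ∀ N′ → N ℕ.≤ N′ → lengthBefore N′ u + x ≤ lengthBefore N′ x + u

        bounded : ∃ (UpperBound Reached)
        bounded = v , λ (_ , x≤v , _) → x≤v

        u-reached : u ∈ Reached
        u-reached = ≤-refl , u≤v , 0 , λ _ _ → ≤-refl

        z : ℝ
        z = sup Reached

        u≤z : u ≤ z
        u≤z = sup-upper bounded u-reached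

        z≤v : z ≤ v
        z≤v = sup-least (u , u-reached) λ (_ , x≤v , _) → x≤v

        at-v : ∃[ N ] ∀ N′ → N ℕ.≤ N′ → lengthBefore N′ u + v ≤ lengthBefore N′ v + u
        at-v with covered u≤z z≤v
        -- The interval that covers the supremum z extends to its left, so it contains a reached
        -- point x.
        ... | i , aᵢ<z , z<bᵢ with em {∃[ x ] x ∈ Reached × a i < x}
        ... | no none = contradiction (sup-least (u , u-reached) λ {x} x∈ → ≮⇒≥ λ aᵢ<x → none (x , x∈ , aᵢ<x)) (<⇒≱ aᵢ<z)
        ... | yes (x , x∈@(u≤x , _ , N , reach) , aᵢ<x) = conclude (total v (b i))
          where
          y : ℝ
          y = v ⊓ b i
          x≤z : x ≤ z
          x≤z = sup-upper bounded x∈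
          x≤y : x ≤ y
          x≤y = ⊓-glb (≤-trans x≤z z≤v) (≤-trans x≤z (<⇒≤ z<bᵢ))
          advance : ∀ N′ → N ℕ.⊔ suc i ℕ.≤ N′ → lengthBefore N′ u + y ≤ lengthBefore N′ y + u
          advance N′ le = +-cancelʳ-≤ x (begin
            (lengthBefore N′ u + y) + x   ≈⟨ swapʳ (lengthBefore N′ u) y x ⟩
            (lengthBefore N′ u + x) + y   ≤⟨ +-monoˡ-≤ y (reach N′ (ℕ.≤-trans (ℕ.m≤m⊔n N (suc i)) le)) ⟩
            (lengthBefore N′ x + u) + y   ≈⟨ swapʳ (lengthBefore N′ x) u y ⟩
            (lengthBefore N′ x + y) + u   ≤⟨ +-monoˡ-≤ u (Sum-gain (λ j → clamp-mono (a j) (b j) x≤y) (ℕ.≤-trans (ℕ.m≤n⊔m N (suc i)) le) gain) ⟩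
            (lengthBefore N′ y + x) + u   ≈⟨ swapʳ (lengthBefore N′ y) x u ⟩
            (lengthBefore N′ y + u) + x   ∎)
            where
            open ≤-Reasoning
            gain : clamp (a i) (b i) x + y ≤ clamp (a i) (b i) y + x
            gain = begin
              clamp (a i) (b i) x + y   ≈⟨ +-congʳ (clamp-inside (<⇒≤ aᵢ<x) (≤-trans x≤y (x⊓y≤y v (b i)))) ⟩
              x + y                     ≈⟨ +-comm x y ⟩
              y + x                     ≈⟨ +-congʳ (clamp-inside (≤-trans (<⇒≤ aᵢ<x) x≤y) (x⊓y≤y v (b i))) ⟨
              clamp (a i) (b i) y + x   ∎
          y-reached : y ∈ Reached
          y-reached = ≤-trans u≤x x≤y , x⊓y≤x v (b i) , N ℕ.⊔ suc i , advance
          conclude : v ≤ b i ⊎ b i ≤ v → ∃[ N ] ∀ N′ → N ℕ.≤ N′ → lengthBefore N′ u + v ≤ lengthBefore N′ v + u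
          -- If bᵢ ≤ v, then y = bᵢ is a reached point beyond z.
          conclude (inj₂ bᵢ≤v) = contradiction (≤-trans (⊓-glb bᵢ≤v ≤-refl) (sup-upper bounded y-reached)) (<⇒≱ z<bᵢ)
          conclude (inj₁ v≤bᵢ) = N ℕ.⊔ suc i , λ N′ le → begin
            lengthBefore N′ u + v   ≤⟨ +-monoʳ-≤ (lengthBefore N′ u) (⊓-glb ≤-refl v≤bᵢ) ⟩
            lengthBefore N′ u + y   ≤⟨ advance N′ le ⟩
            lengthBefore N′ y + u   ≤⟨ +-monoˡ-≤ u (lengthBefore-mono N′ (x⊓y≤x v (b i))) ⟩
            lengthBefore N′ v + u   ∎
            where open ≤-Reasoning

      -- Between consecutive intervals `lengthBefore` does not decrease, so the gains add up. Each
      -- gain holds for all N′ beyond some bound, which allows one N for all the intervals.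
      covered-length-many : (o : ℕ → ℝ) (h : ℝ) → 0# ≤ h → (∀ k → o k + h ≤ o (suc k)) →
        {Q : Pred ℕ 0ℓ} (Q? : Decidable Q) → ∀ M → (∀ {k x} → k ℕ.< M → Q k → o k ≤ x → x ≤ o k + h → Covered x) →
        ∃[ N ] ∀ N′ → N ℕ.≤ N′ → lengthBefore N′ (o 0) + fromℕ (length (filter Q? (upTo M))) * h ≤ lengthBefore N′ (o M)
      covered-length-many o h 0≤h step Q? zero covered = 0 , λ N′ _ →
        ≤-reflexive (trans (+-congˡ (zeroˡ h)) (+-identityʳ _))
      covered-length-many o h 0≤h step Q? (suc M) covered
        with Q? M | covered-length-many o h 0≤h step Q? M (λ k<M → covered (ℕ.m<n⇒m<1+n k<M))
      ... | no ¬q | N , ih = N , λ N′ le → begin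
          lengthBefore N′ (o 0) + fromℕ (length (filter Q? (upTo (suc M)))) * h
            ≡⟨ ≡.cong (λ j → lengthBefore N′ (o 0) + fromℕ j * h) (count-suc-no Q? M ¬q) ⟩
          lengthBefore N′ (o 0) + fromℕ m * h            ≤⟨ ih N′ le ⟩
          lengthBefore N′ (o M)                          ≤⟨ lengthBefore-mono N′ (≤-trans (x≤x+y (o M) 0≤h) (step M)) ⟩
          lengthBefore N′ (o (suc M))                    ∎
        where
        open ≤-Reasoning
        m = length (filter Q? (upTo M))
      ... | yes q | N₁ , ih with covered-length (x≤x+y (o M) 0≤h) (covered ℕ.≤-refl q)
      ... | N₂ , interval = N₁ ℕ.⊔ N₂ , λ N′ le → begin
          lengthBefore N′ (o 0) + fromℕ (length (filter Q? (upTo (suc M)))) * h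
            ≡⟨ ≡.cong (λ j → lengthBefore N′ (o 0) + fromℕ j * h) (count-suc-yes Q? M q) ⟩
          lengthBefore N′ (o 0) + (1# + fromℕ m) * h       ≈⟨ +-congˡ (trans (*-congʳ (+-comm 1# (fromℕ m))) (trans (distribʳ h (fromℕ m) 1#) (+-congˡ (*-identityˡ h)))) ⟩
          lengthBefore N′ (o 0) + (fromℕ m * h + h)        ≈⟨ +-assoc _ (fromℕ m * h) h ⟨
          (lengthBefore N′ (o 0) + fromℕ m * h) + h        ≤⟨ +-monoˡ-≤ h (ih N′ (ℕ.≤-trans (ℕ.m≤m⊔n N₁ N₂) le)) ⟩
          lengthBefore N′ (o M) + h                        ≤⟨ +-cancelʳ-≤ (o M) (≤-respˡ (assoc-swap (lengthBefore N′ (o M)))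
                                                                (interval N′ (ℕ.≤-trans (ℕ.m≤n⊔m N₁ N₂) le))) ⟩
          lengthBefore N′ (o M + h)                        ≤⟨ lengthBefore-mono N′ (step M) ⟩
          lengthBefore N′ (o (suc M))                      ∎
        where
        open ≤-Reasoning
        m = length (filter Q? (upTo M))
        assoc-swap : ∀ g → g + (o M + h) ≈ (g + h) + o M
        assoc-swap g = trans (+-congˡ (+-comm (o M) h)) (sym (+-assoc g h (o M)))

    Cover : Pred ℝ 0ℓ → Pred ℝ 0ℓ
    Cover S ℓ = Σ[ a ∈ (ℕ → ℝ) ] Σ[ b ∈ (ℕ → ℝ) ] (∀ i → a i ≤ b i) ×
      (∀ {x} → x ∈ S → ∃[ i ] a i < x × x < b i) × (∀ N → Sum N (λ i → b i - a i) ≤ ℓ)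

    -- The interval (-1, n + 1), followed by empty ones. This crude cover makes the infimum in
    -- `measure` range over a nonempty set, and it bounds the measure by n + 2.
    interval-cover : ∀ {S n} → (∀ {x} → x ∈ S → 0# ≤ x × x ≤ fromℕ n) → Cover S (fromℕ (suc n) + 1#)
    interval-cover {S} {n} S⊆ = a , b , a≤b , (λ x∈ → 0 , -1<x x∈ , ≤-<-trans (proj₂ (S⊆ x∈)) (fromℕ<fromℕ-suc n)) , total-length
      where
      a b : ℕ → ℝ
      a zero    = - 1#
      a (suc i) = 0#
      b zero    = fromℕ (suc n)
      b (suc i) = 0#
      -1<0 : - 1# < 0#
      -1<0 = <-≤-trans (x<x+y (- 1#) 0<1) (≤-reflexive (-‿inverseˡ 1#))
      -1<x : ∀ {x} → x ∈ S → - 1# < x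
      -1<x x∈ = <-≤-trans -1<0 (proj₁ (S⊆ x∈))
      a≤b : ∀ i → a i ≤ b i
      a≤b zero    = ≤-trans (<⇒≤ -1<0) (0≤fromℕ (suc n))
      a≤b (suc i) = ≤-refl
      zero-tail : ∀ N → Sum N (λ i → 0# - 0#) ≈ 0#
      zero-tail zero    = refl
      zero-tail (suc N) = trans (+-cong (-‿inverseʳ 0#) (zero-tail N)) (+-identityˡ 0#)
      total-length : ∀ N → Sum N (λ i → b i - a i) ≤ fromℕ (suc n) + 1#
      total-length zero    = ≤-trans (0≤fromℕ (suc n)) (x≤x+y _ 0≤1)
      total-length (suc N) = ≤-reflexive (trans (+-congˡ (zero-tail N)) (trans (+-identityʳ _) (+-congˡ (-‿involutive 1#))))

    measure-≤ : ∀ {S ℓ} → Cover S ℓ → measure S ≤ ℓ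
    measure-≤ cover = inf-lower (0# , λ (_ , _ , _ , _ , length≤) → length≤ 0) cover

    -- In any cover, clamping keeps the i-th summand of `lengthBefore` between a i and b i, so its
    -- growth from `o 0` to `o M` is at most the total length of the first N intervals. The given
    -- cover keeps the infimum from its junk value.
    measure-≥ : ∀ {S ℓ} → Cover S ℓ → (o : ℕ → ℝ) (h : ℝ) → 0# ≤ h → (∀ k → o k + h ≤ o (suc k)) →
      {Q : Pred ℕ 0ℓ} (Q? : Decidable Q) → ∀ M → (∀ {k x} → k ℕ.< M → Q k → o k ≤ x → x ≤ o k + h → x ∈ S) →
      fromℕ (length (filter Q? (upTo M))) * h ≤ measure S
    measure-≥ {S} cover o h 0≤h step Q? M blocks⊆S = inf-greatest (_ , cover) lower
      where
      mh : ℝ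
      mh = fromℕ (length (filter Q? (upTo M))) * h
      lower : ∀ {ℓ} → Cover S ℓ → mh ≤ ℓ
      lower {ℓ} (a , b , a≤b , covers , length≤) =
        let N , many = covered-length-many a b a≤b o h 0≤h step Q? M (λ k<M q o≤x x≤ → covers (blocks⊆S k<M q o≤x x≤))
        in ≤-trans (+-cancelʳ-≤ (Sum N a) (begin
          mh + Sum N a                                      ≈⟨ +-comm mh (Sum N a) ⟩
          Sum N a + mh                                      ≤⟨ +-monoˡ-≤ mh (Sum-mono N (λ i → clamp-≥ (o 0) (a≤b i))) ⟩
          lengthBefore a b a≤b N (o 0) + mh                 ≤⟨ many N ℕ.≤-refl ⟩
          lengthBefore a b a≤b N (o M)                      ≤⟨ Sum-mono N (λ i → ≤-trans (clamp-≤ (a i) (b i) (o M)) (≤-reflexive (sym (x-z+z≈x (b i) (a i))))) ⟩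
          Sum N (λ i → (b i - a i) + a i)                   ≈⟨ Sum-+ N (λ i → b i - a i) a ⟩
          Sum N (λ i → b i - a i) + Sum N a                 ∎)) (length≤ N)
        where open ≤-Reasoning

  -- From the exceptional exponent to the bound for g

  module MainTheorem (em : ExcludedMiddle 0ℓ) (R : CompleteOrderedField) where

    open OrderedField em R
    open RealPowers em R
    open IntervalCovers em R using (measure-≤; measure-≥; interval-cover)

    half : ∀ {d} → 0# < d → ∃[ ε ] 0# < ε × ε + ε ≈ d
    half {d} 0<d = d * two ⁻¹ , ε-positive , double
      where
      two = fromℕ 2
      0<two : 0# < two
      0<two = fromℕ-mono-< {0} {2} (ℕ.s≤s ℕ.z≤n)
      ε-positive : 0# < d * two ⁻¹
      ε-positive = ≤-<-trans (≤-reflexive (sym (zeroˡ (two ⁻¹)))) (*-monoˡ-< (0<⇒0<⁻¹ 0<two) 0<d)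
      double : d * two ⁻¹ + d * two ⁻¹ ≈ d
      double = begin-equality
        d * two ⁻¹ + d * two ⁻¹        ≈⟨ distribˡ d (two ⁻¹) (two ⁻¹) ⟨
        d * (two ⁻¹ + two ⁻¹)          ≈⟨ *-congˡ (+-cong (sym (*-identityˡ _)) (sym (trans (*-congʳ fromℕ-1) (*-identityˡ _)))) ⟩
        d * (1# * two ⁻¹ + fromℕ 1 * two ⁻¹)  ≈⟨ *-congˡ (distribʳ (two ⁻¹) 1# (fromℕ 1)) ⟨
        d * (two * two ⁻¹)             ≈⟨ *-congˡ (*-inverse 0<two) ⟩
        d * 1#                         ≈⟨ *-identityʳ d ⟩
        d                              ∎
        where open ≤-Reasoning

    0<y-x : ∀ {x y} → x < y → 0# < y - x
    0<y-x {x} {y} x<y = ≤-<-trans (≤-reflexive (sym (-‿inverseʳ x))) (+-monoˡ-< (- x) x<y)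

    module _ (α : ℝ) (0<α : 0# < α) where

      exceptional-cover : ∀ n → IntervalCovers.Cover em R (Exceptional α n) (fromℕ (suc n) + 1#)
      exceptional-cover n = interval-cover {Exceptional α n} {n} λ (0≤x , x≤n , _) → 0≤x , x≤n

      -- Provides a member, so that the infimum of the exceptional exponents exists; the measure is
      -- at most n + 2 < n².
      2-isExceptionalExponent : fromℕ 2 ∈ IsExceptionalExponent α
      2-isExceptionalExponent = 0≤fromℕ 2 , λ ε 0<ε → 3 , λ n 3≤n → begin-strict
        measure (Exceptional α n)      ≤⟨ measure-≤ (exceptional-cover n) ⟩
        fromℕ (suc n) + 1#             ≈⟨ +-comm (fromℕ (suc n)) 1# ⟩
        fromℕ (2 ℕ.+ n)                <⟨ fromℕ-mono-< (n+2<n² n 3≤n) ⟩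
        fromℕ (n ℕ.^ 2)                ≤⟨ ^-lower-ℕ (n ℕ.^ 2) 2 1 (ℕ.≤-trans (ℕ.s≤s ℕ.z≤n) 3≤n) (ℕ.s≤s ℕ.z≤n)
                                            (≤-trans (x≤x+y (fromℕ 2) (<⇒≤ 0<ε)) (≤-reflexive (sym (trans (*-congʳ fromℕ-1) (*-identityˡ _)))))
                                            (ℕ.≤-reflexive (ℕ.*-identityʳ (n ℕ.^ 2))) ⟩
        fromℕ n ^ (fromℕ 2 + ε)        ∎
        where
        open ≤-Reasoning
        n+2<n² : ∀ n → 3 ℕ.≤ n → 2 ℕ.+ n ℕ.< n ℕ.^ 2
        n+2<n² n 3≤n = N.begin-strict
          2 ℕ.+ n                  N.<⟨ ℕ.+-monoˡ-< n (ℕ.≤-trans 3≤n (ℕ.m≤m+n n 0)) ⟩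
          n ℕ.+ 0 ℕ.+ n            N.≤⟨ ℕ.+-monoˡ-≤ n (ℕ.+-monoʳ-≤ n (ℕ.z≤n {n})) ⟩
          n ℕ.+ n ℕ.+ n            N.≡⟨ ≡.trans (ℕ.+-assoc n n n) (≡.cong (λ z → n ℕ.+ (n ℕ.+ z)) (≡.sym (ℕ.+-identityʳ n))) ⟩
          3 ℕ.* n                  N.≤⟨ ℕ.*-monoˡ-≤ n 3≤n ⟩
          n ℕ.* n                  N.≡⟨ ≡.cong (n ℕ.*_) (≡.sym (ℕ.*-identityʳ n)) ⟩
          n ℕ.^ 2                  N.∎
          where module N = ℕ.≤-Reasoning

      -- The condition is imposed for every ε > 0, so it passes to the infimum z: some admissible μ
      -- lies below z + ε/2, and n^(μ + ε/2) ≤ n^(z + ε). Hence `least` does not take its junk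
      -- value.
      least-exceptionalExponent : ∃ (IsLeast (IsExceptionalExponent α))
      least-exceptionalExponent = z , (0≤z , exceptional) , inf-lower 0-lower
        where
        z : ℝ
        z = inf (IsExceptionalExponent α)
        0-lower : ∃ (LowerBound (IsExceptionalExponent α))
        0-lower = 0# , proj₁
        0≤z : 0# ≤ z
        0≤z = inf-greatest (fromℕ 2 , 2-isExceptionalExponent) proj₁
        exceptional : ∀ ε → 0# < ε → ∃[ N ] ∀ n → N ℕ.≤ n → measure (Exceptional α n) < fromℕ n ^ (z + ε)
        exceptional ε 0<ε with half 0<ε
        ... | δ , 0<δ , δ+δ≈ε with em {∃[ μ ] μ ∈ IsExceptionalExponent α × μ < z + δ}
        ... | no none = contradiction (inf-greatest (fromℕ 2 , 2-isExceptionalExponent) λ {μ} μ∈ → ≮⇒≥ λ μ< → none (μ , μ∈ , μ<))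
                                      (<⇒≱ (x<x+y z 0<δ))
        ... | yes (μ , (0≤μ , μ-exceptional) , μ<z+δ) =
          let N , small = μ-exceptional δ 0<δ in N ℕ.⊔ 1 , λ n N≤n → <-≤-trans (small n (ℕ.≤-trans (ℕ.m≤m⊔n N 1) N≤n))
            (^-monoʳ-≤ (1≤fromℕ (ℕ.≤-trans (ℕ.m≤n⊔m N 1) N≤n)) (≤-trans 0≤μ (x≤x+y μ (<⇒≤ 0<δ)))
              (≤-trans (+-monoˡ-≤ δ (<⇒≤ μ<z+δ)) (≤-reflexive (trans (+-assoc z δ δ) (+-congˡ δ+δ≈ε)))))

      exceptionalExponent-∈ : exceptionalExponent α ∈ IsExceptionalExponent α
      exceptionalExponent-∈ with em {∃ (IsLeast (IsExceptionalExponent α))}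
      ... | yes (_ , x∈ , _) = x∈
      ... | no  ¬least       = contradiction least-exceptionalExponent ¬least

      -- The exponent ν is taken halfway between λ(α) and β.
      measure-exceptional : ∀ {β} → exceptionalExponent α < β →
        ∃[ ν ] 0# ≤ ν × ν < β × ∃[ N ] ∀ n → N ℕ.≤ n → measure (Exceptional α n) ≤ fromℕ n ^ ν
      measure-exceptional {β} λ<β =
        let μ = exceptionalExponent α
            0≤μ , small = exceptionalExponent-∈
            ε , 0<ε , ε+ε≈ = half (0<y-x λ<β)
            N , small-ε = small ε 0<ε
        in μ + ε , ≤-trans 0≤μ (x≤x+y μ (<⇒≤ 0<ε)) ,
           <-≤-trans (x<x+y (μ + ε) 0<ε) (≤-reflexive (trans (+-assoc μ ε ε) (trans (+-congˡ ε+ε≈) (trans (+-comm μ (β - μ)) (x-z+z≈x β μ))))) ,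
           N , λ n N≤n → <⇒≤ (small-ε n N≤n)

      hitting-≥0 : ∀ {n} → ∃ (LowerBound (IsSidonHitting n))
      hitting-≥0 = 0# , proj₁

      -- No interval of length l ≥ n fits into [1, n], so the empty set qualifies.
      g≤trivial : ∀ {n l} → n ℕ.≤ l → g n ≤ fromℕ l
      g≤trivial {n} {l} n≤l = inf-lower hitting-≥0 (0≤fromℕ l , [] , (λ ()) , (λ ()) , λ x 1≤x x+l≤n →
        contradiction (begin
          1# + fromℕ l   ≤⟨ +-monoˡ-≤ (fromℕ l) 1≤x ⟩
          x + fromℕ l    ≤⟨ x+l≤n ⟩
          fromℕ n        ≤⟨ fromℕ-mono-≤ n≤l ⟩
          fromℕ l        ∎) (<⇒≱ (fromℕ<fromℕ-suc l)))
        where open ≤-Reasoning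

      -- If j ℓ ≤ x < (j + 1) ℓ, then block j, which is ((j + 1) ℓ, (j + 2) ℓ], lies inside
      -- [x, x + 3 ℓ]; and x + 3 ℓ ≤ n < (M + 2) ℓ makes j smaller than M.
      g≤blocks : ∀ {n ℓ M} → 1 ℕ.≤ ℓ → n ℕ.< (2 ℕ.+ M) ℕ.* ℓ →
        (∃[ A ] (∀ {a} → a ∈ˡ A → 1 ℕ.≤ a × a ℕ.≤ n) × Sidon A × (∀ {k} → k ℕ.< M → ∃[ a ] a ∈ˡ A × Blocks.InBlock ℓ k a)) →
        g n ≤ fromℕ (3 ℕ.* ℓ)
      g≤blocks {n} {ℓ} {M} 1≤ℓ n< (A , range , sidon , hit) = inf-lower hitting-≥0 (0≤fromℕ (3 ℕ.* ℓ) , A , range ,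
        (λ {a} {b} {c} {d} → sidon {a} {b} {c} {d}) , hits)
        where
        instance _ = ℕ.>-nonZero 1≤ℓ
        hits : ∀ x → 1# ≤ x → x + fromℕ (3 ℕ.* ℓ) ≤ fromℕ n → ∃[ a ] a ∈ˡ A × x ≤ fromℕ a × fromℕ a ≤ x + fromℕ (3 ℕ.* ℓ)
        hits x 1≤x x+3ℓ≤n =
          let f , f≤x , x<f+1 = floor (≤-trans 0≤1 1≤x)
              j = f ℕ./ ℓ
              jℓ≤f = ℕ.≤-trans (ℕ.m≤n+m (j ℕ.* ℓ) (f ℕ.% ℓ)) (ℕ.≤-reflexive (≡.sym (m≡m%n+[m/n]*n f ℓ)))
              f<[j+1]ℓ = ℕ.≤-<-trans (ℕ.≤-reflexive (m≡m%n+[m/n]*n f ℓ)) (ℕ.+-monoˡ-< (j ℕ.* ℓ) (m%n<n f ℓ))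
              f+3ℓ≤n = fromℕ-cancel-≤ {f ℕ.+ 3 ℕ.* ℓ} {n} (≤-trans (≤-reflexive (fromℕ-+ f (3 ℕ.* ℓ)))
                         (≤-trans (+-monoˡ-≤ (fromℕ (3 ℕ.* ℓ)) f≤x) x+3ℓ≤n))
              [j+3]ℓ≤f+3ℓ = ℕ.≤-trans (ℕ.≤-reflexive (ℕ.*-distribʳ-+ ℓ j 3)) (ℕ.+-monoˡ-≤ (3 ℕ.* ℓ) jℓ≤f)
              j+3<2+M = ℕ.*-cancelʳ-< ℓ (j ℕ.+ 3) (2 ℕ.+ M) (ℕ.≤-<-trans (ℕ.≤-trans [j+3]ℓ≤f+3ℓ f+3ℓ≤n) n<)
              j<M = ℕ.+-cancelˡ-< 2 j M (ℕ.≤-<-trans (ℕ.≤-trans (ℕ.≤-reflexive (ℕ.+-comm 2 j)) (ℕ.+-monoʳ-≤ j (ℕ.s≤s (ℕ.s≤s (ℕ.z≤n {1}))))) j+3<2+M)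
              a , a∈A , origin<a , a≤ = hit j<M
              a≤f+3ℓ = ℕ.≤-trans a≤ (ℕ.≤-trans (ℕ.≤-reflexive (≡.trans (ℕ.+-comm (suc j ℕ.* ℓ) ℓ) (≡.cong (ℕ._* ℓ) (ℕ.+-comm 2 j))))
                         (ℕ.≤-trans (ℕ.*-monoˡ-≤ ℓ (ℕ.+-monoʳ-≤ j (ℕ.s≤s (ℕ.s≤s (ℕ.z≤n {1}))))) [j+3]ℓ≤f+3ℓ))
          in a , a∈A ,
             ≤-trans (<⇒≤ x<f+1) (fromℕ-mono-≤ (ℕ.≤-trans f<[j+1]ℓ (ℕ.<⇒≤ origin<a))) ,
             ≤-trans (fromℕ-mono-≤ a≤f+3ℓ) (≤-trans (≤-reflexive (fromℕ-+ f (3 ℕ.* ℓ))) (+-monoˡ-≤ (fromℕ (3 ℕ.* ℓ)) f≤x))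

      module Sparse {n γ kk M : ℕ} (1≤γ : 1 ℕ.≤ γ) (n^α≤γ : fromℕ n ^ α ≤ fromℕ γ)
        (blocks≤n : suc M ℕ.* (64 ℕ.* γ) ℕ.≤ n) (kk≤α⁻¹ : fromℕ kk ≤ α ⁻¹) where

        open Blocks (64 ℕ.* γ)

        -- From a point x in the first half of a block, the interval of length x^α ≤ n^α ≤ γ ends
        -- within 33 γ of the origin. So its primes are primes of the block, fewer than 5^kk ≤
        -- 5^(1/α).
        sparse⇒exceptional : ∀ {k x} → k ℕ.< M → Sparse kk k →
          fromℕ (origin k) ≤ x → x ≤ fromℕ (origin k) + fromℕ (32 ℕ.* γ) → x ∈ Exceptional α n
        sparse⇒exceptional {k} {x} k<M sparse o≤x x≤ = ≤-trans 0≤1 1≤x , x≤n ,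
          filter (λ p → em) (blockPrimes k) , Unique.filter⁺ (λ p → em) (blockPrimes-unique k) ,
          ((λ p∈ → proj₂ (∈-filter⁻ (λ p → em) {xs = blockPrimes k} p∈)) ,
           (λ { {p} pr@(pp , x<p , p≤) → ∈-filter⁺ (λ p → em) (∈-blockPrimes⁺ {k} pp (inBlock x<p p≤)) pr })) ,
          few
          where
          open ≤-Reasoning
          ℓ = 64 ℕ.* γ
          1≤x : 1# ≤ x
          1≤x = ≤-trans (1≤fromℕ (ℕ.*-mono-≤ {1} {suc k} (ℕ.s≤s ℕ.z≤n) (ℕ.*-mono-≤ {1} {64} (ℕ.s≤s ℕ.z≤n) 1≤γ))) o≤x
          32γ≤ℓ : 32 ℕ.* γ ℕ.≤ ℓ
          32γ≤ℓ = ℕ.*-monoˡ-≤ γ (ℕ.≤ᵇ⇒≤ 32 64 _)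
          x≤n : x ≤ fromℕ n
          x≤n = begin
            x                                          ≤⟨ x≤ ⟩
            fromℕ (origin k) + fromℕ (32 ℕ.* γ)        ≈⟨ fromℕ-+ (origin k) (32 ℕ.* γ) ⟨
            fromℕ (origin k ℕ.+ 32 ℕ.* γ)              ≤⟨ fromℕ-mono-≤ (ℕ.≤-trans (inBlock-≤ {M} {k} k<M
                                                            (ℕ.m<m+n (origin k) (ℕ.*-mono-≤ {1} {32} (ℕ.s≤s ℕ.z≤n) 1≤γ) , ℕ.+-monoʳ-≤ (origin k) 32γ≤ℓ)) blocks≤n) ⟩
            fromℕ n                                    ∎
          inBlock : ∀ {p} → x < fromℕ p → fromℕ p ≤ x + x ^ α → InBlock k p
          inBlock {p} x<p p≤ = fromℕ-cancel-< (≤-<-trans o≤x x<p) , fromℕ-cancel-≤ (begin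
            fromℕ p                                          ≤⟨ p≤ ⟩
            x + x ^ α                                        ≤⟨ +-mono-≤ x≤ (≤-trans (^-monoˡ-≤ 1≤x x≤n (<⇒≤ 0<α)) n^α≤γ) ⟩
            (fromℕ (origin k) + fromℕ (32 ℕ.* γ)) + fromℕ γ  ≈⟨ trans (fromℕ-+ (origin k ℕ.+ 32 ℕ.* γ) γ) (+-congʳ (fromℕ-+ (origin k) (32 ℕ.* γ))) ⟨
            fromℕ (origin k ℕ.+ 32 ℕ.* γ ℕ.+ γ)              ≤⟨ fromℕ-mono-≤ (ℕ.≤-trans (ℕ.≤-reflexive (ℕ.+-assoc (origin k) (32 ℕ.* γ) γ))
                                                                  (ℕ.+-monoʳ-≤ (origin k) (ℕ.≤-trans (ℕ.≤-reflexive (ℕ.+-comm (32 ℕ.* γ) γ)) (ℕ.*-monoˡ-≤ γ (ℕ.≤ᵇ⇒≤ 33 64 _))))) ⟩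
            fromℕ (origin k ℕ.+ ℓ)                           ∎)
          few : fromℕ (length (filter (λ p → em) (blockPrimes k))) < fromℕ 5 ^ α ⁻¹
          few = <-≤-trans (fromℕ-mono-< (ℕ.≤-<-trans (length-filter (λ p → em) (blockPrimes k)) sparse))
            (^-lower-ℕ (5 ℕ.^ kk) kk 1 (ℕ.s≤s ℕ.z≤n) (ℕ.s≤s ℕ.z≤n)
              (≤-trans kk≤α⁻¹ (≤-reflexive (sym (trans (*-congʳ fromℕ-1) (*-identityˡ _)))))
              (ℕ.≤-reflexive (ℕ.*-identityʳ (5 ℕ.^ kk))))

        few-sparse-blocks : fromℕ (length (sparseBlocks kk M)) * fromℕ (32 ℕ.* γ) ≤ measure (Exceptional α n)
        few-sparse-blocks = measure-≥ (exceptional-cover n) (λ k → fromℕ (origin k)) (fromℕ (32 ℕ.* γ)) (0≤fromℕ (32 ℕ.* γ))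
          (λ k → ≤-trans (≤-reflexive (sym (fromℕ-+ (origin k) (32 ℕ.* γ)))) (fromℕ-mono-≤ (ℕ.≤-trans
            (ℕ.+-monoʳ-≤ (origin k) (ℕ.*-monoˡ-≤ γ (ℕ.≤ᵇ⇒≤ 32 64 _))) (ℕ.≤-reflexive (ℕ.+-comm (origin k) (64 ℕ.* γ))))))
          (sparse? kk) M (λ k<M → sparse⇒exceptional k<M)

      multiple-≥ : ∀ {d} → 0# < d → ∀ c → ∃[ q ] fromℕ c ≤ fromℕ q * d
      multiple-≥ {d} 0<d c = let q , le = archimedean (fromℕ c * d ⁻¹) in q , (begin
        fromℕ c                  ≈⟨ *-identityʳ (fromℕ c) ⟨
        fromℕ c * 1#             ≈⟨ *-congˡ (trans (*-comm (d ⁻¹) d) (*-inverse 0<d)) ⟨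
        fromℕ c * (d ⁻¹ * d)     ≈⟨ *-assoc (fromℕ c) (d ⁻¹) d ⟨
        fromℕ c * d ⁻¹ * d       ≤⟨ *-monoˡ-≤ (<⇒≤ 0<d) le ⟩
        fromℕ q * d              ∎)
        where open ≤-Reasoning

      y+[x-y]≈x : ∀ x y → y + (x - y) ≈ x
      y+[x-y]≈x x y = trans (+-comm y (x - y)) (x-z+z≈x x y)

      -- Any large q works: p is ν q rounded up, r is q α rounded down, and the gaps `d₁` and `d₂`,
      -- multiplied by q, outgrow the rounding errors. The gap `d₂` is positive because kk is 1/α
      -- rounded down.
      exponents : ∀ {ν} → 0# ≤ ν → ν < fromℕ 3 * α → ∃[ p ] ∃[ q ] ∃[ r ] ∃[ kk ]
        ν * fromℕ q ≤ fromℕ p × fromℕ r ≤ fromℕ q * α × fromℕ kk ≤ α ⁻¹ ×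
        1 ℕ.≤ q × 1 ℕ.≤ r × suc p ℕ.≤ 3 ℕ.* r × q ℕ.≤ r ℕ.* suc kk
      exponents {ν} 0≤ν ν<3α = p , q , r , kk , νq≤p , r≤qα , kk≤α⁻¹ , ℕ.s≤s ℕ.z≤n , 1≤r , p<3r , q≤r[1+kk]
        where
        open ≤-Reasoning
        0<α⁻¹ = 0<⇒0<⁻¹ 0<α
        floor-α⁻¹ = floor (<⇒≤ 0<α⁻¹)
        kk = proj₁ floor-α⁻¹
        kk≤α⁻¹ = proj₁ (proj₂ floor-α⁻¹)
        1<[1+kk]α : 1# < fromℕ (suc kk) * α
        1<[1+kk]α = ≤-<-trans (≤-reflexive (sym (trans (*-comm (α ⁻¹) α) (*-inverse 0<α)))) (*-monoˡ-< 0<α (proj₂ (proj₂ floor-α⁻¹)))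
        d₁ = fromℕ 3 * α - ν
        d₂ = fromℕ (suc kk) * α - 1#
        -- Rounding ν q up costs 1, rounding q α down costs 3 in 3 r, and p + 1 in place of p costs
        -- 1.
        multiple₁ = multiple-≥ (0<y-x ν<3α) 5
        multiple₂ = multiple-≥ (0<y-x 1<[1+kk]α) (suc kk)
        q = suc (proj₁ multiple₁ ℕ.+ proj₁ multiple₂)
        5≤qd₁ : fromℕ 5 ≤ fromℕ q * d₁
        5≤qd₁ = ≤-trans (proj₂ multiple₁) (*-monoˡ-≤ (<⇒≤ (0<y-x ν<3α)) (fromℕ-mono-≤ {proj₁ multiple₁} {q} (ℕ.m≤n⇒m≤1+n (ℕ.m≤m+n (proj₁ multiple₁) (proj₁ multiple₂)))))
        kk<qd₂ : fromℕ (suc kk) ≤ fromℕ q * d₂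
        kk<qd₂ = ≤-trans (proj₂ multiple₂) (*-monoˡ-≤ (<⇒≤ (0<y-x 1<[1+kk]α)) (fromℕ-mono-≤ {proj₁ multiple₂} {q} (ℕ.m≤n⇒m≤1+n (ℕ.m≤n+m (proj₁ multiple₂) (proj₁ multiple₁)))))
        ceiling-νq = ceiling (*-nonneg 0≤ν (0≤fromℕ q))
        p = proj₁ ceiling-νq
        νq≤p = proj₁ (proj₂ ceiling-νq)
        floor-qα = floor (*-nonneg (0≤fromℕ q) (<⇒≤ 0<α))
        r = proj₁ floor-qα
        r≤qα = proj₁ (proj₂ floor-qα)
        p<3r : suc p ℕ.≤ 3 ℕ.* r
        p<3r = ℕ.<⇒≤ (ℕ.+-cancelˡ-< 3 (suc p) (3 ℕ.* r) (ℕ.<-≤-trans (ℕ.≤-<-trans (ℕ.≤-reflexive (ℕ.+-suc 3 p)) 4+p<) (ℕ.≤-reflexive (ℕ.*-suc 3 r))))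
          where
          4+p< : 4 ℕ.+ p ℕ.< 3 ℕ.* suc r
          4+p< = fromℕ-cancel-< (begin-strict
            fromℕ (4 ℕ.+ p)                        ≈⟨ fromℕ-+ 4 p ⟩
            fromℕ 4 + fromℕ p                      ≤⟨ +-monoʳ-≤ (fromℕ 4) (proj₂ (proj₂ ceiling-νq)) ⟩
            fromℕ 4 + (ν * fromℕ q + 1#)           ≈⟨ trans (+-comm (fromℕ 4) _) (+-assoc (ν * fromℕ q) 1# (fromℕ 4)) ⟩
            ν * fromℕ q + fromℕ 5                  ≤⟨ +-mono-≤ (≤-reflexive (*-comm ν (fromℕ q))) 5≤qd₁ ⟩
            fromℕ q * ν + fromℕ q * d₁             ≈⟨ distribˡ (fromℕ q) ν d₁ ⟨
            fromℕ q * (ν + d₁)                     ≈⟨ *-congˡ (y+[x-y]≈x (fromℕ 3 * α) ν) ⟩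
            fromℕ q * (fromℕ 3 * α)                ≈⟨ trans (*-congˡ (*-comm (fromℕ 3) α)) (sym (*-assoc (fromℕ q) α (fromℕ 3))) ⟩
            fromℕ q * α * fromℕ 3                  <⟨ *-monoˡ-< (fromℕ-mono-< {0} {3} (ℕ.s≤s ℕ.z≤n)) (proj₂ (proj₂ floor-qα)) ⟩
            fromℕ (suc r) * fromℕ 3                ≈⟨ trans (fromℕ-* 3 (suc r)) (*-comm (fromℕ 3) (fromℕ (suc r))) ⟨
            fromℕ (3 ℕ.* suc r)                    ∎)
        1≤r : 1 ℕ.≤ r
        1≤r = ℕ.n≢0⇒n>0 λ r≡0 → ℕ.<⇒≱ p<3r (ℕ.≤-trans (ℕ.≤-reflexive (≡.cong (3 ℕ.*_) r≡0)) ℕ.z≤n)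
        q≤r[1+kk] : q ℕ.≤ r ℕ.* suc kk
        q≤r[1+kk] = ℕ.<⇒≤ (ℕ.+-cancelˡ-< (suc kk) q (r ℕ.* suc kk) (ℕ.≤-<-trans (ℕ.≤-reflexive (ℕ.+-comm (suc kk) q)) (fromℕ-cancel-< (begin-strict
          fromℕ (q ℕ.+ suc kk)                     ≈⟨ fromℕ-+ q (suc kk) ⟩
          fromℕ q + fromℕ (suc kk)                 ≤⟨ +-mono-≤ (≤-reflexive (sym (*-identityʳ (fromℕ q)))) kk<qd₂ ⟩
          fromℕ q * 1# + fromℕ q * d₂              ≈⟨ distribˡ (fromℕ q) 1# d₂ ⟨
          fromℕ q * (1# + d₂)                      ≈⟨ *-congˡ (y+[x-y]≈x (fromℕ (suc kk) * α) 1#) ⟩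
          fromℕ q * (fromℕ (suc kk) * α)           ≈⟨ trans (*-congˡ (*-comm (fromℕ (suc kk)) α)) (sym (*-assoc (fromℕ q) α (fromℕ (suc kk)))) ⟩
          fromℕ q * α * fromℕ (suc kk)             <⟨ *-monoˡ-< (fromℕ-mono-< {0} {suc kk} (ℕ.s≤s ℕ.z≤n)) (proj₂ (proj₂ floor-qα)) ⟩
          fromℕ (suc r) * fromℕ (suc kk)           ≈⟨ fromℕ-* (suc r) (suc kk) ⟨
          fromℕ (suc r ℕ.* suc kk)                 ∎))))

      count-blocks : ∀ {n ℓ} → 1 ℕ.≤ ℓ → ℓ ℕ.≤ n → ∃[ M ] suc M ℕ.* ℓ ℕ.≤ n × n ℕ.< (2 ℕ.+ M) ℕ.* ℓ
      count-blocks {n} {ℓ} 1≤ℓ ℓ≤n = go (n ℕ./ ℓ) (m≡m%n+[m/n]*n n ℓ)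
        where
        instance _ = ℕ.>-nonZero 1≤ℓ
        go : ∀ Q → n ≡ n ℕ.% ℓ ℕ.+ Q ℕ.* ℓ → ∃[ M ] suc M ℕ.* ℓ ℕ.≤ n × n ℕ.< (2 ℕ.+ M) ℕ.* ℓ
        go zero    eq = contradiction ℓ≤n (ℕ.<⇒≱ (ℕ.≤-<-trans (ℕ.≤-reflexive (≡.trans eq (ℕ.+-identityʳ _))) (m%n<n n ℓ)))
        go (suc M) eq = M , ℕ.≤-trans (ℕ.m≤n+m _ (n ℕ.% ℓ)) (ℕ.≤-reflexive (≡.sym eq)) ,
          ℕ.≤-<-trans (ℕ.≤-reflexive eq) (ℕ.+-monoˡ-< (suc M ℕ.* ℓ) (m%n<n n ℓ))

      module LargeN (ν : ℝ) (0≤ν : 0# ≤ ν) (p q r kk : ℕ) (νq≤p : ν * fromℕ q ≤ fromℕ p) (r≤qα : fromℕ r ≤ fromℕ q * α)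
        (kk≤α⁻¹ : fromℕ kk ≤ α ⁻¹) (1≤q : 1 ℕ.≤ q) (1≤r : 1 ℕ.≤ r) (p<3r : suc p ℕ.≤ 3 ℕ.* r) (q≤r[1+kk] : q ℕ.≤ r ℕ.* suc kk) where

        open Exponents p q r kk 1≤q 1≤r p<3r q≤r[1+kk] public using (threshold)
        private module E = Exponents p q r kk 1≤q 1≤r p<3r q≤r[1+kk]

        g≤[192γ] : ∀ {n γ} → 1 ℕ.≤ n → threshold ℕ.≤ n → measure (Exceptional α n) ≤ fromℕ n ^ ν →
                   1 ℕ.≤ γ → fromℕ n ^ α ≤ fromℕ γ → g n ≤ fromℕ (3 ℕ.* (64 ℕ.* γ))
        g≤[192γ] {n} {γ} 1≤n threshold≤n small-measure 1≤γ n^α≤γ with 64 ℕ.* γ ℕ.≤? n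
        ... | no  ℓ≰n = g≤trivial (ℕ.≤-trans (ℕ.<⇒≤ (ℕ.≰⇒> ℓ≰n)) (ℕ.m≤n*m (64 ℕ.* γ) 3))
        ... | yes ℓ≤n =
          let M , blocks≤n , n< = count-blocks 1≤ℓ ℓ≤n
          in g≤blocks {n} {64 ℕ.* γ} {M} 1≤ℓ n<
            (Construction.hitting-sidon-set em n γ (64 ℕ.* γ) kk (E.maxDivisors {n} {γ} threshold≤n n^r<) M ≡.refl
              (E.64≤γ {n} {γ} threshold≤n n^r<) (E.n<2^γ {n} {γ} threshold≤n n^r<) (E.n<[64γ]^[1+kk] {n} {γ} threshold≤n n^r<) blocks≤n
              E.divisorsOf E.divisorsOf-complete (E.divisorsOf-length {n} {γ} threshold≤n n^r<)
              (E.few-sparse {n} {γ} threshold≤n n^r< (length (Blocks.sparseBlocks (64 ℕ.* γ) kk M)) (sparse-count M blocks≤n)))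
          where
          1≤ℓ : 1 ℕ.≤ 64 ℕ.* γ
          1≤ℓ = ℕ.*-mono-≤ {1} {64} (ℕ.s≤s ℕ.z≤n) 1≤γ
          n^r< : n ℕ.^ r ℕ.< (64 ℕ.* γ) ℕ.^ q
          -- Otherwise 64 γ ≤ n^(r/q) ≤ n^α ≤ γ.
          n^r< = ℕ.≰⇒> λ le → ℕ.<⇒≱ (ℕ.*-monoˡ-< γ {{ℕ.>-nonZero 1≤γ}} {1} {64} (ℕ.s≤s (ℕ.s≤s ℕ.z≤n)))
            (ℕ.≤-trans (fromℕ-cancel-≤ (≤-trans (^-lower-ℕ (64 ℕ.* γ) r q 1≤n 1≤q r≤qα le) n^α≤γ)) (ℕ.≤-reflexive (≡.sym (ℕ.*-identityˡ γ))))
          sparse-count : ∀ M → suc M ℕ.* (64 ℕ.* γ) ℕ.≤ n →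
            (16 ℕ.* (length (Blocks.sparseBlocks (64 ℕ.* γ) kk M) ℕ.* γ)) ℕ.^ q ℕ.≤ n ℕ.^ p
          sparse-count M blocks≤n = halve (length (Blocks.sparseBlocks (64 ℕ.* γ) kk M))
            (Sparse.few-sparse-blocks {n} {γ} {kk} {M} 1≤γ n^α≤γ blocks≤n kk≤α⁻¹)
            where
            -- Here w is n^(p/q) rounded up. The factor 2 lost by rounding turns 32 γ, the length of
            -- half a block, into 16 γ.
            root = ceiling-root (n ℕ.^ p) q (^-positive p 1≤n) 1≤q
            w = proj₁ root
            halve : ∀ m → fromℕ m * fromℕ (32 ℕ.* γ) ≤ measure (Exceptional α n) → (16 ℕ.* (m ℕ.* γ)) ℕ.^ q ℕ.≤ n ℕ.^ p
            halve m m32γ≤ = ℕ.*-cancelˡ-≤ (2 ℕ.^ q) {{ℕ.m^n≢0 2 q}} (begin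
              2 ℕ.^ q ℕ.* (16 ℕ.* (m ℕ.* γ)) ℕ.^ q   ≡⟨ ^-distribʳ-* 2 (16 ℕ.* (m ℕ.* γ)) q ⟨
              (2 ℕ.* (16 ℕ.* (m ℕ.* γ))) ℕ.^ q       ≡⟨ ≡.cong (ℕ._^ q) (double-16 m γ) ⟩
              (m ℕ.* (32 ℕ.* γ)) ℕ.^ q               ≤⟨ ℕ.^-monoˡ-≤ q m32γ≤w ⟩
              w ℕ.^ q                                ≤⟨ proj₂ (proj₂ root) ⟩
              2 ℕ.^ q ℕ.* n ℕ.^ p                    ∎)
              where
              open ℕ.≤-Reasoning
              m32γ≤w : m ℕ.* (32 ℕ.* γ) ℕ.≤ w
              m32γ≤w = fromℕ-cancel-≤ (≤-trans (≤-reflexive (fromℕ-* m (32 ℕ.* γ))) (≤-trans m32γ≤ (≤-trans small-measure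
                (^-upper-ℕ w p q 1≤n 0≤ν 1≤q νq≤p (proj₁ (proj₂ root))))))

      bound : exceptionalExponent α < fromℕ 3 * α → ∃[ K ] 0# < K × (∀ n → 1 ℕ.≤ n → g n ≤ K * fromℕ n ^ α)
      bound λ<3α =
        let ν , 0≤ν , ν<3α , N , small-measure = measure-exceptional λ<3α
            p , q , r , kk , νq≤p , r≤qα , kk≤α⁻¹ , 1≤q , 1≤r , p<3r , q≤ = exponents 0≤ν ν<3α
        in conclude N (λ n → fromℕ n ^ ν) small-measure (LargeN.threshold ν 0≤ν p q r kk νq≤p r≤qα kk≤α⁻¹ 1≤q 1≤r p<3r q≤)
             (λ {n} {γ} → LargeN.g≤[192γ] ν 0≤ν p q r kk νq≤p r≤qα kk≤α⁻¹ 1≤q 1≤r p<3r q≤ {n} {γ})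
        where
        conclude : ∀ N (E : ℕ → ℝ) → (∀ n → N ℕ.≤ n → measure (Exceptional α n) ≤ E n) → ∀ n₀ →
          (∀ {n γ} → 1 ℕ.≤ n → n₀ ℕ.≤ n → measure (Exceptional α n) ≤ E n → 1 ℕ.≤ γ → fromℕ n ^ α ≤ fromℕ γ → g n ≤ fromℕ (3 ℕ.* (64 ℕ.* γ))) →
          ∃[ K ] 0# < K × (∀ n → 1 ℕ.≤ n → g n ≤ K * fromℕ n ^ α)
        conclude N E small n₀ large = fromℕ K , fromℕ-mono-< {0} {K} (ℕ.s≤s ℕ.z≤n) , g≤
          where
          n₁ = N ℕ.+ n₀
          -- For n < n₁ the trivial bound g n ≤ n suffices. For other n, the bound 3 · 64 γ with γ ≤
          -- n^α + 1 ≤ 2 n^α gives 384 n^α.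
          K = suc (384 ℕ.+ n₁)
          g≤ : ∀ n → 1 ℕ.≤ n → g n ≤ fromℕ K * fromℕ n ^ α
          g≤ n 1≤n with n₁ ℕ.≤? n
          ... | no n₁≰n = begin
              g n                            ≤⟨ g≤trivial ℕ.≤-refl ⟩
              fromℕ n                        ≤⟨ fromℕ-mono-≤ (ℕ.≤-trans (ℕ.<⇒≤ (ℕ.≰⇒> n₁≰n)) (ℕ.m≤n⇒m≤1+n (ℕ.m≤n+m n₁ 384))) ⟩
              fromℕ K                        ≈⟨ *-identityʳ (fromℕ K) ⟨
              fromℕ K * 1#                   ≤⟨ *-monoʳ-≤ (0≤fromℕ K) (1≤^ (1≤fromℕ 1≤n) (<⇒≤ 0<α)) ⟩
              fromℕ K * fromℕ n ^ α          ∎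
            where open ≤-Reasoning
          ... | yes n₁≤n =
            let θ = fromℕ n ^ α
                1≤θ = 1≤^ (1≤fromℕ 1≤n) (<⇒≤ 0<α)
                γ , θ≤γ , γ≤θ+1 = ceiling {θ} (≤-trans 0≤1 1≤θ)
                1≤γ = fromℕ-cancel-≤ {1} {γ} (≤-trans (≤-reflexive fromℕ-1) (≤-trans 1≤θ θ≤γ))
            in begin
              g n                            ≤⟨ large 1≤n (ℕ.≤-trans (ℕ.m≤n+m n₀ N) n₁≤n) (small n (ℕ.≤-trans (ℕ.m≤m+n N n₀) n₁≤n)) 1≤γ θ≤γ ⟩
              fromℕ (3 ℕ.* (64 ℕ.* γ))       ≡⟨ ≡.cong fromℕ (≡.sym (ℕ.*-assoc 3 64 γ)) ⟩
              fromℕ (192 ℕ.* γ)              ≈⟨ fromℕ-* 192 γ ⟩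
              fromℕ 192 * fromℕ γ            ≤⟨ *-monoʳ-≤ (0≤fromℕ 192) (≤-trans γ≤θ+1 (+-monoʳ-≤ θ 1≤θ)) ⟩
              fromℕ 192 * (θ + θ)            ≈⟨ trans (distribˡ (fromℕ 192) θ θ) (sym (distribʳ θ (fromℕ 192) (fromℕ 192))) ⟩
              (fromℕ 192 + fromℕ 192) * θ    ≈⟨ *-congʳ (fromℕ-+ 192 192) ⟨
              fromℕ 384 * θ                  ≤⟨ *-monoˡ-≤ (≤-trans 0≤1 1≤θ) (fromℕ-mono-≤ {384} {K} (ℕ.m≤n⇒m≤1+n (ℕ.m≤m+n 384 n₁))) ⟩
              fromℕ K * θ                    ∎
            where open ≤-Reasoning

theorem3p2 : (em : ExcludedMiddle 0ℓ) (R : CompleteOrderedField) →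
    let open Analysis em R in
    (α : ℝ) → 0# < α →
    exceptionalExponent α < fromℕ 3 * α →
    ∃[ K ] 0# < K × (∀ (n : ℕ) → 1 ℕ.≤ n → g n ≤ K * fromℕ n ^ α)
theorem3p2 em R α 0<α = Analytic.MainTheorem.bound em R α 0<α
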